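{- There is an algorithm that, given a Boolean TDD $D$ over a vtree $(T,b)$ on a variable set $X$ and a d-SDNNF $D'$ on $X$ respecting an arbitrary vtree over $X$, decides whether $D\equiv D'$ in time polynomial in $|D|+|D'|$.
   Context: **Vtree.** A variable tree (vtree) over a finite variable set $X$ is a pair $(T,b)$ where $T$ is a rooted full binary tree (every node has 0 or 2 children) and $b$ is a bijection from the leaves of $T$ to $X$. **TDD.** A Tree Decision Diagram over the vtree $(T,b)$ is a tuple $D=((T,b),N,E,\mathrm{out},\lambda)$ where: - $N$ maps each $t\in V(T)$ to a finite nonempty set $N(t)$, with $N(t_1)\cap N(t_2)=\emptyset$ for $t_1\neq t_2$. - For every non-leaf $t\in V(T)$ with children $t_1,t_2$ (in an arbitrary but fixed order), $E$ assigns to each $u\in N(t)$ a set $E(u)\subseteq N(t_1)\times N(t_2)$, and the sets $\{E(u)\mid u\in N(t)\}$ form a partition of $N(t_1)\times N(t_2)$ (for distinct $u$ they are nonempty and disjoint, and together they cover everything). - $\mathrm{out}$ is a set of output labels with $|\mathrm{out}|=|N(r)|$, where $r$ is the root of $T$, and $\lambda:\mathrm{out}\to N(r)$ is a bijection. Semantics: if $t$ is a leaf with $b(t)=x$, each $u\in N(t)$ carries a label $D[u]\in\{x,\neg x,0,1\}$; for distinct $u_1,u_2\in N(t)$ the functions $D[u_1],D[u_2]$ are not simultaneously satisfiable, and (completeness) each of the two values of $x$ satisfies some $D[u]$ with $u\in N(t)$. If $t$ is not a leaf and $u\in N(t)$, then $D[u]=\bigvee_{(v,w)\in E(u)}(D[v]\wedge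 D[w])$. For $\ell\in\mathrm{out}$ put $D[\ell]:=D[\lambda(\ell)]$. The size is $|D|=\sum_{t\in V(T)}|N(t)|$. **Boolean TDD.** A TDD $D$ is Boolean if its output set is $\{0,1\}$; the function computed by $D$ is $D[1]$. **d-SDNNF.** A deterministic structured decomposable negation normal form (d-SDNNF) respecting a vtree $(T',b')$ over $X$ is a Boolean circuit with one output gate whose inputs are constants and literals over $X$ and whose inner gates are $\wedge$-gates of fan-in two and $\vee$-gates, such that: for every $\wedge$-gate with inputs $g_1,g_2$ there is an internal node $t$ of $T'$ with children $t_1,t_2$ such that the variables occurring below $g_1$ label leaves of the subtree at $t_1$ and those occurring below $g_2$ label leaves of the subtree at $t_2$ (or vice versa); and for every $\vee$-gate, its inputs are pairwise not simultaneously satisfiable. The vtree is given with the circuit, and $|D'|$ denotes the size of the representation. $D\equiv D'$ means that $D$ and $D'$ compute the same Boolean function on $X$. -}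

module Defs where

open import Data.Bool.Base using (Bool; true; false; _∧_; not; if_then_else_)
open import Data.Bool.ListAction using (any)
open import Data.Empty using (⊥)
open import Data.Fin.Base using (Fin; zero; suc; toℕ)
open import Data.List.Base
  using (List; []; _∷_; length; map; allFin; cartesianProduct; filterᵇ)
open import Data.List.Relation.Unary.AllPairs using (AllPairs)
open import Data.List.Relation.Unary.Any using (Any)
open import Data.Nat.Base using (ℕ; zero; suc; _+_; _≤_)
open import Data.Product using (_×_; _,_; ∃-syntax)
open import Data.Sum.Base using (_⊎_; inj₁; inj₂)
open import Data.Unit.Base using (⊤)
open import Data.Vec.Base using (Vec; []; _∷_; lookup)
open import Function.Bundles using (_⇔_; _⤖_; module Bijection)
open import Function.Definitions using (Bijective)
open import Relation.Binary.PropositionalEquality.Core using (_≡_; _≢_)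
open import Relation.Nullary.Negation.Core using (¬_)
open import Relation.Unary using (Pred; _⊆_)
open import Level using (0ℓ)

------------------------------------------------------------------------
-- Boolean functions

BoolFun : Set → Set
BoolFun X = (X → Bool) → Bool

NotSimultaneouslySat : {X : Set} → BoolFun X → BoolFun X → Set
NotSimultaneouslySat f g = ∀ α → ¬ (f α ≡ true × g α ≡ true)

infix 4 _≋_
_≋_ : {X : Set} → BoolFun X → BoolFun X → Set
f ≋ g = ∀ α → f α ≡ g α

------------------------------------------------------------------------
-- Vtrees

data Tree (X : Set) : Set where
  leaf : X → Tree X
  node : Tree X → Tree X → Tree X

Leaf : {X : Set} → Tree X → Set
Leaf (leaf _)   = ⊤
Leaf (node l r) = Leaf l ⊎ Leaf r

label : {X : Set} (T : Tree X) → Leaf T → X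
label (leaf x)   _        = x
label (node l r) (inj₁ p) = label l p
label (node l r) (inj₂ p) = label r p

record Vtree (X : Set) : Set where
  field
    tree      : Tree X
    bijective : Bijective _≡_ _≡_ (label tree)
open Vtree public

LeafVars : {X : Set} → Tree X → Pred X 0ℓ
LeafVars T x = ∃[ p ] label T p ≡ x

-- Internal T l r: some internal node of T has children (rooting) l and r.
data Internal {X : Set} : Tree X → Tree X → Tree X → Set where
  here  : ∀ {l r} → Internal (node l r) l r
  left  : ∀ {l r t₁ t₂} → Internal l t₁ t₂ → Internal (node l r) t₁ t₂
  right : ∀ {l r t₁ t₂} → Internal r t₁ t₂ → Internal (node l r) t₁ t₂

treeSize : {X : Set} → Tree X → ℕ
treeSize (leaf _)   = 1
treeSize (node l r) = suc (treeSize l + treeSize r)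

------------------------------------------------------------------------
-- Tree decision diagrams

data LeafLabel : Set where
  pos neg bot top : LeafLabel

⟦_⟧ˡ : LeafLabel → Bool → Bool
⟦ pos ⟧ˡ b = b
⟦ neg ⟧ˡ b = not b
⟦ bot ⟧ˡ b = false
⟦ top ⟧ˡ b = true

record IsPartition {I A : Set} (E : I → A → Bool) : Set where
  field
    nonempty : ∀ u → ∃[ a ] E u a ≡ true
    disjoint : ∀ {u v} → u ≢ v → ∀ a → ¬ (E u a ≡ true × E v a ≡ true)
    covering : ∀ a → ∃[ u ] E u a ≡ true

-- The sets N(t), for t in the tree, together with E and the leaf labels.  The
-- ℕ index is |N(root)|.  Each N(t) is Fin (suc k) for some k, so it is
-- nonempty; the N(t) are tagged by their position t and hence disjoint.  The
-- set E(u) is given by its characteristic function.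
data Nodes {X : Set} : Tree X → ℕ → Set where
  leaf : ∀ {x k} (ℓ : Fin (suc k) → LeafLabel) →
         (∀ {u v} → u ≢ v →
            NotSimultaneouslySat (λ (α : X → Bool) → ⟦ ℓ u ⟧ˡ (α x))
                                 (λ α → ⟦ ℓ v ⟧ˡ (α x))) →
         (∀ b → ∃[ u ] ⟦ ℓ u ⟧ˡ b ≡ true) →
         Nodes (leaf x) (suc k)
  node : ∀ {l r k₁ k₂ k} → Nodes l k₁ → Nodes r k₂ →
         (E : Fin (suc k) → Fin k₁ × Fin k₂ → Bool) → IsPartition E →
         Nodes (node l r) (suc k)

elements : ∀ {k₁ k₂} → (Fin k₁ × Fin k₂ → Bool) → List (Fin k₁ × Fin k₂)
elements {k₁} {k₂} S = filterᵇ S (cartesianProduct (allFin k₁) (allFin k₂))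

-- eval N u is D[u].
eval : ∀ {X} {T : Tree X} {k} → Nodes T k → Fin k → BoolFun X
eval (leaf {x = x} ℓ _ _) u α = ⟦ ℓ u ⟧ˡ (α x)
eval (node N₁ N₂ E _)     u α =
  any (λ (v , w) → eval N₁ v α ∧ eval N₂ w α) (elements (E u))

nodeCount : ∀ {X} {T : Tree X} {k} → Nodes T k → ℕ
nodeCount (leaf {k = k} _ _ _)     = suc k
nodeCount (node {k = k} N₁ N₂ _ _) = suc k + (nodeCount N₁ + nodeCount N₂)

-- |Out| = |N(root)| follows from the bijection.
record TDD {X : Set} (Out : Set) (V : Vtree X) : Set where
  field
    width   : ℕ
    nodes   : Nodes (tree V) width
    outNode : Out ⤖ Fin width

  output : Out → BoolFun X
  output o = eval nodes (Bijection.to outNode o)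

  size : ℕ
  size = nodeCount nodes

BooleanTDD : {X : Set} → Vtree X → Set
BooleanTDD = TDD Bool

computedByTDD : ∀ {X} {V : Vtree X} → BooleanTDD V → BoolFun X
computedByTDD D = TDD.output D true

------------------------------------------------------------------------
-- Circuits and d-SDNNFs

-- A gate whose inputs are among m given gates.
data Gate (X : Set) (m : ℕ) : Set where
  const : Bool → Gate X m
  lit   : X → Bool → Gate X m          -- lit x true is x, lit x false is ¬x
  and   : Fin m → Fin m → Gate X m
  or    : List (Fin m) → Gate X m

-- Gates in topological order, the latest one having index zero.
data Circuit (X : Set) : ℕ → Set where
  []  : Circuit X 0
  _▷_ : ∀ {m} → Circuit X m → Gate X m → Circuit X (suc m)

evalGate : ∀ {X m} → Gate X m → (X → Bool) → (Fin m → Bool) → Bool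
evalGate (const b) α val = b
evalGate (lit x b) α val = if b then α x else not (α x)
evalGate (and i j) α val = val i ∧ val j
evalGate (or is)   α val = any val is

evalCircuit : ∀ {X m} → Circuit X m → Fin m → BoolFun X
evalCircuit (C ▷ g) zero    α = evalGate g α (λ i → evalCircuit C i α)
evalCircuit (C ▷ g) (suc i) α = evalCircuit C i α

gateVars : ∀ {X m} → Gate X m → (Fin m → Pred X 0ℓ) → Pred X 0ℓ
gateVars (const _) below x = ⊥
gateVars (lit y _) below x = x ≡ y
gateVars (and i j) below x = below i x ⊎ below j x
gateVars (or is)   below x = Any (λ i → below i x) is

VarsBelow : ∀ {X m} → Circuit X m → Fin m → Pred X 0ℓ
VarsBelow (C ▷ g) zero    = gateVars g (VarsBelow C)
VarsBelow (C ▷ g) (suc i) = VarsBelow C i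

-- P is applied to each gate and the circuit of the gates preceding it.
EveryGate : ∀ {X} → (∀ {m} → Circuit X m → Gate X m → Set) →
            ∀ {m} → Circuit X m → Set
EveryGate P []      = ⊤
EveryGate P (C ▷ g) = EveryGate P C × P C g

StructuredGate : ∀ {X} → Tree X → ∀ {m} → Circuit X m → Gate X m → Set
StructuredGate T C (and i j) = ∃[ t₁ ] ∃[ t₂ ] Internal T t₁ t₂ ×
  ( (VarsBelow C i ⊆ LeafVars t₁ × VarsBelow C j ⊆ LeafVars t₂)
  ⊎ (VarsBelow C i ⊆ LeafVars t₂ × VarsBelow C j ⊆ LeafVars t₁) )
StructuredGate T C _         = ⊤

DeterministicGate : ∀ {X m} → Circuit X m → Gate X m → Set
DeterministicGate C (or is) =
  AllPairs (λ i j → NotSimultaneouslySat (evalCircuit C i) (evalCircuit C j)) is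
DeterministicGate C _       = ⊤

-- A gate counts 1 plus its number of input wires.
gateSize : ∀ {X m} → Gate X m → ℕ
gateSize (const _) = 1
gateSize (lit _ _) = 1
gateSize (and _ _) = 3
gateSize (or is)   = 1 + length is

circuitSize : ∀ {X m} → Circuit X m → ℕ
circuitSize []      = 0
circuitSize (C ▷ g) = circuitSize C + gateSize g

record DSDNNF {X : Set} (V : Vtree X) : Set where
  field
    gates         : ℕ
    circuit       : Circuit X gates
    outputGate    : Fin gates
    structured    : EveryGate (StructuredGate (tree V)) circuit
    deterministic : EveryGate DeterministicGate circuit

  -- The vtree is part of the representation.
  size : ℕ
  size = circuitSize circuit + treeSize (tree V)

computedByDSDNNF : ∀ {X} {V : Vtree X} → DSDNNF V → BoolFun X
computedByDSDNNF D = evalCircuit (DSDNNF.circuit D) (DSDNNF.outputGate D)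

------------------------------------------------------------------------
-- Model of computation
--
-- The untyped call-by-value λ-calculus with recursive functions over binary
-- trees, with environments and closures.  Time is the number of rule instances
-- in the evaluation derivation.  Since values can be shared, each rule is a
-- constant number of pointer operations for a fixed program, and conversely
-- Turing machines are simulated with constant overhead per step (the tape being
-- two lists), so polynomial time here is the usual notion (cf. Blelloch and
-- Greiner, "Parallelism in sequential functional languages", 1995).

-- Terms with n free variables (de Bruijn indices).  Both fun and the last
-- branch of case bind two variables: fun binds its argument (index 0) and the
-- function itself (index 1); case binds the left (0) and right (1) subtree.
data Term (n : ℕ) : Set where
  var  : Fin n → Term n
  fun  : Term (2 + n) → Term n
  app  : Term n → Term n → Term n
  nil  : Term n
  cons : Term n → Term n → Term n
  case : Term n → Term n → Term (2 + n) → Term n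

infixr 5 _∙_
data Value : Set where
  nil     : Value
  _∙_     : Value → Value → Value
  closure : ∀ {n} → Vec Value n → Term (2 + n) → Value

-- ρ ⊢ e ⇓ v ⟨ t ⟩: in environment ρ, e evaluates to v in time t.
infix 3 _⊢_⇓_⟨_⟩
data _⊢_⇓_⟨_⟩ {n : ℕ} (ρ : Vec Value n) : Term n → Value → ℕ → Set where
  var : ∀ i → ρ ⊢ var i ⇓ lookup ρ i ⟨ 1 ⟩
  fun : ∀ e → ρ ⊢ fun e ⇓ closure ρ e ⟨ 1 ⟩
  app : ∀ {e₁ e₂ m} {σ : Vec Value m} {e v w t₁ t₂ t₃} →
        ρ ⊢ e₁ ⇓ closure σ e ⟨ t₁ ⟩ →
        ρ ⊢ e₂ ⇓ v ⟨ t₂ ⟩ →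
        (v ∷ closure σ e ∷ σ) ⊢ e ⇓ w ⟨ t₃ ⟩ →
        ρ ⊢ app e₁ e₂ ⇓ w ⟨ suc (t₁ + t₂ + t₃) ⟩
  nil : ρ ⊢ nil ⇓ nil ⟨ 1 ⟩
  cons : ∀ {e₁ e₂ v₁ v₂ t₁ t₂} →
         ρ ⊢ e₁ ⇓ v₁ ⟨ t₁ ⟩ →
         ρ ⊢ e₂ ⇓ v₂ ⟨ t₂ ⟩ →
         ρ ⊢ cons e₁ e₂ ⇓ v₁ ∙ v₂ ⟨ suc (t₁ + t₂) ⟩
  case-nil : ∀ {e e₁ e₂ w t₁ t₂} →
             ρ ⊢ e ⇓ nil ⟨ t₁ ⟩ →
             ρ ⊢ e₁ ⇓ w ⟨ t₂ ⟩ →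
             ρ ⊢ case e e₁ e₂ ⇓ w ⟨ suc (t₁ + t₂) ⟩
  case-cons : ∀ {e e₁ e₂ v₁ v₂ w t₁ t₂} →
              ρ ⊢ e ⇓ v₁ ∙ v₂ ⟨ t₁ ⟩ →
              (v₁ ∷ v₂ ∷ ρ) ⊢ e₂ ⇓ w ⟨ t₂ ⟩ →
              ρ ⊢ case e e₁ e₂ ⇓ w ⟨ suc (t₁ + t₂) ⟩

-- The free variable holds the input.
Program : Set
Program = Term 1

bool : Bool → Value
bool false = nil
bool true  = nil ∙ nil

DecidesWithin : Program → (input : Value) → Set → (time : ℕ) → Set
DecidesWithin M input P time = ∃[ answer ] ∃[ t ]
  ((input ∷ []) ⊢ M ⇓ bool answer ⟨ t ⟩) × t ≤ time × (answer ≡ true ⇔ P)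

------------------------------------------------------------------------
-- Encoding of the inputs
--
-- Numbers are written in unary; variables, nodes and gates are numbered, so
-- the size of the encoding is polynomial in the sizes defined above.

encℕ : ℕ → Value
encℕ zero    = nil
encℕ (suc n) = nil ∙ encℕ n

encFin : ∀ {n} → Fin n → Value
encFin i = encℕ (toℕ i)

encList : List Value → Value
encList []       = nil
encList (v ∷ vs) = v ∙ encList vs

encTree : ∀ {n} → Tree (Fin n) → Value
encTree (leaf x)   = encℕ 0 ∙ encFin x
encTree (node l r) = encℕ 1 ∙ encTree l ∙ encTree r

encLeafLabel : LeafLabel → Value
encLeafLabel pos = encℕ 0
encLeafLabel neg = encℕ 1
encLeafLabel bot = encℕ 2
encLeafLabel top = encℕ 3

encPairs : ∀ {k₁ k₂} → List (Fin k₁ × Fin k₂) → Value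
encPairs ps = encList (map (λ (v , w) → encFin v ∙ encFin w) ps)

encNodes : ∀ {n} {T : Tree (Fin n)} {k} → Nodes T k → Value
encNodes (leaf {x = x} {k = k} ℓ _ _) =
  encℕ 0 ∙ encFin x ∙ encList (map (λ u → encLeafLabel (ℓ u)) (allFin (suc k)))
encNodes (node {k = k} N₁ N₂ E _) =
  encℕ 1 ∙ encNodes N₁ ∙ encNodes N₂ ∙
  encList (map (λ u → encPairs (elements (E u))) (allFin (suc k)))

-- The vtree is contained in encNodes.
encTDD : ∀ {n} {V : Vtree (Fin n)} → BooleanTDD V → Value
encTDD D = encNodes nodes ∙ encFin (to false) ∙ encFin (to true)
  where
  open TDD D
  open Bijection outNode using (to)

encGate : ∀ {n m} → Gate (Fin n) m → Value
encGate (const b) = encℕ 0 ∙ bool b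
encGate (lit x b) = encℕ 1 ∙ encFin x ∙ bool b
encGate (and i j) = encℕ 2 ∙ encFin i ∙ encFin j
encGate (or is)   = encℕ 3 ∙ encList (map encFin is)

encCircuit : ∀ {n m} → Circuit (Fin n) m → Value
encCircuit []      = nil
encCircuit (C ▷ g) = encGate g ∙ encCircuit C

encDSDNNF : ∀ {n} {V : Vtree (Fin n)} → DSDNNF V → Value
encDSDNNF {V = V} D = encTree (tree V) ∙ encCircuit circuit ∙ encFin outputGate
  where open DSDNNF D

{-# OPTIONS --safe #-}

-- Write F for the function of the d-SDNNF.  Going up the vtree of the TDD, keep
-- for each satisfiable node u one partial assignment rep(u) satisfying D[u]; for
-- an inner node, all assignments rep(v) ∪ rep(w) with (v , w) ∈ E(u) are
-- candidates.  Then D ≡ F holds iff, at every node, all candidates have the same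
-- cofactor of F and, at the root, F has the right value at the representatives.
--
-- To compare the cofactors of F under α and β, consider everything over GF(2).  By
-- determinism ∨ is addition, so for a subtree S of the vtree of F and a fixed
-- assignment outside S, each gate is a linear functional of the vector of values
-- that all gates take, under α and under β, at an assignment of S that is
-- extended arbitrarily.  Hence it suffices to test assignments of S whose
-- vectors span all these vectors.  Such sets are computed bottom-up: concatenate
-- the members of the sets of both children and thin out by Gaussian elimination.
--
-- For the running time, all programs are composed by operations that preserve
-- polynomial bounds on both the cost and the size of the result; recursion along
-- the input does so if the size of its results is polynomially bounded.
module Submission where

open import Defs
open import Algebra.Bundles using (module CommutativeRing)
import Algebra.Properties.CommutativeSemigroup as CommutativeSemigroupProperties
open import Data.Bool.Base using (Bool; true; false; _∧_; _∨_; not; if_then_else_; _xor_)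
open import Data.Bool.ListAction using (any)
open import Data.Bool.Properties
  using (∧-zeroʳ; ∧-comm; xor-same; xor-identityʳ; xor-comm; xor-∧-commutativeRing; ¬-not; T?; T-≡)
open import Data.Empty using (⊥; ⊥-elim)
open import Data.Fin.Base using (Fin; zero; suc; toℕ)
import Data.Fin.Properties as Fin
open import Data.List.Base as List
  using (List; []; _∷_; _++_; length; map; allFin; tabulate; cartesianProduct)
open import Data.List.Membership.Propositional using (_∈_; find; lose)
open import Data.List.Membership.Propositional.Properties
  using (∈-cartesianProduct⁺; ∈-allFin; ∈-filter⁺; ∈-filter⁻; ∈-++⁺ˡ; ∈-++⁺ʳ)
open import Data.List.Properties using (length-filter; length-tabulate; length-++; length-map)
import Data.List.Relation.Unary.All as ListAll
open import Data.List.Relation.Unary.AllPairs using (AllPairs; []; _∷_)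
open import Data.List.Relation.Unary.Any as Any using (Any; here; there)
open import Data.List.Relation.Unary.Any.Properties using (any⁺; any⁻; lookup-index)
open import Data.Nat.Base
  using (ℕ; zero; suc; pred; _+_; _∸_; _*_; _^_; _⊔_; _≤_; _<_; _≡ᵇ_; z≤n; s≤s)
open import Data.Nat.Properties
open import Data.Nat.Solver using (module +-*-Solver)
open import Data.Product using (_×_; _,_; ∃-syntax; proj₁; proj₂)
open import Data.Sum.Base using (_⊎_; inj₁; inj₂; [_,_]′)
open import Data.Unit.Base using (⊤; tt)
open import Data.Vec.Base using (Vec; []; _∷_; lookup)
open import Function.Base using (_∘_)
open import Function.Bundles using (_⇔_; mk⇔; module Equivalence; module Bijection)
open import Function.Definitions using (Injective)
open import Relation.Binary.PropositionalEquality
  using (_≡_; _≢_; refl; sym; trans; cong; cong₂; subst; subst₂; module ≡-Reasoning)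
open import Relation.Nullary using (¬_; Dec; yes; no; does)
open import Relation.Nullary.Decidable using (map′; _⊎-dec_)

-- The two inputs may have unrelated vtrees, so the diagram and the circuit cannot be traversed
-- together. The detour through representatives avoids this: what remains is to compare two
-- cofactors of one circuit, and these share its vtree.
--
-- One direction of the criterion rests on the fact that every assignment satisfies exactly one node
-- at each position of the diagram. If D computes F, then assignments that satisfy the same node and
-- agree elsewhere are interchangeable for F. Conversely, an assignment can be replaced, from the
-- leaves upwards, by the representatives of the nodes it satisfies, and no replacement changes F.
--
-- Without thinning, the test sets would multiply along the vtree. A vector has 1 + 2m coordinates
-- for m gates, the extra one being the constant 1 that makes affine functionals linear, and no
-- thinned set has more members than that. The correctness proof of the elimination exhibits no
-- basis: it follows a single functional that vanishes at the chosen members and concludes that it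
-- vanishes at all of them.

infixr 5 _◂_
data Sexp : Set where
  ε   : Sexp
  _◂_ : Sexp → Sexp → Sexp

⌜_⌝ : Sexp → Value
⌜ ε ⌝     = nil
⌜ a ◂ b ⌝ = ⌜ a ⌝ ∙ ⌜ b ⌝

size : Sexp → ℕ
size ε       = 1
size (a ◂ b) = suc (size a + size b)

hd tl : Sexp → Sexp
hd ε       = ε
hd (a ◂ _) = a
tl ε       = ε
tl (_ ◂ b) = b

bit : Sexp → Bool
bit ε       = false
bit (_ ◂ _) = true

fold : (f g : Sexp → Sexp) (p : Sexp) → Sexp → Sexp
fold f g p ε       = f p
fold f g p (a ◂ b) = g (a ◂ b ◂ fold f g p a ◂ fold f g p b ◂ p)

1≤size : ∀ x → 1 ≤ size x
1≤size ε       = s≤s z≤n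
1≤size (_ ◂ _) = s≤s z≤n

size-hd : ∀ x → size (hd x) ≤ size x
size-hd ε       = ≤-refl
size-hd (a ◂ b) = m≤n⇒m≤1+n (m≤m+n (size a) (size b))

size-tl : ∀ x → size (tl x) ≤ size x
size-tl ε       = ≤-refl
size-tl (a ◂ b) = m≤n⇒m≤1+n (m≤n+m (size b) (size a))

-- Polynomial bounds and the programs that obey them

m≤2^m : ∀ m → m ≤ 2 ^ m
m≤2^m zero    = z≤n
m≤2^m (suc m) = begin
  1 + m              ≤⟨ +-mono-≤ (m^n>0 2 m) (m≤2^m m) ⟩
  2 ^ m + 2 ^ m      ≡⟨ cong (2 ^ m +_) (+-identityʳ (2 ^ m)) ⟨
  2 * 2 ^ m          ∎
  where open ≤-Reasoning

module Growth {A : Set} (μ : A → ℕ) (1≤μ : ∀ x → 1 ≤ μ x) where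

  -- A bare power suffices: its base is at least 2, so a larger exponent absorbs constants, sums and
  -- factors.
  Poly : (A → ℕ) → Set
  Poly F = ∃[ k ] ∀ x → F x ≤ suc (μ x) ^ k

  2≤1+μ : ∀ x → 2 ≤ suc (μ x)
  2≤1+μ x = s≤s (1≤μ x)

  poly-≤ : ∀ {F G} → (∀ x → F x ≤ G x) → Poly G → Poly F
  poly-≤ F≤G (k , G≤) = k , λ x → ≤-trans (F≤G x) (G≤ x)

  poly-const : ∀ c → Poly (λ _ → c)
  poly-const c = c , λ x → ≤-trans (m≤2^m c) (^-monoˡ-≤ c (2≤1+μ x))

  poly-μ : Poly μ
  poly-μ = 1 , λ x → ≤-trans (n≤1+n (μ x)) (≤-reflexive (sym (*-identityʳ (suc (μ x)))))

  poly-+ : ∀ {F G} → Poly F → Poly G → Poly (λ x → F x + G x)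
  poly-+ {F} {G} (k , F≤) (l , G≤) = suc (k + l) , λ x →
    let b = suc (μ x) in begin
    F x + G x                 ≤⟨ +-mono-≤ (F≤ x) (G≤ x) ⟩
    b ^ k + b ^ l             ≤⟨ +-mono-≤ (^-monoʳ-≤ b (m≤m+n k l)) (^-monoʳ-≤ b (m≤n+m l k)) ⟩
    b ^ (k + l) + b ^ (k + l) ≡⟨ cong (b ^ (k + l) +_) (+-identityʳ _) ⟨
    2 * b ^ (k + l)           ≤⟨ *-monoˡ-≤ (b ^ (k + l)) (2≤1+μ x) ⟩
    b * b ^ (k + l)           ∎
    where open ≤-Reasoning

  poly-* : ∀ {F G} → Poly F → Poly G → Poly (λ x → F x * G x)
  poly-* (k , F≤) (l , G≤) = k + l , λ x →
    ≤-trans (*-mono-≤ (F≤ x) (G≤ x)) (≤-reflexive (sym (^-distribˡ-+-* (suc (μ x)) k l)))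

  poly-^ : ∀ {F} → Poly F → ∀ l → Poly (λ x → F x ^ l)
  poly-^ (k , F≤) l = k * l , λ x →
    ≤-trans (^-monoˡ-≤ l (F≤ x)) (≤-reflexive (^-*-assoc (suc (μ x)) k l))

open Growth size 1≤size renaming (poly-μ to poly-size)

-- `F` need not be monotone; its bound is, so the bound on the size of `g x` can be inserted there.
poly-∘ : ∀ {F} {g : Sexp → Sexp} → Poly F → Poly (size ∘ g) → Poly (F ∘ g)
poly-∘ {g = g} (k , F≤) pg =
  poly-≤ (λ x → F≤ (g x)) (poly-^ (poly-+ (poly-const 1) pg) k)

-- The code is a macro whose parameter is the variable that holds the argument.
record Fn : Set where
  field
    run       : Sexp → Sexp
    code      : ∀ {n} → Fin n → Term n
    time      : Sexp → ℕ
    evaluates : ∀ {n} (σ : Vec Value n) i x → lookup σ i ≡ ⌜ x ⌝ →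
                ∃[ t ] (σ ⊢ code i ⇓ ⌜ run x ⌝ ⟨ t ⟩) × t ≤ time x
    time-poly : Poly time
    size-poly : Poly (size ∘ run)
open Fn public

-- The language has no let. Taking a fresh cell apart binds the value of `e₁` to index 0 and a dummy
-- to index 1; the nil branch is never reached.
letTerm : ∀ {n} → Term n → Term (2 + n) → Term n
letTerm e₁ e₂ = case (cons e₁ nil) nil e₂

let-evaluates : ∀ {n} {σ : Vec Value n} {e₁ e₂ v w t₁ t₂} →
  σ ⊢ e₁ ⇓ v ⟨ t₁ ⟩ → (v ∷ nil ∷ σ) ⊢ e₂ ⇓ w ⟨ t₂ ⟩ →
  σ ⊢ letTerm e₁ e₂ ⇓ w ⟨ suc (suc (t₁ + 1) + t₂) ⟩
let-evaluates d₁ d₂ = case-cons (cons d₁ nil) d₂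

var-evaluates : ∀ {n} {σ : Vec Value n} {i x} → lookup σ i ≡ ⌜ x ⌝ →
                σ ⊢ var i ⇓ ⌜ x ⌝ ⟨ 1 ⟩
var-evaluates {σ = σ} {i} eq = subst (λ v → σ ⊢ var i ⇓ v ⟨ 1 ⟩) eq (var i)

nilF : Fn
nilF = record
  { run       = λ _ → ε
  ; code      = λ _ → nil
  ; time      = λ _ → 1
  ; evaluates = λ σ i x eq → 1 , nil , ≤-refl
  ; time-poly = poly-const 1
  ; size-poly = poly-const 1
  }

infixr 5 _▹_
_▹_ : Fn → Fn → Fn
f ▹ g = record
  { run       = λ x → run f x ◂ run g x
  ; code      = λ i → cons (code f i) (code g i)
  ; time      = λ x → suc (time f x + time g x)
  ; evaluates = λ σ i x eq →
      let t₁ , d₁ , ≤₁ = evaluates f σ i x eq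
          t₂ , d₂ , ≤₂ = evaluates g σ i x eq
      in _ , cons d₁ d₂ , s≤s (+-mono-≤ ≤₁ ≤₂)
  ; time-poly = poly-+ (poly-const 1) (poly-+ (time-poly f) (time-poly g))
  ; size-poly = poly-+ (poly-const 1) (poly-+ (size-poly f) (size-poly g))
  }

infixr 6 _⊚_
_⊚_ : Fn → Fn → Fn
g ⊚ f = record
  { run       = λ x → run g (run f x)
  ; code      = λ i → letTerm (code f i) (code g zero)
  ; time      = λ x → suc (suc (time f x + 1) + time g (run f x))
  ; evaluates = λ σ i x eq →
      let t₁ , d₁ , ≤₁ = evaluates f σ i x eq
          t₂ , d₂ , ≤₂ = evaluates g (_ ∷ nil ∷ σ) zero (run f x) refl
      in _ , let-evaluates d₁ d₂ , s≤s (+-mono-≤ (s≤s (+-monoˡ-≤ 1 ≤₁)) ≤₂)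
  ; time-poly = poly-+ (poly-const 1)
      (poly-+ (poly-+ (poly-const 1) (poly-+ (time-poly f) (poly-const 1)))
              (poly-∘ (time-poly g) (size-poly f)))
  ; size-poly = poly-∘ (size-poly g) (size-poly f)
  }

hdF tlF : Fn
hdF = record
  { run       = hd
  ; code      = λ i → case (var i) nil (var zero)
  ; time      = λ _ → 3
  ; evaluates = λ where
      σ i ε       eq → 3 , case-nil (var-evaluates eq) nil , ≤-refl
      σ i (a ◂ b) eq → 3 , case-cons (var-evaluates eq) (var zero) , ≤-refl
  ; time-poly = poly-const 3
  ; size-poly = poly-≤ size-hd poly-size
  }
tlF = record
  { run       = tl
  ; code      = λ i → case (var i) nil (var (suc zero))
  ; time      = λ _ → 3
  ; evaluates = λ where
      σ i ε       eq → 3 , case-nil (var-evaluates eq) nil , ≤-refl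
      σ i (a ◂ b) eq → 3 , case-cons (var-evaluates eq) (var (suc zero)) , ≤-refl
  ; time-poly = poly-const 3
  ; size-poly = poly-≤ size-tl poly-size
  }

ifF : Fn → Fn → Fn → Fn
ifF c f g = record
  { run       = λ x → if bit (run c x) then run f x else run g x
  ; code      = λ i → case (code c i) (code g i) (code f (suc (suc i)))
  ; time      = λ x → suc (time c x + (time f x + time g x))
  ; evaluates = eval-if
  ; time-poly = poly-+ (poly-const 1)
      (poly-+ (time-poly c) (poly-+ (time-poly f) (time-poly g)))
  ; size-poly = poly-≤ size-if (poly-+ (size-poly f) (size-poly g))
  }
  where
  eval-if : ∀ {n} (σ : Vec Value n) i x → lookup σ i ≡ ⌜ x ⌝ →
    ∃[ t ] (σ ⊢ case (code c i) (code g i) (code f (suc (suc i)))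
              ⇓ ⌜ if bit (run c x) then run f x else run g x ⌝ ⟨ t ⟩)
         × t ≤ suc (time c x + (time f x + time g x))
  eval-if σ i x eq with run c x | evaluates c σ i x eq
  ... | ε | t₁ , d₁ , ≤₁ =
    let t₂ , d₂ , ≤₂ = evaluates g σ i x eq
    in _ , case-nil d₁ d₂ , s≤s (+-mono-≤ ≤₁ (≤-trans ≤₂ (m≤n+m _ _)))
  ... | a ◂ b | t₁ , d₁ , ≤₁ =
    let t₂ , d₂ , ≤₂ = evaluates f (⌜ a ⌝ ∷ ⌜ b ⌝ ∷ σ) (suc (suc i)) x eq
    in _ , case-cons d₁ d₂ , s≤s (+-mono-≤ ≤₁ (≤-trans ≤₂ (m≤m+n _ _)))

  size-if : ∀ x → size (if bit (run c x) then run f x else run g x)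
              ≤ size (run f x) + size (run g x)
  size-if x with bit (run c x)
  ... | true  = m≤m+n _ _
  ... | false = m≤n+m _ _

foldRun : Fn → Fn → Sexp → Sexp
foldRun f g z = fold (run f) (run g) (tl z) (hd z)

module FoldCode (f g : Fn) where

  -- Index 0 is the argument of the recursive call, 1 the closure itself and 2 the parameter of the
  -- fold. In the second branch of `case` they are shifted by two, below the two parts of the
  -- argument.
  body : ∀ {n} → Term (3 + n)
  body = case (var zero) (code f (suc (suc zero)))
    (letTerm (cons (var zero) (cons (var (suc zero))
               (cons (app (var (suc (suc (suc zero)))) (var zero))
               (cons (app (var (suc (suc (suc zero)))) (var (suc zero)))
                     (var (suc (suc (suc (suc zero)))))))))
             (code g zero))

  foldCode : ∀ {n} → Fin n → Term n
  foldCode i = letTerm (code tlF i) (app (fun body) (code hdF (suc (suc i))))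

  module _ {n} (σ : Vec Value n) (p : Sexp) (s R N : ℕ)
    (R-bound : ∀ y → size y ≤ s → size (fold (run f) (run g) p y) ≤ R)
    (f-bound : 4 + time f p ≤ N)
    (g-bound : ∀ w → size w ≤ 4 + (s + (R + R + size p)) → 40 + time g w ≤ N)
    where

    self : Value
    self = closure (⌜ p ⌝ ∷ σ) body

    private
      foldp : Sexp → Sexp
      foldp = fold (run f) (run g) p

    size-step : ∀ a b → size (a ◂ b) ≤ s →
      size (a ◂ b ◂ foldp a ◂ foldp b ◂ p) ≤ 4 + (s + (R + R + size p))
    size-step a b ≤s = begin
      suc (A + suc (B + suc (X + suc (Y + P))))
        ≡⟨ lemma A B X Y P ⟩
      4 + ((A + B) + (X + Y + P))
        ≤⟨ +-monoʳ-≤ 4 (+-mono-≤ A+B≤s (+-monoˡ-≤ P (+-mono-≤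
             (R-bound a (≤-trans (m≤m+n A B) A+B≤s)) (R-bound b (≤-trans (m≤n+m B A) A+B≤s))))) ⟩
      4 + (s + (R + R + P)) ∎
      where
      open ≤-Reasoning
      A = size a
      B = size b
      X = size (foldp a)
      Y = size (foldp b)
      P = size p
      A+B≤s = ≤-trans (n≤1+n (A + B)) ≤s
      open +-*-Solver
      lemma : ∀ A B X Y P → suc (A + suc (B + suc (X + suc (Y + P)))) ≡ 4 + ((A + B) + (X + Y + P))
      lemma = solve 5 (λ A B X Y P →
        con 1 :+ (A :+ (con 1 :+ (B :+ (con 1 :+ (X :+ (con 1 :+ (Y :+ P)))))))
          := con 4 :+ ((A :+ B) :+ (X :+ Y :+ P))) refl

    -- Every leaf and every cell of `y` is charged `N`. One `N` serves all calls because `R` bounds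
    -- the intermediate results and hence the arguments of `g`. The overhead of a call is 18; the 40
    -- in `g-bound` leaves slack.
    call : ∀ y → size y ≤ s →
      ∃[ t ] ((⌜ y ⌝ ∷ self ∷ ⌜ p ⌝ ∷ σ) ⊢ body ⇓ ⌜ foldp y ⌝ ⟨ t ⟩) × t ≤ size y * N
    call ε _ =
      let t , d , t≤ = evaluates f (nil ∷ self ∷ ⌜ p ⌝ ∷ σ) (suc (suc zero)) p refl
      in _ , case-nil (var zero) d ,
         ≤-trans (s≤s (s≤s t≤))
           (≤-trans (m≤n+m _ 2) (≤-trans f-bound (≤-reflexive (sym (+-identityʳ N)))))
    call (a ◂ b) ≤s =
      let A+B≤s = ≤-trans (n≤1+n (size a + size b)) ≤s
          ta , da , ta≤ = call a (≤-trans (m≤m+n (size a) (size b)) A+B≤s)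
          tb , db , tb≤ = call b (≤-trans (m≤n+m (size b) (size a)) A+B≤s)
          w = a ◂ b ◂ foldp a ◂ foldp b ◂ p
          tg , dg , tg≤ = evaluates g
            (⌜ w ⌝ ∷ nil ∷ ⌜ a ⌝ ∷ ⌜ b ⌝ ∷ (⌜ a ◂ b ⌝) ∷ self ∷ ⌜ p ⌝ ∷ σ) zero w refl
          open ≤-Reasoning
      in _ , case-cons (var zero) (let-evaluates
               (cons (var _) (cons (var _) (cons (app (var _) (var _) da)
                  (cons (app (var _) (var _) db) (var _))))) dg) ,
         (begin
           _                              ≡⟨ arith ta tb tg ⟩
           18 + tg + (ta + tb)            ≤⟨ +-mono-≤ (+-mono-≤ (m≤m+n 18 22) tg≤) (+-mono-≤ ta≤ tb≤) ⟩
           40 + time g w + (size a * N + size b * N)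
             ≤⟨ +-mono-≤ (g-bound w (size-step a b ≤s)) (≤-reflexive (sym (*-distribʳ-+ N (size a) (size b)))) ⟩
           N + (size a + size b) * N      ∎)
      where
      open +-*-Solver
      arith : ∀ ta tb tg →
        suc (1 + suc (suc (suc (1 + suc (1 + suc (suc (1 + 1 + ta) + suc (suc (1 + 1 + tb) + 1)))) + 1) + tg))
        ≡ 18 + tg + (ta + tb)
      arith = solve 3 (λ ta tb tg →
        con 4 :+ (((con 5 :+ ((con 3 :+ ta) :+ (con 1 :+ ((con 3 :+ tb) :+ con 1)))) :+ con 1) :+ tg)
        := con 18 :+ tg :+ (ta :+ tb)) refl

  module _ (q : ℕ) (q-bound : ∀ z → size (foldRun f g z) ≤ suc (size z) ^ q) where

    private
      k = proj₁ (time-poly g)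

      R M N : Sexp → ℕ
      -- The bound `q-bound` at `y ◂ tl z`, where both parts have at most the size of `z`.
      R z = (2 + (size z + size z)) ^ q
      M z = 5 + (size z + (R z + R z + size z))
      N z = 4 + time f (tl z) + (40 + M z ^ k)

    foldTime : Sexp → ℕ
    foldTime z = 20 + size z * N z

    foldEvaluates : ∀ {n} (σ : Vec Value n) i z → lookup σ i ≡ ⌜ z ⌝ →
      ∃[ t ] (σ ⊢ foldCode i ⇓ ⌜ foldRun f g z ⌝ ⟨ t ⟩) × t ≤ foldTime z
    foldEvaluates σ i z eq =
      let t₁ , d₁ , ≤₁ = evaluates tlF σ i z eq
          t₂ , d₂ , ≤₂ = evaluates hdF (⌜ tl z ⌝ ∷ nil ∷ σ) (suc (suc i)) z eq
          t₃ , d₃ , ≤₃ = call (nil ∷ σ) (tl z) (size z) (R z) (N z)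
                           R-bound (m≤m+n _ _) g-bound (hd z) (size-hd z)
      in _ , let-evaluates d₁ (app (fun body) d₂ d₃) , (begin
        suc (suc (t₁ + 1) + suc (1 + t₂ + t₃)) ≤⟨ s≤s (+-mono-≤ (s≤s (+-monoˡ-≤ 1 ≤₁)) (s≤s (s≤s (+-mono-≤ ≤₂ ≤₃)))) ⟩
        11 + size (hd z) * N z                   ≤⟨ +-mono-≤ (m≤m+n 11 9) (*-monoˡ-≤ (N z) (size-hd z)) ⟩
        20 + size z * N z                       ∎)
      where
      open ≤-Reasoning
      R-bound : ∀ y → size y ≤ size z → size (fold (run f) (run g) (tl z) y) ≤ R z
      R-bound y y≤ = ≤-trans (q-bound (y ◂ tl z)) (^-monoˡ-≤ q (s≤s (s≤s (+-mono-≤ y≤ (size-tl z)))))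
      g-bound : ∀ w → size w ≤ 4 + (size z + (R z + R z + size (tl z))) → 40 + time g w ≤ N z
      g-bound w w≤ = ≤-trans
        (+-monoʳ-≤ 40 (≤-trans (proj₂ (time-poly g) w) (^-monoˡ-≤ k
          (s≤s (≤-trans w≤ (+-monoʳ-≤ 4 (+-monoʳ-≤ (size z) (+-monoʳ-≤ (R z + R z) (size-tl z)))))))))
        (m≤n+m _ (4 + time f (tl z)))

    foldTime-poly : Poly foldTime
    foldTime-poly = poly-+ (poly-const 20) (poly-* poly-size
      (poly-+ (poly-+ (poly-const 4) (poly-∘ (time-poly f) (size-poly tlF)))
              (poly-+ (poly-const 40) (poly-^ M-poly k))))
      where
      R-poly = poly-^ (poly-+ (poly-const 2) (poly-+ poly-size poly-size)) q
      M-poly = poly-+ (poly-const 5) (poly-+ poly-size (poly-+ (poly-+ R-poly R-poly) poly-size))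

foldF : (f g : Fn) → Poly (size ∘ foldRun f g) → Fn
foldF f g bound = record
  { run       = foldRun f g
  ; code      = foldCode
  ; time      = foldTime (proj₁ bound) (proj₂ bound)
  ; evaluates = foldEvaluates (proj₁ bound) (proj₂ bound)
  ; time-poly = foldTime-poly (proj₁ bound) (proj₂ bound)
  ; size-poly = bound
  }
  where open FoldCode f g

-- Programs: assignments, circuits and Gaussian elimination

-- A step may use each recursive result once and add an amount that depends on the input only. Then
-- the increments sum up to at most the number of cells times the largest one. A step that copied a
-- result could double it at every level.
additive : ∀ (f g : Fn) {G : Sexp → ℕ} → Poly G →
  (∀ a b ra rb p →
     size (run g (a ◂ b ◂ ra ◂ rb ◂ p)) ≤ size ra + size rb + G (a ◂ b ◂ p)) →
  Poly (size ∘ foldRun f g)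
additive f g {G} (k , G≤) step =
  poly-≤ (λ z → ≤-trans (bound z (hd z) (size-hd z)) (*-monoˡ-≤ (N z) (size-hd z)))
    (poly-* poly-size (poly-+ (poly-∘ (size-poly f) (size-poly tlF))
                              (poly-^ (poly-+ (poly-const 2) (poly-+ poly-size poly-size)) k)))
  where
  M N : Sexp → ℕ
  M z = (2 + (size z + size z)) ^ k
  N z = size (run f (tl z)) + M z

  M-bound : ∀ z a b → size (a ◂ b) ≤ size z → G (a ◂ b ◂ tl z) ≤ M z
  M-bound z a b ≤z = ≤-trans (G≤ (a ◂ b ◂ tl z)) (^-monoˡ-≤ k (s≤s (s≤s (begin
    size a + suc (size b + size (tl z))   ≡⟨ +-suc (size a) _ ⟩
    suc (size a + (size b + size (tl z))) ≡⟨ cong suc (+-assoc (size a) (size b) _) ⟨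
    size (a ◂ b) + size (tl z)            ≤⟨ +-mono-≤ ≤z (size-tl z) ⟩
    size z + size z                       ∎))))
    where open ≤-Reasoning

  bound : ∀ z y → size y ≤ size z →
          size (fold (run f) (run g) (tl z) y) ≤ size y * N z
  bound z ε       _  = ≤-trans (m≤m+n _ (M z)) (≤-reflexive (sym (+-identityʳ (N z))))
  bound z (a ◂ b) ≤z = begin
    size (run g (a ◂ b ◂ r a ◂ r b ◂ tl z))       ≤⟨ step a b (r a) (r b) (tl z) ⟩
    size (r a) + size (r b) + G (a ◂ b ◂ tl z)
      ≤⟨ +-mono-≤ (+-mono-≤ (bound z a (≤-trans (m≤m+n _ _) a+b≤z))
                            (bound z b (≤-trans (m≤n+m _ _) a+b≤z))) (M-bound z a b ≤z) ⟩
    size a * N z + size b * N z + M z             ≤⟨ +-monoʳ-≤ _ (m≤n+m (M z) (size (run f (tl z)))) ⟩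
    size a * N z + size b * N z + N z             ≡⟨ +-comm _ (N z) ⟩
    N z + (size a * N z + size b * N z)           ≡⟨ cong (N z +_) (*-distribʳ-+ (N z) (size a) (size b)) ⟨
    size (a ◂ b) * N z                            ∎
    where
    open ≤-Reasoning
    r = fold (run f) (run g) (tl z)
    a+b≤z = ≤-trans (n≤1+n _) ≤z

fromBool : Bool → Sexp
fromBool false = ε
fromBool true  = ε ◂ ε

size-if≤ : ∀ (c : Bool) {x y n} → size x ≤ n → size y ≤ n → size (if c then x else y) ≤ n
size-if≤ true  x≤ y≤ = x≤
size-if≤ false x≤ y≤ = y≤

trueF : Fn
trueF = nilF ▹ nilF

notF boolF : Fn → Fn
notF c  = ifF c nilF trueF
boolF c = ifF c trueF nilF

andF : Fn → Fn → Fn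
andF c d = ifF c (boolF d) nilF

xorF : Fn → Fn → Fn
xorF c d = ifF c (notF d) (boolF d)

size-bool : ∀ b → size (if b then ε ◂ ε else ε) ≤ 3
size-bool b = size-if≤ b ≤-refl (m≤m+n 1 2)

size-not : ∀ b → size (if b then ε else ε ◂ ε) ≤ 3
size-not b = size-if≤ b (m≤m+n 1 2) ≤-refl

-- A program with several arguments takes them as a list x₀ ◂ x₁ ◂ …  In a step
-- of a fold, v0 and v1 are the two parts, v2 and v3 the results for them, and
-- tail4F is the parameter of the fold.
tail4F v0 v1 v2 v3 v4 : Fn
tail4F = tlF ⊚ tlF ⊚ tlF ⊚ tlF
v0 = hdF
v1 = hdF ⊚ tlF
v2 = hdF ⊚ tlF ⊚ tlF
v3 = hdF ⊚ tlF ⊚ tlF ⊚ tlF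
v4 = hdF ⊚ tail4F

-- In mapF f and allF f, the argument is list ◂ parameter, and f is applied to
-- entry ◂ parameter.
mapF : Fn → Fn
mapF f = foldF nilF (f ⊚ (v0 ▹ tail4F) ▹ v3)
  (additive nilF (f ⊚ (v0 ▹ tail4F) ▹ v3)
    {λ w → suc (size (run f (hd w ◂ tl (tl w))))}
    (poly-+ (poly-const 1) (size-poly (f ⊚ (hdF ▹ tlF ⊚ tlF))))
    λ a b ra rb p → ≤-trans (≤-reflexive (cong suc (+-comm _ (size rb))))
      (≤-trans (≤-reflexive (sym (+-suc (size rb) _)))
        (+-monoˡ-≤ _ (m≤n+m (size rb) (size ra)))))

allF : Fn → Fn
allF f = foldF trueF (ifF (f ⊚ (v0 ▹ tail4F)) v3 nilF)
  (additive trueF (ifF (f ⊚ (v0 ▹ tail4F)) v3 nilF)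
    (poly-const 1)
    λ a b ra rb p → size-if≤ (bit (run f (a ◂ p)))
      (≤-trans (m≤n+m (size rb) (size ra)) (m≤m+n _ 1))
      (m≤n+m 1 (size ra + size rb)))

-- Drops as many entries of the second list as the first list has.
dropF : Fn
dropF = foldF v0 (tlF ⊚ v3)
  (additive v0 (tlF ⊚ v3) (poly-const 0)
    λ a b ra rb p → ≤-trans (size-tl rb)
      (≤-trans (m≤n+m (size rb) (size ra)) (m≤m+n _ 0)))

nthF : Fn
nthF = hdF ⊚ dropF

-- Unary numbers are equal if neither is longer.
eqF : Fn
eqF = ifF dropF nilF (ifF (dropF ⊚ (v1 ▹ v0 ▹ nilF)) nilF trueF)

-- The first matching entry counts, and an unassigned variable reads as false; this matches
-- overriding the assignment `ff` below.
lookF : Fn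
lookF = foldF nilF step
  (additive nilF step (poly-const 3)
    λ a b ra rb p → size-if≤ (bit (run eqF (hd a ◂ hd p ◂ ε)))
      (≤-trans (size-bool (bit (tl a))) (m≤n+m 3 (size ra + size rb)))
      (≤-trans (m≤n+m (size rb) (size ra)) (m≤m+n _ 3)))
  where step = ifF (eqF ⊚ (hdF ⊚ v0 ▹ v4 ▹ nilF)) (boolF (tlF ⊚ v0)) v3

appendF : Fn
appendF = foldF v0 (v0 ▹ v3)
  (additive v0 (v0 ▹ v3) {λ w → suc (size (hd w))}
    (poly-+ (poly-const 1) (size-poly hdF))
    λ a b ra rb p → ≤-trans (≤-reflexive (cong suc (+-comm _ (size rb))))
      (≤-trans (≤-reflexive (sym (+-suc (size rb) _)))
        (+-monoˡ-≤ _ (m≤n+m (size rb) (size ra)))))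

append : Sexp → Sexp → Sexp
append a b = run appendF (a ◂ b ◂ ε)

size-append : ∀ a b → size (append a b) ≤ size a + size b
size-append ε       b = n≤1+n (size b)
size-append (c ◂ d) b = s≤s (≤-trans (+-monoʳ-≤ (size c) (size-append d b))
                                     (≤-reflexive (sym (+-assoc (size c) (size d) (size b)))))

anyF : Fn
anyF = foldF nilF step
  (additive nilF step (poly-const 3)
    λ a b ra rb p → size-if≤ (bit (run nthF (a ◂ hd p ◂ ε)))
      (m≤n+m 3 (size ra + size rb))
      (≤-trans (m≤n+m (size rb) (size ra)) (m≤m+n _ 3)))
  where step = ifF (nthF ⊚ (v0 ▹ v4 ▹ nilF)) trueF v3

-- Arguments: gate, values of the preceding gates, assignment.
gateF : Fn
gateF = boolF (ifF tag (ifF (tlF ⊚ tag) (ifF (tlF ⊚ tlF ⊚ tag) orF conjF) litF) payload)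
  where
  tag = hdF ⊚ hdF
  payload = tlF ⊚ hdF
  value = lookF ⊚ (v2 ▹ hdF ⊚ payload ▹ nilF)
  litF = ifF (tlF ⊚ payload) value (notF value)
  conjF = andF (nthF ⊚ (hdF ⊚ payload ▹ v1 ▹ nilF)) (nthF ⊚ (tlF ⊚ payload ▹ v1 ▹ nilF))
  orF = anyF ⊚ (payload ▹ v1 ▹ nilF)

-- The outer `boolF` normalises the answer, so the bound also holds for arguments that encode no
-- gate. The size bounds of programs have to hold for all inputs.
size-gate : ∀ x → size (run gateF x) ≤ 3
size-gate x = size-bool _

-- Arguments: circuit, assignment.
valsF : Fn
valsF = foldF nilF (gateF ⊚ (v0 ▹ v3 ▹ v4 ▹ nilF) ▹ v3)
  (additive nilF (gateF ⊚ (v0 ▹ v3 ▹ v4 ▹ nilF) ▹ v3) (poly-const 4)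
    λ a b ra rb p → ≤-trans (s≤s (+-monoˡ-≤ (size rb) (size-gate (a ◂ rb ◂ hd p ◂ ε))))
      (≤-trans (≤-reflexive (+-comm 4 (size rb))) (+-monoˡ-≤ 4 (m≤n+m (size rb) (size ra)))))

vals : Sexp → Sexp → Sexp
vals C a = run valsF (C ◂ a ◂ ε)

-- The position of the current entry in the second list is recovered from the
-- length of the remaining part of the first one.
xorVecStepF : Fn
xorVecStepF =
  xorF v0 (nthF ⊚ (dropF ⊚ ((v0 ▹ v1) ▹ v4 ▹ nilF) ▹ v4 ▹ nilF)) ▹ v3

size-xor : ∀ c d → size (if c then (if d then ε else ε ◂ ε) else (if d then ε ◂ ε else ε)) ≤ 3
size-xor c d = size-if≤ c (size-not d) (size-bool d)

xorVecF : Fn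
xorVecF = foldF nilF xorVecStepF
  (additive nilF xorVecStepF (poly-const 4)
    λ a b ra rb p → ≤-trans (s≤s (+-monoˡ-≤ (size rb) (size-xor (bit a) _)))
      (≤-trans (≤-reflexive (+-comm 4 (size rb))) (+-monoˡ-≤ 4 (m≤n+m (size rb) (size ra)))))

-- An item is vector ◂ label.
pivotF : Fn
pivotF = foldF nilF (ifF (hdF ⊚ hdF ⊚ v0) v0 v3)
  (additive nilF (ifF (hdF ⊚ hdF ⊚ v0) v0 v3) (size-poly hdF)
    λ a b ra rb p → size-if≤ (bit (hd (hd a)))
      (m≤n+m (size a) (size ra + size rb))
      (≤-trans (m≤n+m (size rb) (size ra)) (m≤m+n _ _)))

-- Arguments: item, pivot.
elimItemF : Fn
elimItemF = tlF ⊚ ifF (hdF ⊚ hdF ⊚ hdF) (xorVecF ⊚ (hdF ⊚ hdF ▹ hdF ⊚ tlF ▹ nilF)) (hdF ⊚ hdF)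
          ▹ tlF ⊚ hdF

elimF : Fn
elimF = mapF elimItemF

-- Arguments: pivot, labels chosen so far, items. A round outputs the label of the pivot, if there
-- is one, and clears and drops the leading coordinate of every item. The pivot stays among the
-- items, where its vector becomes zero.
gaussStepF : Fn
gaussStepF = ifF hdF (tlF ⊚ hdF ▹ hdF ⊚ tlF) (hdF ⊚ tlF) ▹ elimF ⊚ (tlF ⊚ tlF ▹ hdF)

gaussLoopF : Fn
gaussLoopF = gaussStepF ⊚ (pivotF ⊚ (tlF ⊚ v3 ▹ nilF) ▹ v3)

-- Sizes during the elimination

pivot : Sexp → Sexp
pivot items = run pivotF (items ◂ ε)

elim : Sexp → Sexp → Sexp
elim items piv = run elimF (items ◂ piv)

xorVec : Sexp → Sexp → Sexp
xorVec v w = run xorVecF (v ◂ w ◂ ε)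

-- Adding the pivot rewrites entries as `ε` or `ε ◂ ε`, so an entry of size 1 may grow to 3, and
-- `size` is not monotone along the rounds. Counting each entry as at least 3 gives potentials that
-- never increase and exceed the size at most threefold.
potV potI potL : Sexp → ℕ
potV ε       = 1
potV (a ◂ b) = suc ((3 ⊔ size a) + potV b)
-- `elimItemF` turns the item `ε` into `ε ◂ ε`, whose potential is 3.
potI ε       = 3
potI (v ◂ l) = suc (potV v + size l)
potL ε       = 1
potL (i ◂ r) = suc (potI i + potL r)

size≤potV : ∀ v → size v ≤ potV v
size≤potV ε       = ≤-refl
size≤potV (a ◂ b) = s≤s (+-mono-≤ (m≤n⊔m 3 (size a)) (size≤potV b))

size≤potI : ∀ v → size v ≤ potI v
size≤potI ε       = m≤m+n 1 2
size≤potI (a ◂ b) = s≤s (+-monoˡ-≤ _ (size≤potV a))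

size≤potL : ∀ v → size v ≤ potL v
size≤potL ε       = ≤-refl
size≤potL (a ◂ b) = s≤s (+-mono-≤ (size≤potI a) (size≤potL b))

◂-scale : ∀ {m n} a b → m ≤ 3 * size a → n ≤ 3 * size b → suc (m + n) ≤ 3 * size (a ◂ b)
◂-scale {m} {n} a b m≤ n≤ = begin
  suc (m + n)                       ≤⟨ +-mono-≤ (m≤m+n 1 2) (+-mono-≤ m≤ n≤) ⟩
  3 + (3 * size a + 3 * size b)     ≡⟨ cong (3 +_) (*-distribˡ-+ 3 (size a) (size b)) ⟨
  3 + 3 * (size a + size b)         ≡⟨ *-suc 3 (size a + size b) ⟨
  3 * suc (size a + size b)         ∎
  where open ≤-Reasoning

1≤3*size : ∀ a → 3 ≤ 3 * size a
1≤3*size a = *-monoʳ-≤ 3 (1≤size a)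

size≤3*size : ∀ a → size a ≤ 3 * size a
size≤3*size a = m≤m+n (size a) _

potV≤ : ∀ v → potV v ≤ 3 * size v
potV≤ ε       = m≤m+n 1 2
potV≤ (a ◂ b) = ◂-scale a b (⊔-lub (1≤3*size a) (size≤3*size a)) (potV≤ b)

potI≤ : ∀ v → potI v ≤ 3 * size v
potI≤ ε       = ≤-refl
potI≤ (a ◂ b) = ◂-scale a b (potV≤ a) (size≤3*size b)

potL≤ : ∀ v → potL v ≤ 3 * size v
potL≤ ε       = m≤m+n 1 2
potL≤ (a ◂ b) = ◂-scale a b (potI≤ a) (potL≤ b)

potV-xorVec : ∀ p v → potV (fold (run nilF) (run xorVecStepF) p v) ≤ potV v
potV-xorVec p ε       = ≤-refl
potV-xorVec p (a ◂ b) =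
  s≤s (+-mono-≤ (⊔-lub (m≤m⊔n 3 (size a)) (≤-trans (size-xor (bit a) _) (m≤m⊔n 3 (size a))))
                (potV-xorVec p b))

potV-tl : ∀ v → potV (tl v) ≤ potV v
potV-tl ε       = ≤-refl
potV-tl (a ◂ b) = m≤n⇒m≤1+n (m≤n+m (potV b) (3 ⊔ size a))

potI-elimItem : ∀ it piv → potI (run elimItemF (it ◂ piv)) ≤ potI it
potI-elimItem ε       piv = ≤-refl
potI-elimItem (v ◂ l) piv with bit (hd v)
... | true  = s≤s (+-monoˡ-≤ (size l) (≤-trans (potV-tl (xorVec v (hd piv))) (potV-xorVec _ v)))
... | false = s≤s (+-monoˡ-≤ (size l) (potV-tl v))

potL-elim : ∀ items piv → potL (elim items piv) ≤ potL items
potL-elim ε         piv = ≤-refl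
potL-elim (it ◂ is) piv = s≤s (+-mono-≤ (potI-elimItem it piv) (potL-elim is piv))

size-pivot : ∀ items → size (pivot items) ≤ size items
size-pivot ε         = ≤-refl
size-pivot (it ◂ is) = size-if≤ (bit (hd (hd it)))
  (m≤n⇒m≤1+n (m≤m+n _ _)) (≤-trans (size-pivot is) (m≤n⇒m≤1+n (m≤n+m _ _)))

gaussFold : Sexp → Sexp → Sexp
gaussFold p = fold (run (nilF ▹ v0)) (run gaussLoopF) p

potL-gauss : ∀ p y → potL (tl (gaussFold p y)) ≤ potL (hd p)
potL-gauss p ε       = ≤-refl
potL-gauss p (a ◂ b) = ≤-trans (potL-elim (tl (gaussFold p b)) _) (potL-gauss p b)

size-gaussOut : ∀ p y → size (hd (gaussFold p y)) ≤ size y * suc (potL (hd p))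
size-gaussOut p ε       = s≤s z≤n
size-gaussOut p (a ◂ b) = begin
  size (hd (gaussFold p (a ◂ b)))
    ≤⟨ size-if≤ (bit piv) (+-mono-≤ piv≤ (≤-refl {S})) (m≤n+m S (suc P)) ⟩
  suc P + S                            ≤⟨ +-monoʳ-≤ (suc P) (size-gaussOut p b) ⟩
  suc P + size b * suc P               ≤⟨ *-monoˡ-≤ (suc P) (s≤s (m≤n+m (size b) (size a))) ⟩
  size (a ◂ b) * suc P                 ∎
  where
  open ≤-Reasoning
  piv = pivot (tl (gaussFold p b))
  P = potL (hd p)
  S = size (hd (gaussFold p b))
  piv≤ : suc (size (tl piv)) ≤ suc P
  piv≤ = s≤s (≤-trans (size-tl piv) (≤-trans (size-pivot (tl (gaussFold p b)))
           (≤-trans (size≤potL _) (potL-gauss p b))))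

-- Arguments: a list with as many entries as the vectors, items.
gaussF : Fn
gaussF = hdF ⊚ foldF (nilF ▹ v0) gaussLoopF
  (poly-≤ bound (poly-+ (poly-const 1) (poly-+
     (poly-* poly-size (poly-+ (poly-const 1) 3*size-poly)) 3*size-poly)))
  where
  3*size-poly = poly-* (poly-const 3) poly-size
  hd-tl : ∀ z → potL (hd (tl z)) ≤ 3 * size z
  hd-tl z = ≤-trans (potL≤ (hd (tl z)))
    (*-monoʳ-≤ 3 (≤-trans (size-hd (tl z)) (size-tl z)))
  size-split : ∀ p y → size (gaussFold p y)
    ≤ 1 + (size (hd (gaussFold p y)) + size (tl (gaussFold p y)))
  size-split p ε       = ≤-refl
  size-split p (a ◂ b) = ≤-refl
  bound : ∀ z → size (gaussFold (tl z) (hd z)) ≤ 1 + (size z * (1 + 3 * size z) + 3 * size z)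
  bound z = ≤-trans (size-split (tl z) (hd z)) (s≤s (+-mono-≤
    (≤-trans (size-gaussOut (tl z) (hd z)) (*-mono-≤ (size-hd z) (s≤s (hd-tl z))))
    (≤-trans (size≤potL _) (≤-trans (potL-gauss (tl z) (hd z)) (hd-tl z)))))

-- The argument is b ◂ a.
prefixF : Fn
prefixF = appendF ⊚ (tlF ▹ hdF ▹ nilF)

prodF : Fn
prodF = foldF nilF step
  (additive nilF step {λ w → size (run (mapF prefixF) (hd (tl (tl w)) ◂ hd w))}
    (size-poly (mapF prefixF ⊚ (hdF ⊚ tlF ⊚ tlF ▹ hdF)))
    λ a b ra rb p → ≤-trans (size-append (run (mapF prefixF) (hd p ◂ a)) rb)
      (≤-trans (≤-reflexive (+-comm _ (size rb))) (+-monoˡ-≤ _ (m≤n+m (size rb) (size ra)))))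
  where
  step = appendF ⊚ (mapF prefixF ⊚ (v4 ▹ v0) ▹ v3 ▹ nilF)

All : (Sexp → Set) → Sexp → Set
All P ε       = ⊤
All P (a ◂ b) = P a × All P b

len : Sexp → ℕ
len ε       = 0
len (_ ◂ b) = suc (len b)

All-imp : ∀ {P Q : Sexp → Set} → (∀ {x} → P x → Q x) → ∀ l → All P l → All Q l
All-imp P⇒Q ε       _        = tt
All-imp P⇒Q (a ◂ b) (pa , pb) = P⇒Q pa , All-imp P⇒Q b pb

All-map : ∀ {P Q : Sexp → Set} f p → (∀ {x} → P x → Q (run f (x ◂ p))) →
          ∀ l → All P l → All Q (run (mapF f) (l ◂ p))
All-map f p P⇒Q ε       _         = tt
All-map f p P⇒Q (a ◂ b) (pa , pb) = P⇒Q pa , All-map f p P⇒Q b pb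

All-map⁻ : ∀ {P Q : Sexp → Set} f p → (∀ {x} → Q (run f (x ◂ p)) → P x) →
           ∀ l → All Q (run (mapF f) (l ◂ p)) → All P l
All-map⁻ f p Q⇒P ε       _         = tt
All-map⁻ f p Q⇒P (a ◂ b) (qa , qb) = Q⇒P qa , All-map⁻ f p Q⇒P b qb

All-append : ∀ {P : Sexp → Set} a b → All P a → All P b → All P (append a b)
All-append ε       b _         pb = pb
All-append (c ◂ d) b (pc , pd) pb = pc , All-append d b pd pb

All-append⁻ : ∀ {P : Sexp → Set} a b → All P (append a b) → All P a × All P b
All-append⁻ ε       b pb        = tt , pb
All-append⁻ (c ◂ d) b (pc , pr) = let pd , pb = All-append⁻ d b pr in (pc , pd) , pb

prod : Sexp → Sexp → Sexp
prod A B = run prodF (A ◂ B ◂ ε)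

All-prod : ∀ {P Q R : Sexp → Set} → (∀ {a b} → P a → Q b → R (append a b)) →
           ∀ A B → All P A → All Q B → All R (prod A B)
All-prod f ε       B _         qB = tt
All-prod f (a ◂ A) B (pa , pA) qB =
  All-append _ (prod A B) (All-map prefixF a (f pa) B qB) (All-prod f A B pA qB)

All-prod⁻ : ∀ {R : Sexp → Set} A B → All R (prod A B) →
            All (λ a → All (λ b → R (append a b)) B) A
All-prod⁻ ε       B _ = tt
All-prod⁻ (a ◂ A) B r = let r₁ , r₂ = All-append⁻ _ (prod A B) r
  in All-map⁻ prefixF a (λ q → q) B r₁ , All-prod⁻ A B r₂

All-pivot : ∀ {P : Sexp → Set} items → All P items → bit (pivot items) ≡ true → P (pivot items)
All-pivot (it ◂ is) (p , ps) eq with bit (hd (hd it))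
... | true  = p
... | false = All-pivot is ps eq

-- Elimination changes the vectors and keeps the labels, so a property of labels passes through all
-- rounds, in both directions.
All-gaussItems : ∀ {Q : Sexp → Set} p y → All (Q ∘ tl) (hd p) → All (Q ∘ tl) (tl (gaussFold p y))
All-gaussItems {Q} p ε       q = q
All-gaussItems {Q} p (a ◂ b) q =
  All-map {Q ∘ tl} {Q ∘ tl} elimItemF _ (λ q → q) (tl (gaussFold p b)) (All-gaussItems {Q} p b q)

All-gaussItems⁻ : ∀ {Q : Sexp → Set} p y → All (Q ∘ tl) (tl (gaussFold p y)) → All (Q ∘ tl) (hd p)
All-gaussItems⁻ {Q} p ε       q = q
All-gaussItems⁻ {Q} p (a ◂ b) q =
  All-gaussItems⁻ {Q} p b (All-map⁻ {Q ∘ tl} {Q ∘ tl} elimItemF _ (λ q → q) (tl (gaussFold p b)) q)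

All-gaussOut : ∀ {Q : Sexp → Set} p y → All (Q ∘ tl) (hd p) → All Q (hd (gaussFold p y))
All-gaussOut {Q} p ε       q = tt
All-gaussOut {Q} p (a ◂ b) q with bit (pivot (tl (gaussFold p b))) in eq
... | true  = All-pivot {Q ∘ tl} (tl (gaussFold p b)) (All-gaussItems {Q} p b q) eq , All-gaussOut {Q} p b q
... | false = All-gaussOut {Q} p b q

-- A round chooses at most one label. This bound by the number of coordinates keeps the test sets
-- from multiplying along the vtree.
len-gaussOut : ∀ p y → len (hd (gaussFold p y)) ≤ len y
len-gaussOut p ε       = z≤n
len-gaussOut p (a ◂ b) with bit (pivot (tl (gaussFold p b)))
... | true  = s≤s (len-gaussOut p b)
... | false = m≤n⇒m≤1+n (len-gaussOut p b)

gauss : Sexp → Sexp → Sexp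
gauss counter items = run gaussF (counter ◂ items ◂ ε)

len≤size : ∀ x → len x ≤ size x
len≤size ε       = z≤n
len≤size (a ◂ b) = s≤s (≤-trans (len≤size b) (m≤n+m _ (size a)))

size-All : ∀ {n} l → All (λ x → size x ≤ n) l → size l ≤ 1 + len l * suc n
size-All ε       _        = ≤-refl
size-All {n} (a ◂ b) (a≤ , b≤) = s≤s (≤-trans (+-mono-≤ a≤ (size-All b b≤))
  (≤-reflexive (+-suc n (len b * suc n))))

-- Arguments: assignment δ, followed by a circuit and assignments α and β.
vecF : Fn
vecF = trueF ▹ appendF ⊚ (valsF ⊚ (v1 ▹ appendF ⊚ (v2 ▹ v0 ▹ nilF) ▹ nilF)
                        ▹ valsF ⊚ (v1 ▹ appendF ⊚ (v3 ▹ v0 ▹ nilF) ▹ nilF) ▹ nilF)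

itemF : Fn
itemF = vecF ▹ hdF

litF : Fn → Fn → Fn
litF x b = (x ▹ b) ▹ nilF

leafSetF : Fn → Fn
leafSetF x = litF x nilF ▹ litF x trueF ▹ nilF

-- The vector of the empty assignment only serves as a counter: all vectors have the same length.
joinSetsF : Fn
joinSetsF = gaussF ⊚ (vecF ⊚ (nilF ▹ tlF ⊚ tlF)
  ▹ mapF itemF ⊚ (prodF ⊚ (v0 ▹ v1 ▹ nilF) ▹ tlF ⊚ tlF) ▹ nilF)

-- The fold cannot tell the encoding of a vtree from the pair of the encodings
-- of two vtrees, so it returns the results for both readings of its argument.
setsStepF : Fn
setsStepF = ifF v0 (tlF ⊚ v3) (leafSetF v1)
          ▹ joinSetsF ⊚ (hdF ⊚ v2 ▹ hdF ⊚ v3 ▹ tail4F)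

setsFold : Sexp → Sexp → Sexp
setsFold p y = fold (run nilF) (run setsStepF) p y

-- The literal exceeds `x` by at most 6. A bound linear in the size of the subtree is convenient
-- because it survives the concatenation of assignments of disjoint subtrees.
size-literal : ∀ y x c → suc (size x) ≤ size y → size c ≤ 3 → size ((x ◂ c) ◂ ε) ≤ 7 * size y
size-literal y x c x<y c≤3 = begin
  suc (suc (size x + size c) + 1) ≤⟨ s≤s (s≤s (+-monoˡ-≤ 1 (+-monoʳ-≤ (size x) c≤3))) ⟩
  suc (suc (size x + 3 + 1))      ≡⟨ cong (2 +_) (trans (+-assoc (size x) 3 1) (+-comm (size x) 4)) ⟩
  6 + size x                      ≤⟨ +-mono-≤ (m≤m+n 6 1) (m≤m+n (size x) (6 * size x)) ⟩
  7 + 7 * size x                  ≡⟨ *-suc 7 (size x) ⟨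
  7 * suc (size x)                ≤⟨ *-monoʳ-≤ 7 x<y ⟩
  7 * size y                      ∎
  where open ≤-Reasoning

-- `additive` does not apply, since a product of two sets is formed before it is thinned out.
-- Instead the number of members and the size of each member are bounded separately.
module TestSetSize (p : Sexp) where

  private
    -- The 2 accounts for the two literals at a leaf.
    L = 2 + size (run vecF (ε ◂ p))

    Small : Sexp → Sexp → Set
    Small y B = len B ≤ L × All (λ δ → size δ ≤ 7 * size y) B

    Small-≤ : ∀ {y z} → size y ≤ size z → ∀ B → Small y B → Small z B
    Small-≤ y≤z B (l , s) = l , All-imp (λ δ≤ → ≤-trans δ≤ (*-monoʳ-≤ 7 y≤z)) B s

    size-join : ∀ a b {x y} → size x ≤ 7 * size a → size y ≤ 7 * size b →
                size (append x y) ≤ 7 * size (a ◂ b)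
    size-join a b {x} {y} x≤ y≤ = begin
      size (append x y)         ≤⟨ size-append x y ⟩
      size x + size y           ≤⟨ +-mono-≤ x≤ y≤ ⟩
      7 * size a + 7 * size b   ≡⟨ *-distribˡ-+ 7 (size a) (size b) ⟨
      7 * (size a + size b)     ≤⟨ *-monoʳ-≤ 7 (n≤1+n _) ⟩
      7 * size (a ◂ b)          ∎
      where open ≤-Reasoning

    small : ∀ y → Small y (hd (setsFold p y)) × Small y (tl (setsFold p y))
    small ε       = (z≤n , tt) , (z≤n , tt)
    small (a ◂ b) = asTree a , asPair
      where
      asTree : ∀ a → Small (a ◂ b) (if bit a then tl (setsFold p b) else run (leafSetF v1) (a ◂ b ◂ ε))
      asTree ε       = s≤s (s≤s z≤n) , size-literal (ε ◂ b) b ε (s≤s (n≤1+n (size b))) (s≤s z≤n) , size-literal (ε ◂ b) b (ε ◂ ε) (s≤s (n≤1+n (size b))) ≤-refl , tt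
      asTree (c ◂ d) = Small-≤ {b} {(c ◂ d) ◂ b} (m≤n⇒m≤1+n (m≤n+m (size b) _)) _ (proj₂ (small b))
      Fits : Sexp → Set
      Fits δ = size δ ≤ 7 * size (a ◂ b)
      A = hd (setsFold p a)
      B = hd (setsFold p b)
      items = run (mapF itemF) (prod A B ◂ p)
      asPair : Small (a ◂ b) (gauss (run vecF (ε ◂ p)) items)
      asPair = ≤-trans (len-gaussOut (items ◂ ε) (run vecF (ε ◂ p)))
               (≤-trans (len≤size (run vecF (ε ◂ p))) (m≤n+m _ 2)) ,
             All-gaussOut {Fits} (items ◂ ε) (run vecF (ε ◂ p))
               (All-map {Fits} {Fits ∘ tl} itemF p (λ s → s) (prod A B)
                 (All-prod {R = Fits} (λ {x} {y} → size-join a b {x} {y}) A B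
                   (proj₂ (proj₁ (small a))) (proj₂ (proj₁ (small b)))))

  private
    1+len*size≤ : ∀ y B → Small y B → size B ≤ 1 + L * suc (7 * size y)
    1+len*size≤ y B (l , s) = ≤-trans (size-All B s) (s≤s (*-monoˡ-≤ (suc (7 * size y)) l))

    size-split : ∀ y → size (setsFold p y) ≤ 1 + (size (hd (setsFold p y)) + size (tl (setsFold p y)))
    size-split ε       = m≤m+n 1 2
    size-split (a ◂ b) = ≤-refl

  size-sets : ∀ y → size (setsFold p y)
    ≤ 1 + ((1 + L * suc (7 * size y)) + (1 + L * suc (7 * size y)))
  size-sets y = ≤-trans (size-split y) (s≤s (+-mono-≤
    (1+len*size≤ y _ (proj₁ (small y))) (1+len*size≤ y _ (proj₂ (small y)))))

-- Arguments: vtree, circuit, assignments α and β.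
testSetF : Fn
testSetF = hdF ⊚ foldF nilF setsStepF
  (poly-≤ (λ z → ≤-trans (TestSetSize.size-sets (tl z) (hd z))
                 (s≤s (+-mono-≤ (bound z) (bound z))))
          (poly-+ (poly-const 1) (poly-+ bound-poly bound-poly)))
  where
  B : Sexp → ℕ
  B z = 1 + (2 + size (run vecF (ε ◂ tl z))) * suc (7 * size z)
  bound : ∀ z → 1 + (2 + size (run vecF (ε ◂ tl z))) * suc (7 * size (hd z)) ≤ B z
  bound z = s≤s (*-monoʳ-≤ (2 + size (run vecF (ε ◂ tl z))) (s≤s (*-monoʳ-≤ 7 (size-hd z))))
  bound-poly : Poly B
  bound-poly = poly-+ (poly-const 1) (poly-*
    (poly-+ (poly-const 2) (size-poly (vecF ⊚ (nilF ▹ tlF))))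
    (poly-+ (poly-const 1) (poly-* (poly-const 7) poly-size)))

-- Programs: decision diagrams

-- Arguments: assignment, followed by circuit, output gate and vtree of the
-- d-SDNNF; the latter three are the parameters of the programs below.
evalOutF : Fn
evalOutF = nthF ⊚ (v2 ▹ valsF ⊚ (v1 ▹ v0 ▹ nilF) ▹ nilF)

-- Arguments: γ, α, β, parameters.
agreeF : Fn
agreeF = notF (xorF (value v1) (value v2))
  where value = λ x → evalOutF ⊚ (appendF ⊚ (x ▹ v0 ▹ nilF) ▹ tlF ⊚ tlF ⊚ tlF)

-- Arguments: β, α, parameters.
opaque
  sameCofactorF : Fn
  sameCofactorF = allF agreeF ⊚ (testSetF ⊚ (v4 ▹ v2 ▹ v1 ▹ v0 ▹ nilF) ▹ v1 ▹ v0 ▹ tlF ⊚ tlF)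

-- Arguments: candidates, parameters.
sameCofactorsF : Fn
sameCofactorsF = allF sameCofactorF ⊚ (hdF ▹ hdF ⊚ hdF ▹ tlF)

-- The result has at most one entry. The wrapping tells the absence of a representative, at an
-- unsatisfiable node, from an empty assignment.
representativeF : Fn
representativeF = ifF hdF (hdF ⊚ hdF ▹ nilF) nilF

-- Arguments: list of the lists of candidates of each node, parameters.
finishF : Fn
finishF = allF sameCofactorsF ▹ mapF representativeF

-- The argument consists of a leaf label and a variable.
leafCandsF : Fn
leafCandsF = ifF hdF (ifF (tlF ⊚ hdF) (ifF (tlF ⊚ tlF ⊚ hdF) (leafSetF tlF) nilF)
                                      (litF tlF nilF ▹ nilF))
                     (litF tlF trueF ▹ nilF)

-- Argument: pair of nodes, with the lists of representatives of both children.
firstRepF secondRepF joinF : Fn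
firstRepF  = nthF ⊚ (hdF ⊚ v0 ▹ v1 ▹ nilF)
secondRepF = nthF ⊚ (tlF ⊚ v0 ▹ tlF ⊚ tlF ▹ nilF)
joinF      = appendF ⊚ (hdF ⊚ firstRepF ▹ hdF ⊚ secondRepF ▹ nilF)

nodeCandsStepF : Fn
nodeCandsStepF = ifF (firstRepF ⊚ e) (ifF (secondRepF ⊚ e) (joinF ⊚ e ▹ v3) v3) v3
  where e = v0 ▹ tail4F

nodeCandsF : Fn
nodeCandsF = foldF nilF nodeCandsStepF
  (additive nilF nodeCandsStepF {λ w → suc (size (run joinF (hd w ◂ tl (tl w))))}
    (poly-+ (poly-const 1) (size-poly (joinF ⊚ (hdF ▹ tlF ⊚ tlF))))
    λ a b ra rb p →
      let rb≤ = ≤-trans (m≤n+m (size rb) (size ra)) (m≤m+n _ (suc (size (run joinF (a ◂ p))))) in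
      size-if≤ (bit (run firstRepF (a ◂ p)))
        (size-if≤ (bit (run secondRepF (a ◂ p)))
          (≤-trans (≤-reflexive (trans (cong suc (+-comm _ (size rb))) (sym (+-suc (size rb) _))))
                   (+-monoˡ-≤ _ (m≤n+m (size rb) (size ra))))
          rb≤)
        rb≤)

nodeCands : Sexp → Sexp → Sexp
nodeCands E p = run nodeCandsF (E ◂ p)

procLeafF procNodeF procStepF : Fn
procLeafF = finishF ⊚ (mapF leafCandsF ⊚ (tlF ⊚ v1 ▹ hdF ⊚ v1) ▹ tail4F)
procNodeF = (andF (hdF ⊚ v0) (andF v1 (tlF ⊚ tlF)) ▹ tlF ⊚ v0)
          ⊚ (finishF ⊚ (mapF nodeCandsF ⊚ (tlF ⊚ v1 ▹ tlF ⊚ left′ ▹ tlF ⊚ right′) ▹ tail4F)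
             ▹ hdF ⊚ left′ ▹ hdF ⊚ right′)
  where
  left′  = hdF ⊚ v2
  right′ = tlF ⊚ tlF ⊚ v3
-- The argument is read as the encoding x of nodes, as a triple x ◂ y ◂ E of two
-- such encodings and a list of edge sets, and as a pair x ◂ E.
procStepF = ifF v0 (hdF ⊚ tlF ⊚ v3) procLeafF ▹ procNodeF ▹ hdF ⊚ v2

procFold : Sexp → Sexp → Sexp
procFold p y = fold (run nilF) (run procStepF) p y

All-hd : ∀ {P : Sexp → Set} → P ε → ∀ l → All P l → P (hd l)
All-hd pε ε       _       = pε
All-hd pε (a ◂ b) (p , _) = p

All-tl : ∀ {P : Sexp → Set} l → All P l → All P (tl l)
All-tl ε       _       = tt
All-tl (a ◂ b) (_ , p) = p

All-drop : ∀ {P : Sexp → Set} k l → All P l → All P (run dropF (k ◂ l ◂ ε))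
All-drop     ε       l p = p
All-drop {P} (a ◂ k) l p = All-tl {P} (run dropF (k ◂ l ◂ ε)) (All-drop {P} k l p)

All-nth : ∀ {P : Sexp → Set} → P ε → ∀ k l → All P l → P (run nthF (k ◂ l ◂ ε))
All-nth {P} pε k l p = All-hd {P} pε (run dropF (k ◂ l ◂ ε)) (All-drop {P} k l p)

All-universal : ∀ {P : Sexp → Set} → (∀ x → P x) → ∀ l → All P l
All-universal p ε       = tt
All-universal p (a ◂ b) = p a , All-universal p b

len-map : ∀ f p l → len (run (mapF f) (l ◂ p)) ≡ len l
len-map f p ε       = refl
len-map f p (a ◂ b) = cong suc (len-map f p b)

Joins : (Sexp → Set) → Sexp → Sexp → Set
Joins P p e = bit (run firstRepF (e ◂ p)) ≡ true → bit (run secondRepF (e ◂ p)) ≡ true →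
              P (run joinF (e ◂ p))

All-nodeCands : ∀ {P : Sexp → Set} p E → All (Joins P p) E → All P (nodeCands E p)
All-nodeCands p ε       _ = tt
All-nodeCands {P} p (e ◂ E) (j , js) = go (bit a) (bit b) j
  where
  a = run firstRepF (e ◂ p)
  b = run secondRepF (e ◂ p)
  go : ∀ c d → (c ≡ true → d ≡ true → P (run joinF (e ◂ p))) →
       All P (if c then if d then run joinF (e ◂ p) ◂ nodeCands E p else nodeCands E p
              else nodeCands E p)
  go true  true  f = f refl refl , All-nodeCands p E js
  go true  false f = All-nodeCands p E js
  go false d     f = All-nodeCands p E js

All-nodeCands⁻ : ∀ {P : Sexp → Set} p E → All P (nodeCands E p) → All (Joins P p) E
All-nodeCands⁻ p ε       _ = tt
All-nodeCands⁻ {P} p (e ◂ E) = go (bit a) (bit b)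
  where
  a = run firstRepF (e ◂ p)
  b = run secondRepF (e ◂ p)
  go : ∀ c d →
       All P (if c then if d then run joinF (e ◂ p) ◂ nodeCands E p else nodeCands E p
              else nodeCands E p) →
       (c ≡ true → d ≡ true → P (run joinF (e ◂ p))) × All (Joins P p) E
  go true  true  (q , qs) = (λ _ _ → q)  , All-nodeCands⁻ p E qs
  go true  false qs       = (λ _ ())     , All-nodeCands⁻ p E qs
  go false d     qs       = (λ ())       , All-nodeCands⁻ p E qs

-- As for the test sets, the number of entries and the size of each are bounded separately. Lists of
-- candidates may be long, but only one representative of each node is passed upwards.
module ProcSize (p : Sexp) where

  private
    FitsRep : ℕ → Sexp → Set
    -- The first bound concerns the assignment itself and is the one preserved by joins; the
    -- wrapping adds 2, whence 9.
    FitsRep n r = size (hd r) ≤ 7 * n × size r ≤ 9 * n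

    Small : Sexp → Sexp → Set
    Small y r = size (hd r) ≤ 3 × len (tl r) ≤ size y × All (FitsRep (size y)) (tl r)

    Small-ε : ∀ y → Small y ε
    Small-ε y = m≤m+n 1 2 , z≤n , tt

    Small-≤ : ∀ {y z} → size y ≤ size z → ∀ r → Small y r → Small z r
    Small-≤ y≤z r (f , l , s) = f , ≤-trans l y≤z ,
      All-imp (λ (h , r≤) → ≤-trans h (*-monoʳ-≤ 7 y≤z) , ≤-trans r≤ (*-monoʳ-≤ 9 y≤z)) (tl r) s

    1≤k*size : ∀ k y → suc k ≤ suc k * size y
    1≤k*size k y = ≤-trans (≤-reflexive (sym (*-identityʳ (suc k)))) (*-monoʳ-≤ (suc k) (1≤size y))

    FitsCands : Sexp → Sexp → Set
    FitsCands y cs = All (λ c → size c ≤ 7 * size y) cs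

    small-finish : ∀ y cl → len cl ≤ size y → All (FitsCands y) cl →
                   Small y (run finishF (cl ◂ p))
    small-finish y cl l s =
      all-bool sameCofactorsF cl ,
      ≤-trans (≤-reflexive (len-map representativeF p cl)) l ,
      All-map {FitsCands y} {FitsRep (size y)} representativeF p (λ {cs} → rep {cs}) cl s
      where
      all-bool : ∀ f l → size (run (allF f) (l ◂ p)) ≤ 3
      all-bool f ε       = ≤-refl
      all-bool f (a ◂ b) = size-if≤ (bit (run f (a ◂ p))) (all-bool f b) (m≤m+n 1 2)
      rep : ∀ {cs} → FitsCands y cs → FitsRep (size y) (run representativeF (cs ◂ p))
      rep {ε}      _       = ≤-trans (m≤m+n 1 6) (1≤k*size 6 y) , ≤-trans (m≤m+n 1 8) (1≤k*size 8 y)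
      rep {c ◂ cs} (c≤ , _) = c≤ , (begin
        suc (size c + 1)        ≡⟨ cong suc (+-comm (size c) 1) ⟩
        2 + size c              ≤⟨ +-mono-≤ (1≤k*size 1 y) c≤ ⟩
        2 * size y + 7 * size y ≡⟨ *-distribʳ-+ (size y) 2 7 ⟨
        9 * size y              ∎)
        where open ≤-Reasoning

    small-leafCands : ∀ y x → (∀ c → size c ≤ 3 → size ((x ◂ c) ◂ ε) ≤ 7 * size y) →
                      ∀ ℓ → FitsCands y (run leafCandsF (ℓ ◂ x))
    small-leafCands y x lit≤ ε                 = lit≤ (ε ◂ ε) ≤-refl , tt
    small-leafCands y x lit≤ (_ ◂ ε)           = lit≤ ε (m≤m+n 1 2) , tt
    small-leafCands y x lit≤ (_ ◂ _ ◂ ε)       = tt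
    small-leafCands y x lit≤ (_ ◂ _ ◂ _ ◂ _)   =
      lit≤ ε (m≤m+n 1 2) , lit≤ (ε ◂ ε) ≤-refl , tt

    small-leaf : ∀ a b → Small (a ◂ b) (run finishF (run (mapF leafCandsF) (tl b ◂ hd b) ◂ p))
    small-leaf a ε       = small-finish (a ◂ ε) ε z≤n tt
    small-leaf a (x ◂ l) = small-finish (a ◂ x ◂ l) _
      (≤-trans (≤-reflexive (len-map leafCandsF x l)) (≤-trans (len≤size l)
        (m≤n⇒m≤1+n (≤-trans (m≤n⇒m≤1+n (m≤n+m (size l) (size x))) (m≤n+m _ (size a))))))
      (All-map {λ _ → ⊤} {FitsCands (a ◂ x ◂ l)} leafCandsF x
        (λ {ℓ} _ → small-leafCands (a ◂ x ◂ l) x (λ c → size-literal (a ◂ x ◂ l) x c x<) ℓ) l (All-universal (λ _ → tt) l))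
      where
      x< : suc (size x) ≤ size (a ◂ x ◂ l)
      x< = s≤s (≤-trans (m≤n⇒m≤1+n (m≤m+n (size x) (size l))) (m≤n+m _ (size a)))

    small : ∀ y → Small y (hd (procFold p y)) × Small y (hd (tl (procFold p y)))
                × Small y (tl (tl (procFold p y)))
    small ε       = Small-ε ε , Small-ε ε , Small-ε ε
    small (a ◂ b) = asNodes a , asTriple ,
      Small-≤ {a} {a ◂ b} (m≤n⇒m≤1+n (m≤m+n (size a) (size b))) A (proj₁ (small a))
      where
      A = hd (procFold p a)
      B = tl (tl (procFold p b))
      asNodes : ∀ a → Small (a ◂ b) (if bit a then hd (tl (procFold p b))
                        else run finishF (run (mapF leafCandsF) (tl b ◂ hd b) ◂ p))
      asNodes ε       = small-leaf ε b
      asNodes (c ◂ d) = Small-≤ {b} {(c ◂ d) ◂ b} (m≤n⇒m≤1+n (m≤n+m (size b) _))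
                          (hd (tl (procFold p b))) (proj₁ (proj₂ (small b)))
      reps = tl A ◂ tl B
      smallJoin : ∀ e → size (run joinF (e ◂ reps)) ≤ 7 * size (a ◂ b)
      smallJoin e = begin
        size (run joinF (e ◂ reps))    ≤⟨ size-append (hd (run firstRepF (e ◂ reps))) (hd (run secondRepF (e ◂ reps))) ⟩
        size (hd (run firstRepF (e ◂ reps))) + size (hd (run secondRepF (e ◂ reps)))
          ≤⟨ +-mono-≤
               (proj₁ (All-nth {FitsRep (size a)} (fits-ε a) (hd e) (tl A) (proj₂ (proj₂ (proj₁ (small a))))))
               (proj₁ (All-nth {FitsRep (size b)} (fits-ε b) (tl e) (tl B) (proj₂ (proj₂ (proj₂ (proj₂ (small b))))))) ⟩
        7 * size a + 7 * size b        ≡⟨ *-distribˡ-+ 7 (size a) (size b) ⟨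
        7 * (size a + size b)          ≤⟨ *-monoʳ-≤ 7 (n≤1+n _) ⟩
        7 * size (a ◂ b)               ∎
        where
        open ≤-Reasoning
        fits-ε : ∀ y → FitsRep (size y) ε
        fits-ε y = ≤-trans (m≤m+n 1 6) (1≤k*size 6 y) , ≤-trans (m≤m+n 1 8) (1≤k*size 8 y)
      cl = run (mapF nodeCandsF) (tl b ◂ reps)
      fits-cl : All (FitsCands (a ◂ b)) cl
      fits-cl = All-map {λ _ → ⊤} {FitsCands (a ◂ b)} nodeCandsF reps
        (λ {E} _ → All-nodeCands {λ c → size c ≤ 7 * size (a ◂ b)} reps E
          (All-universal (λ e _ _ → smallJoin e) E)) (tl b) (All-universal (λ _ → tt) (tl b))
      finished : Small (a ◂ b) (run finishF (cl ◂ p))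
      finished = small-finish (a ◂ b) cl
        (≤-trans (≤-reflexive (len-map nodeCandsF reps (tl b))) (≤-trans (len≤size (tl b))
          (≤-trans (size-tl b) (m≤n⇒m≤1+n (m≤n+m (size b) (size a))))))
        fits-cl
      asTriple : Small (a ◂ b) (run procNodeF (a ◂ b ◂ procFold p a ◂ procFold p b ◂ p))
      asTriple = size-if≤ (bit (hd (run finishF (cl ◂ p)))) (size-bool _) (m≤m+n 1 2) , proj₂ finished

    size-small : ∀ y r → Small y r → size r ≤ 4 + (1 + size y * suc (9 * size y))
    size-small y ε       _ = s≤s z≤n
    size-small y (f ◂ r) (f≤ , l , s) = s≤s (+-mono-≤ f≤ (≤-trans
      (size-All r (All-imp proj₂ r s)) (s≤s (*-monoˡ-≤ (suc (9 * size y)) l))))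

    size-split : ∀ y → size (procFold p y) ≤
      1 + (size (hd (procFold p y)) + (1 + (size (hd (tl (procFold p y))) + size (tl (tl (procFold p y))))))
    size-split ε       = m≤m+n 1 4
    size-split (a ◂ b) = ≤-refl

  size-proc : ∀ y → size (procFold p y) ≤
    1 + ((4 + (1 + size y * suc (9 * size y)))
      + (1 + ((4 + (1 + size y * suc (9 * size y))) + (4 + (1 + size y * suc (9 * size y))))))
  size-proc y = let s₁ , s₂ , s₃ = small y in ≤-trans (size-split y)
    (s≤s (+-mono-≤ (size-small y (hd r) s₁)
      (s≤s (+-mono-≤ (size-small y (hd (tl r)) s₂) (size-small y (tl (tl r)) s₃)))))
    where r = procFold p y

-- Arguments: nodes, parameters.
procF : Fn
procF = hdF ⊚ foldF nilF procStepF
  (poly-≤ (λ z → ≤-trans (ProcSize.size-proc (tl z) (hd z))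
            (s≤s (+-mono-≤ (b z) (s≤s (+-mono-≤ (b z) (b z))))))
    (poly-+ (poly-const 1) (poly-+ B-poly (poly-+ (poly-const 1) (poly-+ B-poly B-poly)))))
  where
  B : Sexp → ℕ
  B z = 4 + (1 + size z * suc (9 * size z))
  b : ∀ z → 4 + (1 + size (hd z) * suc (9 * size (hd z))) ≤ B z
  b z = +-monoʳ-≤ 5 (*-mono-≤ (size-hd z) (s≤s (*-monoʳ-≤ 9 (size-hd z))))
  B-poly : Poly B
  B-poly = poly-+ (poly-const 4) (poly-+ (poly-const 1)
    (poly-* poly-size (poly-+ (poly-const 1) (poly-* (poly-const 9) poly-size))))

-- Arguments: flag and representatives, false output, true output, parameters.
outputsF : Fn
outputsF = andF (hdF ⊚ v0) (andF (check v2 true′) (check v1 false′))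
  where
  value  = λ r → evalOutF ⊚ (hdF ⊚ r ▹ tlF ⊚ tlF ⊚ tlF)
  rep    = λ u → nthF ⊚ (u ▹ tlF ⊚ v0 ▹ nilF)
  true′  = value
  false′ = λ r → notF (value r)
  check : Fn → (Fn → Fn) → Fn
  check u test = ifF (rep u) (test (rep u)) trueF

opaque
  decisionF : Fn
  decisionF = outputsF ⊚ (procF ⊚ (hdF ⊚ v0 ▹ params) ▹ hdF ⊚ tlF ⊚ v0 ▹ tlF ⊚ tlF ⊚ v0 ▹ params)
    where
    params : Fn
    params = hdF ⊚ tlF ⊚ tlF ▹ tlF ⊚ tlF ⊚ tlF ▹ hdF ⊚ tlF ▹ nilF

-- Correctness of the elimination

bit-bool : ∀ b → bit (if b then ε ◂ ε else ε) ≡ b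
bit-bool true  = refl
bit-bool false = refl

bit-not : ∀ b → bit (if b then ε else ε ◂ ε) ≡ not b
bit-not true  = refl
bit-not false = refl

bit-and : ∀ b c → bit (if b then (if c then ε ◂ ε else ε) else ε) ≡ b ∧ c
bit-and true  c = bit-bool c
bit-and false c = refl

bit-xor : ∀ b c → bit (if b then (if c then ε else ε ◂ ε) else (if c then ε ◂ ε else ε)) ≡ b xor c
bit-xor true  c = bit-not c
bit-xor false c = bit-bool c

xor≡false⇒≡ : ∀ a b → a xor b ≡ false → a ≡ b
xor≡false⇒≡ true  true  _ = refl
xor≡false⇒≡ false false _ = refl

allF⇒All : ∀ f p l → bit (run (allF f) (l ◂ p)) ≡ true → All (λ x → bit (run f (x ◂ p)) ≡ true) l
allF⇒All f p ε       _ = tt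
allF⇒All f p (a ◂ l) eq with bit (run f (a ◂ p)) in eq′
... | true = refl , allF⇒All f p l eq

All⇒allF : ∀ f p l → All (λ x → bit (run f (x ◂ p)) ≡ true) l → bit (run (allF f) (l ◂ p)) ≡ true
All⇒allF f p ε       _ = refl
All⇒allF f p (a ◂ l) (eq , eqs) rewrite eq = All⇒allF f p l eqs

All-zip : ∀ {P Q : Sexp → Set} l → All P l → All Q l → All (λ x → P x × Q x) l
All-zip ε       _        _        = tt
All-zip (a ◂ l) (p , ps) (q , qs) = (p , q) , All-zip l ps qs

-- Unary numbers, positions in lists and assignments

num : ℕ → Sexp
num zero    = ε
num (suc n) = ε ◂ num n

dropℕ : ℕ → Sexp → Sexp
dropℕ zero    v = v
dropℕ (suc k) v = tl (dropℕ k v)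

len-num : ∀ k → len (num k) ≡ k
len-num zero    = refl
len-num (suc k) = cong suc (len-num k)

drop≡dropℕ : ∀ k v → run dropF (k ◂ v ◂ ε) ≡ dropℕ (len k) v
drop≡dropℕ ε       v = refl
drop≡dropℕ (_ ◂ k) v = cong tl (drop≡dropℕ k v)

drop-num : ∀ k v → run dropF (num k ◂ v ◂ ε) ≡ dropℕ k v
drop-num k v = trans (drop≡dropℕ (num k) v) (cong (λ k → dropℕ k v) (len-num k))

nth-num : ∀ k v → run nthF (num k ◂ v ◂ ε) ≡ hd (dropℕ k v)
nth-num k v = cong hd (drop-num k v)

dropℕ-tl : ∀ k v → dropℕ k (tl v) ≡ tl (dropℕ k v)
dropℕ-tl zero    v = refl
dropℕ-tl (suc k) v = cong tl (dropℕ-tl k v)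

tl-num : ∀ k → tl (num k) ≡ num (pred k)
tl-num zero    = refl
tl-num (suc k) = refl

dropℕ-num : ∀ i j → dropℕ i (num j) ≡ num (j ∸ i)
dropℕ-num zero    j = refl
dropℕ-num (suc i) j = trans (cong tl (dropℕ-num i j))
  (trans (tl-num (j ∸ i)) (cong num (pred[m∸n]≡m∸[1+n] j i)))

len-tl : ∀ v → len (tl v) ≡ pred (len v)
len-tl ε       = refl
len-tl (_ ◂ v) = refl

len-dropℕ : ∀ k v → len (dropℕ k v) ≡ len v ∸ k
len-dropℕ zero    v = refl
len-dropℕ (suc k) v = trans (len-tl (dropℕ k v))
  (trans (cong pred (len-dropℕ k v)) (pred[m∸n]≡m∸[1+n] (len v) k))

eqS : Sexp → Sexp → Bool
eqS x y = bit (run eqF (x ◂ y ◂ ε))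

eqS-num : ∀ i j → eqS (num i) (num j) ≡ not (bit (num (j ∸ i))) ∧ not (bit (num (i ∸ j)))
eqS-num i j rewrite trans (drop-num i (num j)) (dropℕ-num i j)
                  | trans (drop-num j (num i)) (dropℕ-num j i)
  with bit (num (j ∸ i)) | bit (num (i ∸ j))
... | true  | _     = refl
... | false | true  = refl
... | false | false = refl

eqS-refl : ∀ i → eqS (num i) (num i) ≡ true
eqS-refl i rewrite eqS-num i i | n∸n≡0 i = refl

eqS⇒≡ : ∀ i j → eqS (num i) (num j) ≡ true → i ≡ j
eqS⇒≡ i j eq rewrite eqS-num i j with j ∸ i in e₁ | i ∸ j in e₂
... | zero | zero = ≤-antisym (m∸n≡0⇒m≤n e₂) (m∸n≡0⇒m≤n e₁)

-- An association list a of literals overrides the total assignment α.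
ov : ∀ {n} → Sexp → (Fin n → Bool) → Fin n → Bool
ov ε       α x = α x
ov (e ◂ r) α x = if eqS (hd e) (num (toℕ x)) then bit (tl e) else ov r α x

ff : ∀ {n} → Fin n → Bool
ff _ = false

ov-cong : ∀ {n} a {α β : Fin n → Bool} {x} → α x ≡ β x → ov a α x ≡ ov a β x
ov-cong ε       eq = eq
ov-cong (e ◂ r) {x = x} eq with eqS (hd e) (num (toℕ x))
... | true  = refl
... | false = ov-cong r eq

ov-append : ∀ {n} a b (α : Fin n → Bool) x → ov (append a b) α x ≡ ov a (ov b α) x
ov-append ε       b α x = refl
ov-append (e ◂ r) b α x with eqS (hd e) (num (toℕ x))
... | true  = refl
... | false = ov-append r b α x

look : ∀ {n} a (x : Fin n) → bit (run lookF (a ◂ num (toℕ x) ◂ ε)) ≡ ov a ff x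
look ε       x = refl
look (e ◂ r) x with eqS (hd e) (num (toℕ x))
... | true  = bit-bool (bit (tl e))
... | false = look r x



-- A linear functional over GF(2). Its coefficients form an infinite sequence, so that dropping the
-- leading coordinate is a shift and lengths need not match.
dot : (ℕ → Bool) → Sexp → Bool
dot c ε       = false
dot c (a ◂ v) = (c zero ∧ bit a) xor dot (c ∘ suc) v

xor-interchange : ∀ a b c d → (a xor b) xor (c xor d) ≡ (a xor c) xor (b xor d)
xor-interchange = CommutativeSemigroupProperties.interchange
  (CommutativeRing.+-commutativeSemigroup xor-∧-commutativeRing)

zipXor : Sexp → Sexp → Sexp
zipXor ε       w = ε
zipXor (a ◂ v) w = (if bit a then (if bit (hd w) then ε else ε ◂ ε)
                             else (if bit (hd w) then ε ◂ ε else ε)) ◂ zipXor v (tl w)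

xorVec≡zipXor : ∀ v w → len v ≡ len w → xorVec v w ≡ zipXor v w
xorVec≡zipXor v w eq = go v 0 (trans (+-identityʳ (len v)) eq)
  where
  offset : ∀ a u k → len (a ◂ u) + k ≡ len w → len (run dropF ((a ◂ u) ◂ w ◂ ε)) ≡ k
  offset a u k eq = begin
    len (run dropF ((a ◂ u) ◂ w ◂ ε)) ≡⟨ cong len (drop≡dropℕ (a ◂ u) w) ⟩
    len (dropℕ (suc (len u)) w)       ≡⟨ len-dropℕ (suc (len u)) w ⟩
    len w ∸ suc (len u)               ≡⟨ cong (_∸ suc (len u)) eq ⟨
    suc (len u) + k ∸ suc (len u)     ≡⟨ m+n∸m≡n (suc (len u)) k ⟩
    k                                 ∎
    where open ≡-Reasoning
  -- `k` counts the entries already passed. The program recovers it as the length of `w` minus that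
  -- of the remaining part, which is where equal lengths are needed.
  go : ∀ u k → len u + k ≡ len w →
       fold (run nilF) (run xorVecStepF) (w ◂ ε) u ≡ zipXor u (dropℕ k w)
  go ε       k eq = refl
  go (a ◂ u) k eq = cong₂ _◂_
    (cong (λ x → if bit a then (if bit (hd x) then ε else ε ◂ ε) else (if bit (hd x) then ε ◂ ε else ε))
      (trans (drop≡dropℕ (run dropF ((a ◂ u) ◂ w ◂ ε)) w)
             (cong (λ k → dropℕ k w) (offset a u k eq))))
    (go u (suc k) (trans (+-suc (len u) k) eq))

len-zipXor : ∀ v w → len (zipXor v w) ≡ len v
len-zipXor ε       w = refl
len-zipXor (a ◂ v) w = cong suc (len-zipXor v (tl w))

∧-xor : ∀ a b c → a ∧ (b xor c) ≡ (a ∧ b) xor (a ∧ c)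
∧-xor false b c = refl
∧-xor true  b c = refl

dot-zipXor : ∀ c v w → len v ≡ len w → dot c (zipXor v w) ≡ dot c v xor dot c w
dot-zipXor c ε       ε       _  = refl
dot-zipXor c (a ◂ v) (b ◂ w) eq = begin
  (c 0 ∧ _) xor dot (c ∘ suc) (zipXor v w)
    ≡⟨ cong₂ (λ x y → (c 0 ∧ x) xor y) (bit-xor (bit a) (bit b)) (dot-zipXor (c ∘ suc) v w (suc-injective eq)) ⟩
  (c 0 ∧ (bit a xor bit b)) xor (dot (c ∘ suc) v xor dot (c ∘ suc) w)
    ≡⟨ cong (_xor (dot (c ∘ suc) v xor dot (c ∘ suc) w)) (∧-xor (c 0) (bit a) (bit b)) ⟩
  ((c 0 ∧ bit a) xor (c 0 ∧ bit b)) xor (dot (c ∘ suc) v xor dot (c ∘ suc) w)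
    ≡⟨ xor-interchange (c 0 ∧ bit a) _ _ _ ⟩
  dot c (a ◂ v) xor dot c (b ◂ w) ∎
  where open ≡-Reasoning

pivot-head : ∀ items → bit (pivot items) ≡ true → bit (hd (hd (pivot items))) ≡ true
pivot-head (it ◂ is) eq with bit (hd (hd it)) in e
... | true  = e
... | false = pivot-head is eq

pivot-exists : ∀ items → All (λ it → bit (hd (hd it)) ≡ true → bit (pivot items) ≡ true) items
pivot-exists ε         = tt
pivot-exists (it ◂ is) with bit (hd (hd it)) in e
... | true  = (λ _ → nonempty it e) , All-universal (λ _ _ → nonempty it e) is
  where
  nonempty : ∀ it → bit (hd (hd it)) ≡ true → bit it ≡ true
  nonempty (_ ◂ _) _ = refl
... | false = (λ ()) , pivot-exists is

module _ (h : Sexp → Bool) where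

  -- The invariant of the rounds: one functional `c`, common to all items, computes the value of `h`
  -- at each label from the current reduced vector.
  Represents : (ℕ → Bool) → ℕ → Sexp → Set
  Represents c r it = h (tl it) ≡ dot c (hd it) × len (hd it) ≡ r

  represents-elimItem : ∀ c r piv it →
    (bit piv ≡ true → bit (hd (hd piv)) ≡ true × Represents c (suc r) piv × h (tl piv) ≡ false) →
    (bit (hd (hd it)) ≡ true → bit piv ≡ true) → Represents c (suc r) it →
    Represents (c ∘ suc) r (run elimItemF (it ◂ piv))
  represents-elimItem c r piv ((a ◂ v) ◂ l) pivOK found (h≡ , len≡) with bit a in bit-a
  ... | false = trans h≡ (cong (_xor dot (c ∘ suc) v) (∧-zeroʳ (c 0))) , suc-injective len≡
  ... | true = reduce (hd piv) (pivOK (found refl))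
    where
    reduce : ∀ w → bit (hd w) ≡ true × (h (tl piv) ≡ dot c w × len w ≡ suc r) × h (tl piv) ≡ false →
      h l ≡ dot (c ∘ suc) (tl (xorVec (a ◂ v) w)) × len (tl (xorVec (a ◂ v) w)) ≡ r
    reduce (b ◂ w) (head , (hp≡ , lenp≡) , hp≡false)
      rewrite head = subst
      (λ z → h l ≡ dot (c ∘ suc) (tl z) × len (tl z) ≡ r)
      (sym (xorVec≡zipXor (a ◂ v) (b ◂ w) (trans len≡ (sym lenp≡))))
      ((begin
        h l                                          ≡⟨ h≡ ⟩
        (c 0 ∧ true) xor dot (c ∘ suc) v             ≡⟨ xor-comm (c 0 ∧ true) _ ⟩
        dot (c ∘ suc) v xor (c 0 ∧ true)
          ≡⟨ cong (dot (c ∘ suc) v xor_) (xor≡false⇒≡ _ _ (trans (sym hp≡) hp≡false)) ⟩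
        dot (c ∘ suc) v xor dot (c ∘ suc) w
          ≡⟨ dot-zipXor (c ∘ suc) v w (suc-injective (trans len≡ (sym lenp≡))) ⟨
        dot (c ∘ suc) (zipXor v w)                   ∎) ,
      trans (len-zipXor v w) (suc-injective len≡))
      where open ≡-Reasoning

  gauss-step : ∀ c r items → All (Represents c (suc r)) items →
    (bit (pivot items) ≡ true → h (tl (pivot items)) ≡ false) →
    All (Represents (c ∘ suc) r) (elim items (pivot items))
  gauss-step c r items rep out = All-map
    {λ it → (bit (hd (hd it)) ≡ true → bit (pivot items) ≡ true) × Represents c (suc r) it}
    {Represents (c ∘ suc) r} elimItemF (pivot items)
    (λ {it} (found , rep-it) → represents-elimItem c r (pivot items) it
       (λ piv → pivot-head items piv , All-pivot {Represents c (suc r)} items rep piv , out piv)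
       found rep-it)
    items (All-zip items (pivot-exists items) rep)

  gauss-loop : ∀ y c r items → All (Represents c (len y + r)) items →
    All (λ δ → h δ ≡ false) (hd (gaussFold (items ◂ ε) y)) →
    ∃[ c′ ] All (Represents c′ r) (tl (gaussFold (items ◂ ε) y))
  gauss-loop ε       c r items rep _   = c , rep
  gauss-loop (a ◂ y) c r items rep out =
    let out′ , piv-out = split (bit (pivot (tl st))) out
        -- The fold treats the tail of the counter first, which leaves one additional coordinate for
        -- the present round.
        c′ , rep′ = gauss-loop y c (suc r) items
          (subst (λ k → All (Represents c k) items) (sym (+-suc (len y) r)) rep) out′
    in c′ ∘ suc , gauss-step c′ r (tl st) rep′ piv-out
    where
    st = gaussFold (items ◂ ε) y
    split : ∀ b → All (λ δ → h δ ≡ false) (if b then tl (pivot (tl st)) ◂ hd st else hd st) →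
            All (λ δ → h δ ≡ false) (hd st) × (b ≡ true → h (tl (pivot (tl st))) ≡ false)
    split true  (p , out) = out , λ _ → p
    split false out       = out , λ ()

  -- After one round per coordinate all vectors are empty, and every functional is false on the
  -- empty vector.
  gauss-spans : ∀ counter items c → All (Represents c (len counter)) items →
    All (λ δ → h δ ≡ false) (gauss counter items) → All (λ it → h (tl it) ≡ false) items
  gauss-spans counter items c rep out =
    let c′ , rep′ = gauss-loop counter c 0 items
          (subst (λ k → All (Represents c k) items) (sym (+-identityʳ (len counter))) rep) out
    in All-gaussItems⁻ {λ δ → h δ ≡ false} (items ◂ ε) counter
         (All-imp (λ {it} → vanishes c′ it) (tl (gaussFold (items ◂ ε) counter)) rep′)
    where
    vanishes : ∀ c it → Represents c 0 it → h (tl it) ≡ false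
    vanishes c ε       (h≡ , _)  = h≡
    vanishes c (ε ◂ l) (h≡ , _)  = h≡

-- Circuits and cofactor tests

-- This and the following functions give preimages of the input encodings under `⌜_⌝`, on which
-- `run` can be evaluated.
dFins : ∀ {m} → List (Fin m) → Sexp
dFins []       = ε
dFins (i ∷ is) = num (toℕ i) ◂ dFins is

dGate : ∀ {n m} → Gate (Fin n) m → Sexp
dGate (const b) = num 0 ◂ fromBool b
dGate (lit x b) = num 1 ◂ num (toℕ x) ◂ fromBool b
dGate (and i j) = num 2 ◂ num (toℕ i) ◂ num (toℕ j)
dGate (or is)   = num 3 ◂ dFins is

dCircuit : ∀ {n m} → Circuit (Fin n) m → Sexp
dCircuit []      = ε
dCircuit (C ▷ g) = dGate g ◂ dCircuit C

dTree : ∀ {n} → Tree (Fin n) → Sexp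
dTree (leaf x)   = num 0 ◂ num (toℕ x)
dTree (node l r) = num 1 ◂ dTree l ◂ dTree r

nthBit : ℕ → Sexp → Bool
nthBit k v = bit (hd (dropℕ k v))

bit-fromBool : ∀ b → bit (fromBool b) ≡ b
bit-fromBool true  = refl
bit-fromBool false = refl

any-correct : ∀ {m} (V : Sexp) (val : Fin m → Bool) → (∀ i → nthBit (toℕ i) V ≡ val i) →
              ∀ is → bit (run anyF (dFins is ◂ V ◂ ε)) ≡ any val is
any-correct V val ok []       = refl
any-correct V val ok (i ∷ is)
  rewrite trans (cong bit (nth-num (toℕ i) V)) (ok i) with val i
... | true  = refl
... | false = any-correct V val ok is

gate-correct : ∀ {n m} (g : Gate (Fin n) m) V a (val : Fin m → Bool) →
  (∀ i → nthBit (toℕ i) V ≡ val i) →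
  bit (run gateF (dGate g ◂ V ◂ a ◂ ε)) ≡ evalGate g (ov a ff) val
gate-correct (const b) V a val ok = trans (bit-bool _) (bit-fromBool b)
gate-correct (lit x true)  V a val ok = trans (bit-bool _) (look a x)
gate-correct (lit x false) V a val ok = trans (bit-bool _)
  (trans (bit-not (bit (run lookF (a ◂ num (toℕ x) ◂ ε)))) (cong not (look a x)))
gate-correct (and i j) V a val ok = trans (bit-bool _)
  (trans (bit-and (bit (run nthF (num (toℕ i) ◂ V ◂ ε))) _)
    (cong₂ _∧_ (trans (cong bit (nth-num (toℕ i) V)) (ok i))
               (trans (cong bit (nth-num (toℕ j) V)) (ok j))))
gate-correct (or is) V a val ok = trans (bit-bool _) (any-correct V val ok is)

vals-correct : ∀ {n m} (C : Circuit (Fin n) m) a i →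
               nthBit (toℕ i) (vals (dCircuit C) a) ≡ evalCircuit C i (ov a ff)
vals-correct (C ▷ g) a zero    = gate-correct g (vals (dCircuit C) a) a _ (vals-correct C a)
vals-correct (C ▷ g) a (suc i) = trans
  (cong (bit ∘ hd) (sym (dropℕ-tl (toℕ i) (vals (dCircuit (C ▷ g)) a)))) (vals-correct C a i)

len-vals : ∀ {n m} (C : Circuit (Fin n) m) a → len (vals (dCircuit C) a) ≡ m
len-vals []      a = refl
len-vals (C ▷ g) a = cong suc (len-vals C a)

any-cong : ∀ {A : Set} {f g : A → Bool} (xs : List A) → (∀ x → f x ≡ g x) → any f xs ≡ any g xs
any-cong []       f≡g = refl
any-cong (x ∷ xs) f≡g = cong₂ _∨_ (f≡g x) (any-cong xs f≡g)

evalCircuit-local : ∀ {X m} (C : Circuit X m) i {α β : X → Bool} →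
  (∀ x → VarsBelow C i x → α x ≡ β x) → evalCircuit C i α ≡ evalCircuit C i β
evalCircuit-local (C ▷ g) (suc i) agree = evalCircuit-local C i agree
evalCircuit-local (C ▷ const b) zero agree = refl
evalCircuit-local (C ▷ lit x b) zero agree =
  cong (λ a → if b then a else not a) (agree x refl)
evalCircuit-local (C ▷ and i j) zero agree =
  cong₂ _∧_ (evalCircuit-local C i (λ x → agree x ∘ inj₁))
            (evalCircuit-local C j (λ x → agree x ∘ inj₂))
evalCircuit-local (C ▷ or is) zero {α} {β} agree = go is agree
  where
  go : ∀ is → (∀ x → Any (λ i → VarsBelow C i x) is → α x ≡ β x) →
       any (λ i → evalCircuit C i α) is ≡ any (λ i → evalCircuit C i β) is
  go []       agree = refl
  go (i ∷ is) agree = cong₂ _∨_ (evalCircuit-local C i (λ x → agree x ∘ here))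
                                (go is (λ x → agree x ∘ there))

evalCircuit-cong : ∀ {X m} (C : Circuit X m) i {α β : X → Bool} →
  (∀ x → α x ≡ β x) → evalCircuit C i α ≡ evalCircuit C i β
evalCircuit-cong C i eq = evalCircuit-local C i (λ x _ → eq x)

-- Subtrees of a vtree and assignments of their variables

LeafVars? : ∀ {n} (T : Tree (Fin n)) x → Dec (LeafVars T x)
LeafVars? (leaf y) x = map′ (tt ,_) proj₂ (y Fin.≟ x)
LeafVars? (node l r) x = map′ [ (λ (p , eq) → inj₁ p , eq) , (λ (p , eq) → inj₂ p , eq) ]′
  (λ where (inj₁ p , eq) → inj₁ (p , eq)
           (inj₂ p , eq) → inj₂ (p , eq)) (LeafVars? l x ⊎-dec LeafVars? r x)

Distinct : ∀ {X} → Tree X → Set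
Distinct T = Injective _≡_ _≡_ (label T)

module _ {X : Set} {l r : Tree X} where

  inˡ : ∀ {x} → LeafVars l x → LeafVars (node l r) x
  inˡ (p , eq) = inj₁ p , eq

  inʳ : ∀ {x} → LeafVars r x → LeafVars (node l r) x
  inʳ (p , eq) = inj₂ p , eq

  distinctˡ : Distinct (node l r) → Distinct l
  distinctˡ inj eq with inj {inj₁ _} {inj₁ _} eq
  ... | refl = refl

  distinctʳ : Distinct (node l r) → Distinct r
  distinctʳ inj eq with inj {inj₂ _} {inj₂ _} eq
  ... | refl = refl

  disjoint : Distinct (node l r) → ∀ {x} → LeafVars l x → LeafVars r x → ⊥
  disjoint inj (p , eq) (q , eq′) with inj {inj₁ p} {inj₂ q} (trans eq (sym eq′))
  ... | ()

infix 4 _⊑_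
data _⊑_ {X : Set} (S : Tree X) : Tree X → Set where
  here  : S ⊑ S
  left  : ∀ {l r} → S ⊑ l → S ⊑ node l r
  right : ∀ {l r} → S ⊑ r → S ⊑ node l r

⊑-trans : ∀ {X} {R S T : Tree X} → R ⊑ S → S ⊑ T → R ⊑ T
⊑-trans R⊑S here        = R⊑S
⊑-trans R⊑S (left S⊑l)  = left (⊑-trans R⊑S S⊑l)
⊑-trans R⊑S (right S⊑r) = right (⊑-trans R⊑S S⊑r)

⊑-vars : ∀ {X} {S T : Tree X} → S ⊑ T → ∀ {x} → LeafVars S x → LeafVars T x
⊑-vars here        x∈S = x∈S
⊑-vars (left S⊑l)  x∈S = inˡ (⊑-vars S⊑l x∈S)
⊑-vars (right S⊑r) x∈S = inʳ (⊑-vars S⊑r x∈S)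

⊑-distinct : ∀ {X} {S T : Tree X} → S ⊑ T → Distinct T → Distinct S
⊑-distinct here        d = d
⊑-distinct (left S⊑l)  d = ⊑-distinct S⊑l (distinctˡ d)
⊑-distinct (right S⊑r) d = ⊑-distinct S⊑r (distinctʳ d)

internal-⊑ : ∀ {X} {T t₁ t₂ : Tree X} → Internal T t₁ t₂ → t₁ ⊑ T × t₂ ⊑ T
internal-⊑ here      = left here , right here
internal-⊑ (left i)  = let s₁ , s₂ = internal-⊑ i in left s₁ , left s₂
internal-⊑ (right i) = let s₁ , s₂ = internal-⊑ i in right s₁ , right s₂

Disjoint : ∀ {X} → Tree X → Tree X → Set
Disjoint s t = ∀ {x} → LeafVars s x → ¬ LeafVars t x

-- If the internal node lies above `S`, then `S` is inside one child and misses the other; if the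
-- two are incomparable, both children miss `S`. So an ∧-gate that is not placed inside `S` has an
-- input independent of the variables of `S`.
internal-or-disjoint : ∀ {X} {T S t₁ t₂ : Tree X} → Distinct T → Internal T t₁ t₂ → S ⊑ T →
  (t₁ ⊑ S × t₂ ⊑ S) ⊎ (Disjoint t₁ S ⊎ Disjoint t₂ S)
internal-or-disjoint d i         here      = inj₁ (internal-⊑ i)
internal-or-disjoint d here      (left s)  = inj₂ (inj₂ λ x∈r x∈S → disjoint d (⊑-vars s x∈S) x∈r)
internal-or-disjoint d here      (right s) = inj₂ (inj₁ λ x∈l x∈S → disjoint d x∈l (⊑-vars s x∈S))
internal-or-disjoint d (left i)  (left s)  = internal-or-disjoint (distinctˡ d) i s
internal-or-disjoint d (right i) (right s) = internal-or-disjoint (distinctʳ d) i s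
internal-or-disjoint d (left i)  (right s) =
  inj₂ (inj₁ λ x∈t x∈S → disjoint d (⊑-vars (proj₁ (internal-⊑ i)) x∈t) (⊑-vars s x∈S))
internal-or-disjoint d (right i) (left s)  =
  inj₂ (inj₁ λ x∈t x∈S → disjoint d (⊑-vars s x∈S) (⊑-vars (proj₁ (internal-⊑ i)) x∈t))

-- That `δ` assigns exactly the variables of `S` is expressed by its effect as an override, so order
-- and repetitions in the list do not matter.
Complete : ∀ {n} → Tree (Fin n) → Sexp → Set
Complete S δ = (∀ {x} → LeafVars S x → ∀ α β → ov δ α x ≡ ov δ β x)
             × (∀ {x} → ¬ LeafVars S x → ∀ α → ov δ α x ≡ α x)

complete-append : ∀ {n} {l r : Tree (Fin n)} → Distinct (node l r) → ∀ {a b} →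
                  Complete l a → Complete r b → Complete (node l r) (append a b)
complete-append {l = l} {r} d {a} {b} (fixa , freea) (fixb , freeb) = fix , free
  where
  fix : ∀ {x} → LeafVars (node l r) x → ∀ α β → ov (append a b) α x ≡ ov (append a b) β x
  fix {x} x∈ α β rewrite ov-append a b α x | ov-append a b β x with x∈
  ... | inj₁ p , eq = fixa (p , eq) _ _
  ... | inj₂ p , eq = ov-cong a (fixb (p , eq) α β)
  free : ∀ {x} → ¬ LeafVars (node l r) x → ∀ α → ov (append a b) α x ≡ α x
  free {x} x∉ α = trans (ov-append a b α x) (trans (freea (x∉ ∘ inˡ) (ov b α)) (freeb (x∉ ∘ inʳ) α))

complete-literal : ∀ {n} (x : Fin n) c → Complete (leaf x) ((num (toℕ x) ◂ c) ◂ ε)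
complete-literal {n} x c = fix , free
  where
  fix : ∀ {y} → LeafVars (leaf x) y → ∀ (α β : Fin n → Bool) →
        ov ((num (toℕ x) ◂ c) ◂ ε) α y ≡ ov ((num (toℕ x) ◂ c) ◂ ε) β y
  fix (_ , refl) α β rewrite eqS-refl (toℕ x) = refl
  free : ∀ {y} → ¬ LeafVars (leaf x) y → ∀ (α : Fin n → Bool) →
         ov ((num (toℕ x) ◂ c) ◂ ε) α y ≡ α y
  free {y} y∉ α with eqS (num (toℕ x)) (num (toℕ y)) in eq
  ... | true  = ⊥-elim (y∉ (tt , Fin.toℕ-injective (eqS⇒≡ (toℕ x) (toℕ y) eq)))
  ... | false = refl

ov-literal : ∀ {n} (x : Fin n) c (α : Fin n → Bool) → ov ((num (toℕ x) ◂ c) ◂ ε) α x ≡ bit c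
ov-literal x c α rewrite eqS-refl (toℕ x) = refl

ov-literal-unique : ∀ {n} (x : Fin n) c {α β : Fin n → Bool} → β x ≡ bit c →
  (∀ {y} → ¬ LeafVars (leaf x) y → β y ≡ α y) → ∀ y → ov ((num (toℕ x) ◂ c) ◂ ε) α y ≡ β y
ov-literal-unique x c {α} βx agree y with LeafVars? (leaf x) y
... | yes (_ , refl) = trans (ov-literal x c α) (sym βx)
... | no y∉          = trans (proj₂ (complete-literal x c) y∉ α) (sym (agree y∉))

-- Functionals on vectors of gate values

dot-zero : ∀ c v → (∀ j → c j ≡ false) → dot c v ≡ false
dot-zero c ε       z = refl
dot-zero c (a ◂ v) z rewrite z 0 = dot-zero (c ∘ suc) v (z ∘ suc)

dot-unit : ∀ k v → dot (k ≡ᵇ_) v ≡ nthBit k v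
dot-unit zero    ε       = refl
dot-unit (suc k) ε       = trans (dot-unit k ε) (cong (bit ∘ hd) (dropℕ-tl k ε))
dot-unit zero    (a ◂ v) = trans (cong (bit a xor_) (dot-zero _ v (λ _ → refl))) (xor-identityʳ (bit a))
dot-unit (suc k) (a ◂ v) = trans (dot-unit k v) (cong (bit ∘ hd) (dropℕ-tl k (a ◂ v)))

dot-xor : ∀ c d v → dot (λ j → c j xor d j) v ≡ dot c v xor dot d v
dot-xor c d ε       = refl
dot-xor c d (a ◂ v) = trans
  (cong₂ _xor_ (distrib (c 0) (d 0) (bit a)) (dot-xor (c ∘ suc) (d ∘ suc) v))
  (xor-interchange (c 0 ∧ bit a) (d 0 ∧ bit a) _ _)
  where
  distrib : ∀ a b c → (a xor b) ∧ c ≡ (a ∧ c) xor (b ∧ c)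
  distrib a b c = trans (∧-comm (a xor b) c) (trans (∧-xor c a b) (cong₂ _xor_ (∧-comm c a) (∧-comm c b)))

nth-append₁ : ∀ k v w → k < len v → nthBit k (append v w) ≡ nthBit k v
nth-append₁ zero    (a ◂ v) w _       = refl
nth-append₁ (suc k) (a ◂ v) w (s≤s k<) = trans (cong (bit ∘ hd) (sym (dropℕ-tl k (a ◂ append v w))))
  (trans (nth-append₁ k v w k<) (cong (bit ∘ hd) (dropℕ-tl k (a ◂ v))))

nth-append₂ : ∀ k v w → nthBit (len v + k) (append v w) ≡ nthBit k w
nth-append₂ k ε       w = refl
nth-append₂ k (a ◂ v) w = trans (cong (bit ∘ hd) (sym (dropℕ-tl (len v + k) (a ◂ append v w))))
  (nth-append₂ k v w)

module CofactorTest {n m} (T : Tree (Fin n)) (distinct : Distinct T)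
  (covers : ∀ x → LeafVars T x)
  (C : Circuit (Fin n) m) (out : Fin m)
  (struct : EveryGate (StructuredGate T) C) (det : EveryGate DeterministicGate C)
  (α β : Sexp) where

  private
    params : Sexp
    params = dCircuit C ◂ α ◂ β ◂ ε

    vec : Sexp → Sexp
    vec δ = run vecF (δ ◂ params)

    valsα valsβ : Sexp → Sexp
    valsα δ = vals (dCircuit C) (append α δ)
    valsβ δ = vals (dCircuit C) (append β δ)

    len-append : ∀ a b → len (append a b) ≡ len a + len b
    len-append ε       b = refl
    len-append (_ ◂ a) b = cong suc (len-append a b)

    len-vec : ∀ δ → len (vec δ) ≡ suc (m + m)
    len-vec δ = cong suc (trans (len-append (valsα δ) (valsβ δ))
      (cong₂ _+_ (len-vals C (append α δ)) (len-vals C (append β δ))))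

  module _ (S : Tree (Fin n)) (S⊑T : S ⊑ T) where

    -- The coefficients are chosen before `δ`. They may depend on the assignment outside `S`, which
    -- is fixed.
    Linear : (Sexp → Bool) → Set
    Linear h = ∃[ c ] ∀ δ → Complete S δ → h δ ≡ dot c (vec δ)

    linear-cong : ∀ {h h′} → (∀ δ → Complete S δ → h′ δ ≡ h δ) → Linear h → Linear h′
    linear-cong h′≡h (c , h≡) = c , λ δ comp → trans (h′≡h δ comp) (h≡ δ comp)

    linear-false : Linear (λ _ → false)
    linear-false = (λ _ → false) , λ δ _ → sym (dot-zero _ (vec δ) (λ _ → refl))

    -- Coordinate 0 is the constant that `vecF` puts in front of the gate values; it makes constants
    -- linear.
    linear-true : Linear (λ _ → true)
    linear-true = (0 ≡ᵇ_) , λ δ _ → sym (dot-unit 0 (vec δ))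

    linear-const : ∀ b → Linear (λ _ → b)
    linear-const true  = linear-true
    linear-const false = linear-false

    linear-xor : ∀ {h h′} → Linear h → Linear h′ → Linear (λ δ → h δ xor h′ δ)
    linear-xor (c , h≡) (c′ , h′≡) = (λ j → c j xor c′ j) , λ δ comp →
      trans (cong₂ _xor_ (h≡ δ comp) (h′≡ δ comp)) (sym (dot-xor c c′ (vec δ)))

    linear-∧ : ∀ b {h} → Linear h → Linear (λ δ → b ∧ h δ)
    linear-∧ true  lin = lin
    linear-∧ false lin = linear-false

    linear-α : ∀ i → Linear (λ δ → evalCircuit C i (ov α (ov δ ff)))
    linear-α i = (suc (toℕ i) ≡ᵇ_) , λ δ _ → begin
      evalCircuit C i (ov α (ov δ ff))     ≡⟨ evalCircuit-cong C i (ov-append α δ ff) ⟨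
      evalCircuit C i (ov (append α δ) ff) ≡⟨ vals-correct C (append α δ) i ⟨
      nthBit (toℕ i) (valsα δ)             ≡⟨ nth-append₁ (toℕ i) (valsα δ) (valsβ δ) (i<len δ) ⟨
      nthBit (toℕ i) (tl (vec δ))          ≡⟨ cong (bit ∘ hd) (dropℕ-tl (toℕ i) (vec δ)) ⟩
      nthBit (suc (toℕ i)) (vec δ)         ≡⟨ dot-unit (suc (toℕ i)) (vec δ) ⟨
      dot (suc (toℕ i) ≡ᵇ_) (vec δ)        ∎
      where
      open ≡-Reasoning
      i<len : ∀ δ → toℕ i < len (valsα δ)
      i<len δ = subst (toℕ i <_) (sym (len-vals C (append α δ))) (Fin.toℕ<n i)

    linear-β : ∀ i → Linear (λ δ → evalCircuit C i (ov β (ov δ ff)))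
    linear-β i = (suc (m + toℕ i) ≡ᵇ_) , λ δ _ → begin
      evalCircuit C i (ov β (ov δ ff))     ≡⟨ evalCircuit-cong C i (ov-append β δ ff) ⟨
      evalCircuit C i (ov (append β δ) ff) ≡⟨ vals-correct C (append β δ) i ⟨
      nthBit (toℕ i) (valsβ δ)             ≡⟨ nth-append₂ (toℕ i) (valsα δ) (valsβ δ) ⟨
      nthBit (len (valsα δ) + toℕ i) (tl (vec δ))
        ≡⟨ cong (λ k → nthBit (k + toℕ i) (tl (vec δ))) (len-vals C (append α δ)) ⟩
      nthBit (m + toℕ i) (tl (vec δ))      ≡⟨ cong (bit ∘ hd) (dropℕ-tl (m + toℕ i) (vec δ)) ⟩
      nthBit (suc (m + toℕ i)) (vec δ)     ≡⟨ dot-unit (suc (m + toℕ i)) (vec δ) ⟨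
      dot (suc (m + toℕ i) ≡ᵇ_) (vec δ)    ∎
      where open ≡-Reasoning

    module _ (θ : Sexp) (e : Fin n → Bool) where

      inside : ∀ {x} δ → LeafVars S x → Complete S δ → ov θ (ov δ e) x ≡ ov θ (ov δ ff) x
      inside δ x∈S (fix , _) = ov-cong θ (fix x∈S e ff)

      outside : ∀ {x} δ → ¬ LeafVars S x → Complete S δ → ov θ (ov δ e) x ≡ ov θ e x
      outside δ x∉S (_ , free) = ov-cong θ (free x∉S e)

      -- Only the gates in the subtree S depend on δ; determinism turns an
      -- ∨-gate into a sum over GF(2), and an ∧-gate above S has a constant input.
      linear : ∀ {k} (C : Circuit (Fin n) k) →
        EveryGate (StructuredGate T) C → EveryGate DeterministicGate C →
        (∀ i → Linear (λ δ → evalCircuit C i (ov θ (ov δ ff)))) →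
        ∀ i → Linear (λ δ → evalCircuit C i (ov θ (ov δ e)))
      linear (C ▷ g) (s , _) (d , _) lin (suc i) = linear C s d (lin ∘ suc) i
      linear (C ▷ const b) _ _ lin zero = lin zero
      linear (C ▷ lit x b) _ _ lin zero with LeafVars? S x
      ... | yes x∈S = linear-cong (λ δ comp → cong (λ a → if b then a else not a) (inside δ x∈S comp)) (lin zero)
      ... | no  x∉S = linear-cong (λ δ comp → cong (λ a → if b then a else not a) (outside δ x∉S comp))
                                  (linear-const _)
      linear (C ▷ and i j) (s , (t₁ , t₂ , int , vars)) (d , _) lin zero =
        combine vars (internal-or-disjoint distinct int S⊑T)
        where
        below : Tree (Fin n) → Fin _ → Set
        below t i = ∀ {x} → VarsBelow C i x → LeafVars t x
        bothInside : t₁ ⊑ S × t₂ ⊑ S → Linear (λ δ → evalCircuit C i (ov θ (ov δ e)) ∧ evalCircuit C j (ov θ (ov δ e)))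
        bothInside (s₁ , s₂) = linear-cong
          (λ δ comp → evalCircuit-local (C ▷ and i j) zero λ x x∈ → inside δ (in-S vars x∈) comp) (lin zero)
          where
          in-S : ∀ {x} → (below t₁ i × below t₂ j) ⊎ (below t₂ i × below t₁ j) →
                 VarsBelow C i x ⊎ VarsBelow C j x → LeafVars S x
          in-S (inj₁ (p , q)) (inj₁ x∈) = ⊑-vars s₁ (p x∈)
          in-S (inj₁ (p , q)) (inj₂ x∈) = ⊑-vars s₂ (q x∈)
          in-S (inj₂ (p , q)) (inj₁ x∈) = ⊑-vars s₂ (p x∈)
          in-S (inj₂ (p , q)) (inj₂ x∈) = ⊑-vars s₁ (q x∈)
        constant : ∀ t i → Disjoint t S → below t i → ∀ δ → Complete S δ →
                   evalCircuit C i (ov θ (ov δ e)) ≡ evalCircuit C i (ov θ e)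
        constant t i disj sub δ comp =
          evalCircuit-local C i (λ x x∈ → outside δ (disj (sub x∈)) comp)
        rec : ∀ i → Linear (λ δ → evalCircuit C i (ov θ (ov δ e)))
        rec = linear C s d (lin ∘ suc)
        firstOutside : ∀ t → Disjoint t S → below t i →
          Linear (λ δ → evalCircuit C i (ov θ (ov δ e)) ∧ evalCircuit C j (ov θ (ov δ e)))
        firstOutside t disj sub = linear-cong
          (λ δ comp → cong (_∧ evalCircuit C j (ov θ (ov δ e))) (constant t i disj sub δ comp))
          (linear-∧ (evalCircuit C i (ov θ e)) (rec j))
        secondOutside : ∀ t → Disjoint t S → below t j →
          Linear (λ δ → evalCircuit C i (ov θ (ov δ e)) ∧ evalCircuit C j (ov θ (ov δ e)))
        secondOutside t disj sub = linear-cong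
          (λ δ comp → trans (∧-comm (evalCircuit C i (ov θ (ov δ e))) _)
            (cong (_∧ evalCircuit C i (ov θ (ov δ e))) (constant t j disj sub δ comp)))
          (linear-∧ (evalCircuit C j (ov θ e)) (rec i))
        combine : (below t₁ i × below t₂ j) ⊎ (below t₂ i × below t₁ j) →
                  (t₁ ⊑ S × t₂ ⊑ S) ⊎ (Disjoint t₁ S ⊎ Disjoint t₂ S) →
                  Linear (λ δ → evalCircuit C i (ov θ (ov δ e)) ∧ evalCircuit C j (ov θ (ov δ e)))
        combine _              (inj₁ both)        = bothInside both
        combine (inj₁ (p , _)) (inj₂ (inj₁ disj)) = firstOutside t₁ disj p
        combine (inj₁ (_ , q)) (inj₂ (inj₂ disj)) = secondOutside t₂ disj q
        combine (inj₂ (_ , q)) (inj₂ (inj₁ disj)) = secondOutside t₁ disj q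
        combine (inj₂ (p , _)) (inj₂ (inj₂ disj)) = firstOutside t₂ disj p
      linear (C ▷ or is) (s , _) (d , dg) lin zero = go is dg
        where
        rec : ∀ i → Linear (λ δ → evalCircuit C i (ov θ (ov δ e)))
        rec = linear C s d (lin ∘ suc)
        go : ∀ is → AllPairs (λ i j → NotSimultaneouslySat (evalCircuit C i) (evalCircuit C j)) is →
             Linear (λ δ → any (λ i → evalCircuit C i (ov θ (ov δ e))) is)
        go []       _         = linear-false
        go (i ∷ is) (di ∷ ds) = linear-cong (λ δ _ → ∨≡xor (ov θ (ov δ e)) is di)
                                            (linear-xor (rec i) (go is ds))
          where
          none : ∀ a is → ListAll.All (λ j → NotSimultaneouslySat (evalCircuit C i) (evalCircuit C j)) is →
                 evalCircuit C i a ≡ true → any (λ i → evalCircuit C i a) is ≡ false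
          none a []       _          _  = refl
          none a (j ∷ js) (dj ListAll.∷ djs) eq with evalCircuit C j a in eq′
          ... | true  = ⊥-elim (dj a (eq , eq′))
          ... | false = none a js djs eq
          ∨≡xor : ∀ a is → ListAll.All (λ j → NotSimultaneouslySat (evalCircuit C i) (evalCircuit C j)) is →
                  evalCircuit C i a ∨ any (λ i → evalCircuit C i a) is
                  ≡ evalCircuit C i a xor any (λ i → evalCircuit C i a) is
          ∨≡xor a is djs with evalCircuit C i a in eq
          ... | true  = cong not (sym (none a is djs eq))
          ... | false = refl

  private
    h : (Fin n → Bool) → Bool
    h φ = evalCircuit C out (ov α φ) xor evalCircuit C out (ov β φ)

    h-cong : ∀ {φ ψ} → (∀ x → φ x ≡ ψ x) → h φ ≡ h ψ
    h-cong eq = cong₂ _xor_ (evalCircuit-cong C out (λ x → ov-cong α (eq x)))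
                            (evalCircuit-cong C out (λ x → ov-cong β (eq x)))

    linear-h : ∀ S (S⊑T : S ⊑ T) e → Linear S S⊑T (λ δ → h (ov δ e))
    linear-h S S⊑T e = linear-xor S S⊑T
      (linear S S⊑T α e C struct det (linear-α S S⊑T) out)
      (linear S S⊑T β e C struct det (linear-β S S⊑T) out)

  testSet : Tree (Fin n) → Sexp
  testSet S = hd (setsFold params (dTree S))

  private
    items : Sexp → Sexp
    items B = run (mapF itemF) (B ◂ params)

  complete-testSet : ∀ S → S ⊑ T → All (Complete S) (testSet S)
  complete-testSet (leaf x) _ = complete-literal x ε , complete-literal x (ε ◂ ε) , tt
  complete-testSet (node l r) S⊑T =
    All-gaussOut {Complete (node l r)} (items B ◂ ε) (vec ε)
      (All-map {Complete (node l r)} {Complete (node l r) ∘ tl} itemF params (λ c → c) B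
        (All-prod {Complete l} {Complete r} {Complete (node l r)}
          (λ {a} {b} → complete-append (⊑-distinct S⊑T distinct) {a} {b}) (testSet l) (testSet r)
          (complete-testSet l (⊑-trans (left here) S⊑T))
          (complete-testSet r (⊑-trans (right here) S⊑T))))
    where B = prod (testSet l) (testSet r)

  -- At an inner node, `gauss-spans` leads from the thinned set back to the whole product. For each
  -- fixed member `b` of the right set, the induction hypothesis for `l` over the base `ov b e` then
  -- replaces the members of the left set by `φ`. Finally the induction hypothesis for `r` replaces
  -- `b`.
  testSet-suffices : ∀ S → S ⊑ T → ∀ e → All (λ δ → h (ov δ e) ≡ false) (testSet S) →
    ∀ φ → (∀ {x} → ¬ LeafVars S x → φ x ≡ e x) → h φ ≡ false
  testSet-suffices (leaf x) S⊑T e (h₀ , h₁ , _) φ φ≡e with φ x in φx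
  ... | false = trans (sym (h-cong (ov-literal-unique x ε φx φ≡e))) h₀
  ... | true  = trans (sym (h-cong (ov-literal-unique x (ε ◂ ε) φx φ≡e))) h₁
  testSet-suffices S@(node l r) S⊑T e tested φ φ≡e =
    -- The base is now `φ` itself, so agreement outside `r` is trivial.
    testSet-suffices r r⊑T φ
      (All-imp (λ {b} (b∈ , tested-b) → slice b b∈ tested-b) (testSet r)
         (All-zip (testSet r) (complete-testSet r r⊑T) swapped))
      φ (λ _ → refl)
    where
    l⊑T = ⊑-trans (left here) S⊑T
    r⊑T = ⊑-trans (right here) S⊑T
    B = prod (testSet l) (testSet r)
    c = proj₁ (linear-h S S⊑T e)

    complete-B : All (Complete S) B
    complete-B = All-prod {Complete l} {Complete r} {Complete (node l r)}
      (λ {a} {b} → complete-append (⊑-distinct S⊑T distinct) {a} {b}) (testSet l) (testSet r)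
      (complete-testSet l l⊑T) (complete-testSet r r⊑T)

    vanishing : All (λ δ → h (ov δ e) ≡ false) B
    vanishing = All-map⁻ {λ δ → h (ov δ e) ≡ false} {λ it → h (ov (tl it) e) ≡ false} itemF params (λ q → q) B
      (gauss-spans (λ δ → h (ov δ e)) (vec ε) (items B) c
        (All-map {Complete S} {Represents (λ δ → h (ov δ e)) c (len (vec ε))} itemF params
          (λ {δ} comp → proj₂ (linear-h S S⊑T e) δ comp , trans (len-vec δ) (sym (len-vec ε)))
          B complete-B)
        tested)

    swapped : All (λ b → All (λ a → h (ov (append a b) e) ≡ false) (testSet l)) (testSet r)
    swapped = transpose (testSet l) (testSet r) (All-prod⁻ (testSet l) (testSet r) vanishing)
      where
      transpose : ∀ {R : Sexp → Sexp → Set} A B → All (λ a → All (R a) B) A → All (λ b → All (λ a → R a b) A) B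
      transpose ε       B _        = All-universal (λ _ → tt) B
      transpose {R} (a ◂ A) B (r , rs) = All-zip B r (transpose {R} A B rs)

    slice : ∀ b → Complete r b → All (λ a → h (ov (append a b) e) ≡ false) (testSet l) →
            h (ov b φ) ≡ false
    slice b (fix , free) tested-b = testSet-suffices l l⊑T (ov b e)
      (All-imp (λ {a} eq → trans (sym (h-cong (ov-append a b e))) eq) (testSet l) tested-b)
      (ov b φ) agree
      where
      agree : ∀ {x} → ¬ LeafVars l x → ov b φ x ≡ ov b e x
      agree {x} x∉l with LeafVars? r x
      ... | yes x∈r = fix x∈r φ e
      ... | no  x∉r = ov-cong b (φ≡e λ where
        (inj₁ p , eq) → x∉l (p , eq)
        (inj₂ p , eq) → x∉r (p , eq))

  private
    env : Sexp
    env = dCircuit C ◂ num (toℕ out) ◂ dTree T ◂ ε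

  evalOut-correct : ∀ a → bit (run evalOutF (a ◂ env)) ≡ evalCircuit C out (ov a ff)
  evalOut-correct a = trans (cong bit (nth-num (toℕ out) (vals (dCircuit C) a))) (vals-correct C a out)

  agree-correct : ∀ γ → bit (run agreeF (γ ◂ α ◂ β ◂ env)) ≡ not (h (ov γ ff))
  agree-correct γ = trans (bit-not _) (cong not (trans (bit-xor (bit (value α)) (bit (value β)))
    (cong₂ _xor_ (value-correct α) (value-correct β))))
    where
    value : Sexp → Sexp
    value θ = run evalOutF (append θ γ ◂ env)
    value-correct : ∀ θ → bit (value θ) ≡ evalCircuit C out (ov θ (ov γ ff))
    value-correct θ = trans (evalOut-correct (append θ γ)) (evalCircuit-cong C out (ov-append θ γ ff))

  SameCofactor : Set
  SameCofactor = ∀ φ → evalCircuit C out (ov α φ) ≡ evalCircuit C out (ov β φ)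

  opaque
    unfolding sameCofactorF

    sameCofactor-sound : bit (run sameCofactorF (β ◂ α ◂ env)) ≡ true → SameCofactor
    -- `T` covers all variables, so the base `ff` puts no condition on `φ`.
    sameCofactor-sound eq φ = xor≡false⇒≡ _ _ (testSet-suffices T here ff
      (All-imp (λ {γ} ok → not≡true (trans (sym (agree-correct γ)) ok)) (testSet T)
        (allF⇒All agreeF (α ◂ β ◂ env) (testSet T) eq))
      φ (λ {x} x∉T → ⊥-elim (x∉T (covers x))))
      where
      not≡true : ∀ {b} → not b ≡ true → b ≡ false
      not≡true {false} _ = refl

    sameCofactor-complete : SameCofactor → bit (run sameCofactorF (β ◂ α ◂ env)) ≡ true
    sameCofactor-complete same = All⇒allF agreeF (α ◂ β ◂ env) (testSet T)
      (All-universal (λ γ → trans (agree-correct γ)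
         (cong not (trans (cong (_xor _) (same (ov γ ff))) (xor-same (evalCircuit C out (ov β (ov γ ff))))))) (testSet T))

-- Semantics of tree decision diagrams

private variable
  X : Set
  n k : ℕ

∧-true : ∀ a b → a ∧ b ≡ true → a ≡ true × b ≡ true
∧-true true true _ = refl , refl

any⇒∈ : ∀ {A : Set} (f : A → Bool) xs → any f xs ≡ true → ∃[ x ] x ∈ xs × f x ≡ true
any⇒∈ f xs eq = let x , x∈ , fx = find (any⁻ f xs (Equivalence.from T-≡ eq)) in x , x∈ , Equivalence.to T-≡ fx

∈⇒any : ∀ {A : Set} (f : A → Bool) {x} xs → x ∈ xs → f x ≡ true → any f xs ≡ true
∈⇒any f xs x∈ fx = Equivalence.to T-≡ (any⁺ f (lose x∈ (Equivalence.from T-≡ fx)))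

module _ {k₁ k₂} (S : Fin k₁ × Fin k₂ → Bool) where

  elements⁻ : ∀ {p} → p ∈ elements S → S p ≡ true
  elements⁻ p∈ = Equivalence.to T-≡ (proj₂ (∈-filter⁻ (T? ∘ S) {xs = cartesianProduct (allFin k₁) (allFin k₂)} p∈))

  elements⁺ : ∀ {p} → S p ≡ true → p ∈ elements S
  elements⁺ {v , w} eq = ∈-filter⁺ (T? ∘ S) (∈-cartesianProduct⁺ (∈-allFin v) (∈-allFin w))
    (Equivalence.from T-≡ eq)

module _ {l r : Tree X} {k₁ k₂ k} (N₁ : Nodes l k₁) (N₂ : Nodes r k₂)
         (E : Fin (suc k) → Fin k₁ × Fin k₂ → Bool) (P : IsPartition E) where

  eval-node⁻ : ∀ u α → eval (node N₁ N₂ E P) u α ≡ true →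
    ∃[ v ] ∃[ w ] E u (v , w) ≡ true × eval N₁ v α ≡ true × eval N₂ w α ≡ true
  eval-node⁻ u α eq =
    let (v , w) , vw∈ , vw≡ = any⇒∈ _ (elements (E u)) eq
        v≡ , w≡ = ∧-true _ _ vw≡
    in v , w , elements⁻ (E u) vw∈ , v≡ , w≡

  eval-node⁺ : ∀ u {v w} α → E u (v , w) ≡ true → eval N₁ v α ≡ true → eval N₂ w α ≡ true →
    eval (node N₁ N₂ E P) u α ≡ true
  eval-node⁺ u α e v≡ w≡ = ∈⇒any _ (elements (E u)) (elements⁺ (E u) e) (cong₂ _∧_ v≡ w≡)

eval-local : ∀ {T : Tree X} (N : Nodes T k) u {α β} → (∀ {x} → LeafVars T x → α x ≡ β x) →
             eval N u α ≡ eval N u β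
eval-local (leaf ℓ _ _)      u agree = cong ⟦ ℓ u ⟧ˡ (agree (tt , refl))
eval-local (node N₁ N₂ E P) u agree = any-cong (elements (E u)) λ (v , w) →
  cong₂ _∧_ (eval-local N₁ v (agree ∘ inˡ)) (eval-local N₂ w (agree ∘ inʳ))

-- With `eval-unique`, the functions of the nodes at one position partition the assignments.
eval-exists : ∀ {T : Tree X} (N : Nodes T k) α → ∃[ u ] eval N u α ≡ true
eval-exists (leaf {x = x} ℓ _ complete) α = complete (α x)
eval-exists (node N₁ N₂ E P) α =
  let v , v≡ = eval-exists N₁ α
      w , w≡ = eval-exists N₂ α
      u , u≡ = IsPartition.covering P (v , w)
  in u , eval-node⁺ N₁ N₂ E P u α u≡ v≡ w≡

eval-unique : ∀ {T : Tree X} (N : Nodes T k) {u u′} α →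
              eval N u α ≡ true → eval N u′ α ≡ true → u ≡ u′
eval-unique (leaf ℓ unsat _) {u} {u′} α u≡ u′≡ with u Fin.≟ u′
... | yes u≡u′ = u≡u′
... | no  u≢u′ = ⊥-elim (unsat u≢u′ α (u≡ , u′≡))
eval-unique (node N₁ N₂ E P) {u} {u′} α u≡ u′≡
  with eval-node⁻ N₁ N₂ E P u α u≡ | eval-node⁻ N₁ N₂ E P u′ α u′≡
... | v , w , e , v≡ , w≡ | v′ , w′ , e′ , v′≡ , w′≡
  with eval-unique N₁ α v≡ v′≡ | eval-unique N₂ α w≡ w′≡ | u Fin.≟ u′
... | _    | _    | yes u≡u′ = u≡u′
... | refl | refl | no  u≢u′ = ⊥-elim (IsPartition.disjoint P u≢u′ (v , w) (e , e′))

dTab : (Fin k → Sexp) → Sexp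
dTab {zero}  f = ε
dTab {suc k} f = f zero ◂ dTab (f ∘ suc)

dLabel : LeafLabel → Sexp
dLabel pos = num 0
dLabel neg = num 1
dLabel bot = num 2
dLabel top = num 3

dPairs : ∀ {k₁ k₂} → List (Fin k₁ × Fin k₂) → Sexp
dPairs []             = ε
dPairs ((v , w) ∷ ps) = (num (toℕ v) ◂ num (toℕ w)) ◂ dPairs ps

dNodes : {T : Tree (Fin n)} → Nodes T k → Sexp
dNodes (leaf {x = x} ℓ _ _) = num 0 ◂ num (toℕ x) ◂ dTab (dLabel ∘ ℓ)
dNodes (node N₁ N₂ E _)     = num 1 ◂ dNodes N₁ ◂ dNodes N₂ ◂ dTab (λ u → dPairs (elements (E u)))

map-dTab : ∀ f p (g : Fin k → Sexp) → run (mapF f) (dTab g ◂ p) ≡ dTab (λ u → run f (g u ◂ p))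
map-dTab {zero}  f p g = refl
map-dTab {suc k} f p g = cong (run f (g zero ◂ p) ◂_) (map-dTab f p (g ∘ suc))

nth-dTab : ∀ (g : Fin k → Sexp) u → run nthF (num (toℕ u) ◂ dTab g ◂ ε) ≡ g u
nth-dTab g u = trans (nth-num (toℕ u) (dTab g)) (go g u)
  where
  go : ∀ {k} (g : Fin k → Sexp) u → hd (dropℕ (toℕ u) (dTab g)) ≡ g u
  go g zero    = refl
  go g (suc u) = trans (cong hd (sym (dropℕ-tl (toℕ u) (dTab g)))) (go (g ∘ suc) u)

All-dTab⁺ : ∀ {P : Sexp → Set} (g : Fin k → Sexp) → (∀ u → P (g u)) → All P (dTab g)
All-dTab⁺ {zero}  g p = tt
All-dTab⁺ {suc k} g p = p zero , All-dTab⁺ (g ∘ suc) (p ∘ suc)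

All-dTab⁻ : ∀ {P : Sexp → Set} (g : Fin k → Sexp) → All P (dTab g) → ∀ u → P (g u)
All-dTab⁻ g (p , ps) zero    = p
All-dTab⁻ g (p , ps) (suc u) = All-dTab⁻ (g ∘ suc) ps u

All-dPairs⁺ : ∀ {k₁ k₂} {P : Sexp → Set} (ps : List (Fin k₁ × Fin k₂)) →
  (∀ {v w} → (v , w) ∈ ps → P (num (toℕ v) ◂ num (toℕ w))) → All P (dPairs ps)
All-dPairs⁺ []             p = tt
All-dPairs⁺ ((v , w) ∷ ps) p = p (here refl) , All-dPairs⁺ ps (p ∘ there)

All-dPairs⁻ : ∀ {k₁ k₂} {P : Sexp → Set} (ps : List (Fin k₁ × Fin k₂)) → All P (dPairs ps) →
  ∀ {v w} → (v , w) ∈ ps → P (num (toℕ v) ◂ num (toℕ w))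
All-dPairs⁻ (_ ∷ ps) (p , _)  (here refl) = p
All-dPairs⁻ (_ ∷ ps) (_ , ps′) (there x∈)  = All-dPairs⁻ ps ps′ x∈

representative : Sexp → Sexp
representative cs = if bit cs then hd cs ◂ ε else ε

bit-representative : ∀ cs → bit (representative cs) ≡ bit cs
bit-representative ε       = refl
bit-representative (_ ◂ _) = refl

hd-representative : ∀ cs → hd (representative cs) ≡ hd cs
hd-representative ε       = refl
hd-representative (_ ◂ _) = refl

cands : {T : Tree (Fin n)} → Nodes T k → Fin k → Sexp
cands (leaf {x = x} ℓ _ _) u = run leafCandsF (dLabel (ℓ u) ◂ num (toℕ x))
cands (node N₁ N₂ E _)     u =
  nodeCands (dPairs (elements (E u))) (dTab (representative ∘ cands N₁) ◂ dTab (representative ∘ cands N₂))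

module _ {l r : Tree (Fin n)} {k₁ k₂ k} (N₁ : Nodes l k₁) (N₂ : Nodes r k₂)
         (E : Fin (suc k) → Fin k₁ × Fin k₂ → Bool) (part : IsPartition E) where

  private
    reps = dTab (representative ∘ cands N₁) ◂ dTab (representative ∘ cands N₂)

    Join : (Sexp → Set) → Fin k₁ → Fin k₂ → Set
    Join P v w = bit (cands N₁ v) ≡ true → bit (cands N₂ w) ≡ true →
                 P (append (hd (cands N₁ v)) (hd (cands N₂ w)))

    Joins≡Join : ∀ P v w → Joins P reps (num (toℕ v) ◂ num (toℕ w)) ≡ Join P v w
    Joins≡Join P v w
      rewrite nth-dTab (representative ∘ cands N₁) v | nth-dTab (representative ∘ cands N₂) w
            | bit-representative (cands N₁ v) | bit-representative (cands N₂ w)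
            | hd-representative (cands N₁ v) | hd-representative (cands N₂ w) = refl

  All-cands⁺ : ∀ {P : Sexp → Set} u → (∀ {v w} → E u (v , w) ≡ true → Join P v w) →
               All P (cands (node N₁ N₂ E part) u)
  All-cands⁺ {P} u f = All-nodeCands {P} reps (dPairs (elements (E u)))
    (All-dPairs⁺ {P = Joins P reps} (elements (E u))
      (λ {v} {w} vw∈ → subst (λ A → A) (sym (Joins≡Join P v w)) (f (elements⁻ (E u) vw∈))))

  All-cands⁻ : ∀ {P : Sexp → Set} u → All P (cands (node N₁ N₂ E part) u) →
               ∀ {v w} → E u (v , w) ≡ true → Join P v w
  All-cands⁻ {P} u all {v} {w} e = subst (λ A → A) (Joins≡Join P v w)
    (All-dPairs⁻ {P = Joins P reps} (elements (E u))
      (All-nodeCands⁻ {P} reps (dPairs (elements (E u))) all) (elements⁺ (E u) e))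

Satisfies : {T : Tree (Fin n)} → Nodes T k → Fin k → Sexp → Set
Satisfies {T = T} N u c = Complete T c × ∀ φ → eval N u (ov c φ) ≡ true

nonempty-hd : ∀ {P : Sexp → Set} cs → All P cs → bit cs ≡ true → P (hd cs)
nonempty-hd (c ◂ cs) (p , _) _ = p

cands-satisfy : ∀ {T : Tree (Fin n)} → Distinct T → (N : Nodes T k) → ∀ u →
                All (Satisfies N u) (cands N u)
cands-satisfy d (leaf {x = x} ℓ _ _) u with ℓ u
... | pos = (complete-literal x (ε ◂ ε) , ov-literal x (ε ◂ ε)) , tt
... | neg = (complete-literal x ε , λ φ → cong not (ov-literal x ε φ)) , tt
... | bot = tt
... | top = (complete-literal x ε , λ φ → refl) , (complete-literal x (ε ◂ ε) , λ φ → refl) , tt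
cands-satisfy d (node N₁ N₂ E part) u = All-cands⁺ N₁ N₂ E part u λ {v} {w} e v+ w+ →
  let a = hd (cands N₁ v)
      b = hd (cands N₂ w)
      ca , sa = nonempty-hd {Satisfies N₁ v} (cands N₁ v) (cands-satisfy (distinctˡ d) N₁ v) v+
      cb , sb = nonempty-hd {Satisfies N₂ w} (cands N₂ w) (cands-satisfy (distinctʳ d) N₂ w) w+
  in complete-append d {a} {b} ca cb , λ φ →
     trans (eval-local (node N₁ N₂ E part) u (λ {x} _ → ov-append a b φ x))
       (eval-node⁺ N₁ N₂ E part u (ov a (ov b φ)) e (sa (ov b φ))
         (trans (eval-local N₂ w (λ x∈r → proj₂ ca (λ x∈l → disjoint d x∈l x∈r) (ov b φ))) (sb φ)))

-- Correctness of the algorithm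

∧₃-⇔ : ∀ {x a b c} {A B C : Set} → x ≡ a ∧ b ∧ c →
  (a ≡ true ⇔ A) → (b ≡ true ⇔ B) → (c ≡ true ⇔ C) → (x ≡ true ⇔ (A × B × C))
∧₃-⇔ {a = a} {b} {c} refl p q r = mk⇔
  (λ eq → let a≡ , bc≡ = ∧-true a (b ∧ c) eq
              b≡ , c≡  = ∧-true b c bc≡
          in Equivalence.to p a≡ , Equivalence.to q b≡ , Equivalence.to r c≡)
  (λ (a≡ , b≡ , c≡) → cong₂ _∧_ (Equivalence.from p a≡)
                       (cong₂ _∧_ (Equivalence.from q b≡) (Equivalence.from r c≡)))

opaque
  result : Sexp → Sexp → Sexp
  result p d = run procF (d ◂ p)

  result-leaf : ∀ p x L →
    result p (num 0 ◂ x ◂ L) ≡ run finishF (run (mapF leafCandsF) (L ◂ x) ◂ p)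
  result-leaf p x L = refl

  combine : Sexp → Sexp → Sexp → Sexp
  combine r r₁ r₂ = fromAnd (bit (hd r)) (bit (hd r₁)) (bit (hd r₂)) ◂ tl r
    where
    fromAnd : Bool → Bool → Bool → Sexp
    fromAnd a b c = if a then (if bit (if b then (if c then ε ◂ ε else ε) else ε) then ε ◂ ε else ε) else ε

  hd-combine : ∀ r r₁ r₂ → bit (hd (combine r r₁ r₂)) ≡ bit (hd r) ∧ bit (hd r₁) ∧ bit (hd r₂)
  hd-combine r r₁ r₂ = trans (bit-and (bit (hd r)) _) (cong (bit (hd r) ∧_) (bit-and (bit (hd r₁)) _))

  tl-combine : ∀ r r₁ r₂ → tl (combine r r₁ r₂) ≡ tl r
  tl-combine r r₁ r₂ = refl

  -- Computation unfolds three layers of the fold: the tagged encoding, its tail read as a triple,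
  -- and the tail of that read as a pair.
  result-node : ∀ p x y L → result p (num 1 ◂ x ◂ y ◂ L) ≡
    combine (run finishF (run (mapF nodeCandsF) (L ◂ tl (result p x) ◂ tl (result p y)) ◂ p))
            (result p x) (result p y)
  result-node p x y L = refl

-- An output node without a representative is unsatisfiable, so its test succeeds by default.
trueTest falseTest : Sexp → Sexp → Sexp
trueTest  env r = if bit r then run evalOutF (hd r ◂ env) else ε ◂ ε
falseTest env r = if bit r then (if bit (run evalOutF (hd r ◂ env)) then ε else ε ◂ ε) else ε ◂ ε

opaque
  unfolding result decisionF

  main-run : ∀ N f t T C o → let env = C ◂ o ◂ T ◂ ε ; r = result env N in
    bit (run decisionF ((N ◂ f ◂ t) ◂ T ◂ C ◂ o)) ≡
    bit (hd r) ∧ bit (trueTest env (run nthF (t ◂ tl r ◂ ε)))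
               ∧ bit (falseTest env (run nthF (f ◂ tl r ◂ ε)))
  main-run N f t T C o = trans
    (bit-and (bit (hd r)) (bit (if bit c then (if bit d then ε ◂ ε else ε) else ε)))
    (cong (bit (hd r) ∧_) (bit-and (bit c) (bit d)))
    where
    env r c d : Sexp
    env = C ◂ o ◂ T ◂ ε
    r = result env N
    c = trueTest env (run nthF (t ◂ tl r ◂ ε))
    d = falseTest env (run nthF (f ◂ tl r ◂ ε))

module Correctness {n m} (T′ : Tree (Fin n)) (distinct′ : Distinct T′)
  (covers′ : ∀ x → LeafVars T′ x)
  (C : Circuit (Fin n) m) (out : Fin m)
  (struct : EveryGate (StructuredGate T′) C) (det : EveryGate DeterministicGate C) where

  private
    module Test = CofactorTest T′ distinct′ covers′ C out struct det

    env : Sexp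
    env = dCircuit C ◂ num (toℕ out) ◂ dTree T′ ◂ ε

    F : BoolFun (Fin n)
    F = evalCircuit C out

    F-cong : ∀ {φ ψ} → (∀ x → φ x ≡ ψ x) → F φ ≡ F ψ
    F-cong = evalCircuit-cong C out

    SameCofactors : Sexp → Set
    SameCofactors cs = All (λ c → Test.SameCofactor (hd cs) c) cs

    sameCofactors⇔ : ∀ cs → bit (run sameCofactorsF (cs ◂ env)) ≡ true ⇔ SameCofactors cs
    sameCofactors⇔ cs = mk⇔
      (λ eq → All-imp (λ {c} → Test.sameCofactor-sound (hd cs) c) cs
                (allF⇒All sameCofactorF (hd cs ◂ env) cs eq))
      (λ same → All⇒allF sameCofactorF (hd cs ◂ env) cs
                  (All-imp (λ {c} → Test.sameCofactor-complete (hd cs) c) cs same))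

  Checked : ∀ {T : Tree (Fin n)} {k} → Nodes T k → Set
  Checked N@(leaf _ _ _)     = ∀ u → SameCofactors (cands N u)
  Checked N@(node N₁ N₂ _ _) = (∀ u → SameCofactors (cands N u)) × Checked N₁ × Checked N₂

  private
    reps-map : ∀ {k} f p (g : Fin k → Sexp) →
      run (mapF representativeF) (run (mapF f) (dTab g ◂ p) ◂ env)
      ≡ dTab (λ u → representative (run f (g u ◂ p)))
    reps-map f p g = trans (cong (λ l → run (mapF representativeF) (l ◂ env)) (map-dTab f p g))
                           (map-dTab representativeF env _)

    flag-map : ∀ {k} f p (g : Fin k → Sexp) →
      bit (run (allF sameCofactorsF) (run (mapF f) (dTab g ◂ p) ◂ env)) ≡ true
      ⇔ (∀ u → SameCofactors (run f (g u ◂ p)))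
    flag-map f p g = subst
      (λ l → bit (run (allF sameCofactorsF) (l ◂ env)) ≡ true ⇔ (∀ u → SameCofactors (run f (g u ◂ p))))
      (sym (map-dTab f p g)) (mk⇔
        (λ eq u → Equivalence.to (sameCofactors⇔ (h u))
           (All-dTab⁻ {P = Same} h (allF⇒All sameCofactorsF env (dTab h) eq) u))
        (λ same → All⇒allF sameCofactorsF env (dTab h)
           (All-dTab⁺ {P = Same} h (λ u → Equivalence.from (sameCofactors⇔ (h u)) (same u)))))
      where
      h = λ u → run f (g u ◂ p)
      Same : Sexp → Set
      Same cs = bit (run sameCofactorsF (cs ◂ env)) ≡ true

  proc : ∀ {T : Tree (Fin n)} {k} → Nodes T k → Sexp
  proc N = result env (dNodes N)

  private
    finished : ∀ {k} → (Fin k → Sexp) → Sexp → Sexp → Sexp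
    finished edges r₁ r₂ = run finishF (run (mapF nodeCandsF) (dTab edges ◂ tl r₁ ◂ tl r₂) ◂ env)

  reps-correct : ∀ {T : Tree (Fin n)} {k} (N : Nodes T k) →
                 tl (proc N) ≡ dTab (representative ∘ cands N)
  reps-correct (leaf {x = x} ℓ _ _) = trans (cong tl (result-leaf env (num (toℕ x)) (dTab (dLabel ∘ ℓ))))
    (reps-map leafCandsF (num (toℕ x)) (dLabel ∘ ℓ))
  reps-correct (node N₁ N₂ E _) = begin
    tl (result env (num 1 ◂ dNodes N₁ ◂ dNodes N₂ ◂ dTab edges))
      ≡⟨ cong tl (result-node env (dNodes N₁) (dNodes N₂) (dTab edges)) ⟩
    tl (combine (finished edges (proc N₁) (proc N₂)) (proc N₁) (proc N₂))
      ≡⟨ tl-combine (finished edges (proc N₁) (proc N₂)) (proc N₁) (proc N₂) ⟩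
    run (mapF representativeF) (run (mapF nodeCandsF) (dTab edges ◂ tl (proc N₁) ◂ tl (proc N₂)) ◂ env)
      ≡⟨ cong₂ (λ r₁ r₂ → run (mapF representativeF) (run (mapF nodeCandsF) (dTab edges ◂ r₁ ◂ r₂) ◂ env))
           (reps-correct N₁) (reps-correct N₂) ⟩
    run (mapF representativeF) (run (mapF nodeCandsF)
      (dTab edges ◂ dTab (representative ∘ cands N₁) ◂ dTab (representative ∘ cands N₂)) ◂ env)
      ≡⟨ reps-map nodeCandsF (dTab (representative ∘ cands N₁) ◂ dTab (representative ∘ cands N₂)) edges ⟩
    dTab (λ u → representative (nodeCands (edges u)
      (dTab (representative ∘ cands N₁) ◂ dTab (representative ∘ cands N₂)))) ∎
    where
    open ≡-Reasoning
    edges = λ u → dPairs (elements (E u))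

  flag-correct : ∀ {T : Tree (Fin n)} {k} (N : Nodes T k) →
                 bit (hd (proc N)) ≡ true ⇔ Checked N
  flag-correct (leaf {x = x} ℓ u c) = subst
    (λ r → bit (hd r) ≡ true ⇔ Checked (leaf {x = x} ℓ u c))
    (sym (result-leaf env (num (toℕ x)) (dTab (dLabel ∘ ℓ)))) (flag-map leafCandsF (num (toℕ x)) (dLabel ∘ ℓ))
  flag-correct N@(node N₁ N₂ E part) = ∧₃-⇔ flag≡ own⇔ (flag-correct N₁) (flag-correct N₂)
    where
    edges = λ u → dPairs (elements (E u))
    ownFlag : Bool
    ownFlag = bit (hd (finished edges (proc N₁) (proc N₂)))
    flag≡ : bit (hd (proc N)) ≡ ownFlag ∧ bit (hd (proc N₁)) ∧ bit (hd (proc N₂))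
    flag≡ = trans (cong (bit ∘ hd) (result-node env (dNodes N₁) (dNodes N₂) (dTab edges)))
                  (hd-combine (finished edges (proc N₁) (proc N₂)) (proc N₁) (proc N₂))
    own⇔ : ownFlag ≡ true ⇔ (∀ u → SameCofactors (cands N u))
    own⇔ = subst₂ (λ r₁ r₂ →
        bit (run (allF sameCofactorsF) (run (mapF nodeCandsF) (dTab edges ◂ r₁ ◂ r₂) ◂ env)) ≡ true
        ⇔ (∀ u → SameCofactors (cands N u)))
      (sym (reps-correct N₁)) (sym (reps-correct N₂))
      (flag-map nodeCandsF (dTab (representative ∘ cands N₁) ◂ dTab (representative ∘ cands N₂)) edges)

  -- First the part of `α` on the right subtree is replaced by its representative `b`, which leaves
  -- the left one alone, then the left part by `a`. The result is the candidate joined from `a` and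
  -- `b`, and by the check it has the same cofactor as the first candidate.
  cofactor-of-representative : ∀ {T : Tree (Fin n)} {k} → Distinct T → (N : Nodes T k) → Checked N →
    ∀ u α → eval N u α ≡ true →
    bit (cands N u) ≡ true × F (ov (hd (cands N u)) α) ≡ F α
  cofactor-of-representative d (leaf {x = x} ℓ _ _) checked u α α⊨u
    with ℓ u | checked u | α x in αx
  ... | pos | _ | true  = refl , F-cong (ov-literal-unique x (ε ◂ ε) αx (λ _ → refl))
  ... | neg | _ | false = refl , F-cong (ov-literal-unique x ε αx (λ _ → refl))
  ... | top | _ | false = refl , F-cong (ov-literal-unique x ε αx (λ _ → refl))
  ... | top | (_ , same , _) | true =
    refl , trans (same α) (F-cong (ov-literal-unique x (ε ◂ ε) αx (λ _ → refl)))
  cofactor-of-representative d N@(node N₁ N₂ E part) (same , checked₁ , checked₂) u α α⊨u =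
    let v , w , e , v≡ , w≡ = eval-node⁻ N₁ N₂ E part u α α⊨u
        b+ , Fb = cofactor-of-representative (distinctʳ d) N₂ checked₂ w α w≡
        b = hd (cands N₂ w)
        completeb , _ = nonempty-hd {Satisfies N₂ w} (cands N₂ w) (cands-satisfy (distinctʳ d) N₂ w) b+
        a+ , Fa = cofactor-of-representative (distinctˡ d) N₁ checked₁ v (ov b α)
          (trans (eval-local N₁ v (λ x∈l → proj₂ completeb (disjoint d x∈l) α)) v≡)
        a = hd (cands N₁ v)
        first~ab = All-cands⁻ N₁ N₂ E part {λ c → Test.SameCofactor (hd (cands N u)) c} u (same u) e a+ b+
    -- If the list were empty, all candidates would satisfy the predicate `⊥`, in particular the one
    -- joined from `a` and `b`.
    in nonempty (cands N u) (λ none → All-cands⁻ N₁ N₂ E part {λ _ → ⊥} u none e a+ b+) ,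
       (begin
         F (ov (hd (cands N u)) α) ≡⟨ first~ab α ⟩
         F (ov (append a b) α)     ≡⟨ F-cong (ov-append a b α) ⟩
         F (ov a (ov b α))         ≡⟨ Fa ⟩
         F (ov b α)                ≡⟨ Fb ⟩
         F α                       ∎)
    where
    open ≡-Reasoning
    nonempty : ∀ cs → (All (λ _ → ⊥) cs → ⊥) → bit cs ≡ true
    nonempty ε       f = ⊥-elim (f tt)
    nonempty (_ ◂ _) f = refl

  Factors : ∀ {T : Tree (Fin n)} {k} → Nodes T k → Set
  Factors {T} N = ∀ u {α β} → eval N u α ≡ true → eval N u β ≡ true →
                  (∀ {x} → ¬ LeafVars T x → α x ≡ β x) → F α ≡ F β

  factors⇒same : ∀ {T : Tree (Fin n)} {k} → Distinct T → (N : Nodes T k) → Factors N →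
                 ∀ u → SameCofactors (cands N u)
  factors⇒same {T} d N fac u = go (cands N u) (cands-satisfy d N u)
    where
    go : ∀ cs → All (Satisfies N u) cs → SameCofactors cs
    go ε        _                         = tt
    go (c ◂ cs) all@((comp , sat) , _) = All-imp
      (λ (comp′ , sat′) φ → fac u (sat φ) (sat′ φ)
         (λ x∉T → trans (proj₂ comp x∉T φ) (sym (proj₂ comp′ x∉T φ))))
      (c ◂ cs) all

  -- `Factors` passes to the children: assignments that agree outside one child satisfy the same
  -- node of the other child, hence the same edge, and so the same node of the parent.
  factors⇒checked : ∀ {T : Tree (Fin n)} {k} → Distinct T → (N : Nodes T k) → Factors N → Checked N
  factors⇒checked d N@(leaf _ _ _) fac = factors⇒same d N fac
  factors⇒checked d N@(node {l = l} {r = r} N₁ N₂ E part) fac =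
    factors⇒same d N fac , factors⇒checked (distinctˡ d) N₁ fac₁ , factors⇒checked (distinctʳ d) N₂ fac₂
    where
    fac₁ : Factors N₁
    fac₁ v {α} {β} v≡ v≡′ agree =
      let w , w≡ = eval-exists N₂ α
          w≡′ = trans (sym (eval-local N₂ w (λ x∈r → agree (λ x∈l → disjoint d x∈l x∈r)))) w≡
          u , e = IsPartition.covering part (v , w)
      in fac u (eval-node⁺ N₁ N₂ E part u α e v≡ w≡) (eval-node⁺ N₁ N₂ E part u β e v≡′ w≡′)
           (λ x∉ → agree (x∉ ∘ inˡ))
    fac₂ : Factors N₂
    fac₂ w {α} {β} w≡ w≡′ agree =
      let v , v≡ = eval-exists N₁ α
          v≡′ = trans (sym (eval-local N₁ v (λ x∈l → agree (disjoint d x∈l)))) v≡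
          u , e = IsPartition.covering part (v , w)
      in fac u (eval-node⁺ N₁ N₂ E part u α e v≡ w≡) (eval-node⁺ N₁ N₂ E part u β e v≡′ w≡′)
           (λ x∉ → agree (x∉ ∘ inʳ))

  module _ {T : Tree (Fin n)} {k} (distinct : Distinct T) (covers : ∀ x → LeafVars T x)
    (N : Nodes T k) (f t : Fin k) (f≢t : f ≢ t) (f-or-t : ∀ u → u ≡ f ⊎ u ≡ t) where

    private
      input : Sexp
      input = (dNodes N ◂ num (toℕ f) ◂ num (toℕ t)) ◂ dTree T′ ◂ dCircuit C ◂ num (toℕ out)

      first : Fin k → Sexp
      first u = hd (cands N u)

      rep : Fin k → Sexp
      rep u = run nthF (num (toℕ u) ◂ tl (proc N) ◂ ε)

      rep≡ : ∀ u → rep u ≡ representative (cands N u)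
      rep≡ u = trans (cong (λ l → run nthF (num (toℕ u) ◂ l ◂ ε)) (reps-correct N))
                     (nth-dTab (representative ∘ cands N) u)

      Outputs : Fin k → Bool → Set
      Outputs u b = bit (cands N u) ≡ true → F (ov (first u) ff) ≡ b

      check-true : bit (trueTest env (rep t)) ≡ true ⇔ Outputs t true
      check-true = subst (λ r → bit (trueTest env r) ≡ true ⇔ Outputs t true) (sym (rep≡ t)) (go (cands N t))
        where
        go : ∀ cs → bit (trueTest env (representative cs)) ≡ true ⇔ (bit cs ≡ true → F (ov (hd cs) ff) ≡ true)
        go ε       = mk⇔ (λ _ ()) (λ _ → refl)
        go (c ◂ _) = mk⇔ (λ eq _ → trans (sym (Test.evalOut-correct ε ε c)) eq)
                         (λ eq → trans (Test.evalOut-correct ε ε c) (eq refl))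

      check-false : bit (falseTest env (rep f)) ≡ true ⇔ Outputs f false
      check-false = subst (λ r → bit (falseTest env r) ≡ true ⇔ Outputs f false) (sym (rep≡ f)) (go (cands N f))
        where
        go : ∀ cs → bit (falseTest env (representative cs)) ≡ true ⇔ (bit cs ≡ true → F (ov (hd cs) ff) ≡ false)
        go ε       = mk⇔ (λ _ ()) (λ _ → refl)
        go (c ◂ _) = mk⇔
          (λ eq _ → trans (sym (Test.evalOut-correct ε ε c)) (not-true (trans (sym (bit-not _)) eq)))
          (λ eq → trans (bit-not _) (cong not (trans (Test.evalOut-correct ε ε c) (eq refl))))
          where
          not-true : ∀ {b} → not b ≡ true → b ≡ false
          not-true {false} _ = refl

    main-flag : bit (run decisionF input) ≡ true ⇔ (Checked N × Outputs t true × Outputs f false)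
    main-flag = ∧₃-⇔
      (main-run (dNodes N) (num (toℕ f)) (num (toℕ t)) (dTree T′) (dCircuit C) (num (toℕ out)))
      (flag-correct N) check-true check-false

    private
      isTrue : Fin k → Bool
      isTrue u = does (u Fin.≟ t)

      output-correct : ∀ u φ → eval N u φ ≡ true → eval N t φ ≡ isTrue u
      output-correct u φ u≡ with u Fin.≟ t
      ... | yes refl = u≡
      ... | no  u≢t  = ¬-not (λ t≡ → u≢t (eval-unique N φ u≡ t≡))

      isTrue-t : isTrue t ≡ true
      isTrue-t with t Fin.≟ t
      ... | yes _   = refl
      ... | no  t≢t = ⊥-elim (t≢t refl)

      isTrue-f : isTrue f ≡ false
      isTrue-f with f Fin.≟ t
      ... | yes f≡t = ⊥-elim (f≢t f≡t)
      ... | no  _   = refl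

    main-correct : bit (run decisionF input) ≡ true ⇔ (∀ φ → eval N t φ ≡ F φ)
    main-correct = mk⇔ (to ∘ Equivalence.to main-flag) (Equivalence.from main-flag ∘ from)
      where
      open ≡-Reasoning
      to : Checked N × Outputs t true × Outputs f false → ∀ φ → eval N t φ ≡ F φ
      to (checked , out-t , out-f) φ = begin
        eval N t φ            ≡⟨ output-correct u φ u≡ ⟩
        isTrue u              ≡⟨ outputs (f-or-t u) ⟨
        -- At the root the representative assigns all variables, so the base is irrelevant.
        F (ov (first u) ff)   ≡⟨ F-cong (λ x → proj₁ completeu (covers x) ff φ) ⟩
        F (ov (first u) φ)    ≡⟨ Fu ⟩
        F φ                   ∎
        where
        u  = proj₁ (eval-exists N φ)
        u≡ = proj₂ (eval-exists N φ)
        u+ = proj₁ (cofactor-of-representative distinct N checked u φ u≡)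
        Fu = proj₂ (cofactor-of-representative distinct N checked u φ u≡)
        completeu = proj₁ (nonempty-hd {Satisfies N u} (cands N u) (cands-satisfy distinct N u) u+)
        outputs : u ≡ f ⊎ u ≡ t → F (ov (first u) ff) ≡ isTrue u
        outputs (inj₁ u≡f) = trans (subst (λ u → Outputs u false) (sym u≡f) out-f u+)
                                   (sym (trans (cong isTrue u≡f) isTrue-f))
        outputs (inj₂ u≡t) = trans (subst (λ u → Outputs u true) (sym u≡t) out-t u+)
                                   (sym (trans (cong isTrue u≡t) isTrue-t))
      from : (∀ φ → eval N t φ ≡ F φ) → Checked N × Outputs t true × Outputs f false
      -- The root has `Factors` because the satisfied root node alone determines the output of the
      -- diagram.
      from D≡F = factors⇒checked distinct N
        (λ u {α} {β} uα uβ _ → trans (sym (D≡F α)) (trans (output-correct u α uα)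
           (trans (sym (output-correct u β uβ)) (D≡F β)))) ,
        (λ nonempty → trans (outputs t nonempty) isTrue-t) ,
        (λ nonempty → trans (outputs f nonempty) isTrue-f)
        where
        outputs : ∀ u → bit (cands N u) ≡ true → F (ov (first u) ff) ≡ isTrue u
        outputs u u+ = trans (sym (D≡F (ov (first u) ff))) (output-correct u (ov (first u) ff)
          (proj₂ (nonempty-hd {Satisfies N u} (cands N u) (cands-satisfy distinct N u) u+) ff))

-- Encodings and the running time

enc-num : ∀ k → ⌜ num k ⌝ ≡ encℕ k
enc-num zero    = refl
enc-num (suc k) = cong (nil ∙_) (enc-num k)

enc-fromBool : ∀ b → ⌜ fromBool b ⌝ ≡ bool b
enc-fromBool true  = refl
enc-fromBool false = refl

enc-tree : ∀ {n} (T : Tree (Fin n)) → ⌜ dTree T ⌝ ≡ encTree T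
enc-tree (leaf x)   = cong (nil ∙_) (enc-num (toℕ x))
enc-tree (node l r) = cong₂ (λ a b → encℕ 1 ∙ a ∙ b) (enc-tree l) (enc-tree r)

enc-tab : ∀ {k} {A : Set} (f : A → Value) (g : Fin k → A) (h : Fin k → Sexp) →
          (∀ u → ⌜ h u ⌝ ≡ f (g u)) → ⌜ dTab h ⌝ ≡ encList (map f (tabulate g))
enc-tab {zero}  f g h eq = refl
enc-tab {suc k} f g h eq = cong₂ _∙_ (eq zero) (enc-tab f (g ∘ suc) (h ∘ suc) (eq ∘ suc))

enc-label : ∀ ℓ → ⌜ dLabel ℓ ⌝ ≡ encLeafLabel ℓ
enc-label pos = refl
enc-label neg = refl
enc-label bot = refl
enc-label top = refl

enc-pairs : ∀ {k₁ k₂} (ps : List (Fin k₁ × Fin k₂)) → ⌜ dPairs ps ⌝ ≡ encPairs ps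
enc-pairs []             = refl
enc-pairs ((v , w) ∷ ps) = cong₂ _∙_ (cong₂ _∙_ (enc-num (toℕ v)) (enc-num (toℕ w))) (enc-pairs ps)

enc-nodes : ∀ {n k} {T : Tree (Fin n)} (N : Nodes T k) → ⌜ dNodes N ⌝ ≡ encNodes N
enc-nodes (leaf {x = x} ℓ _ _) = cong₂ (λ a b → nil ∙ a ∙ b) (enc-num (toℕ x))
  (enc-tab (λ u → encLeafLabel (ℓ u)) (λ u → u) (dLabel ∘ ℓ) (enc-label ∘ ℓ))
enc-nodes (node N₁ N₂ E _) = cong₂ (λ a b → encℕ 1 ∙ a ∙ b) (enc-nodes N₁)
  (cong₂ _∙_ (enc-nodes N₂)
    (enc-tab (λ u → encPairs (elements (E u))) (λ u → u) _ (λ u → enc-pairs (elements (E u)))))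

enc-fins : ∀ {m} (is : List (Fin m)) → ⌜ dFins is ⌝ ≡ encList (map encFin is)
enc-fins []       = refl
enc-fins (i ∷ is) = cong₂ _∙_ (enc-num (toℕ i)) (enc-fins is)

enc-gate : ∀ {n m} (g : Gate (Fin n) m) → ⌜ dGate g ⌝ ≡ encGate g
enc-gate (const b) = cong (nil ∙_) (enc-fromBool b)
enc-gate (lit x b) = cong₂ (λ a c → encℕ 1 ∙ a ∙ c) (enc-num (toℕ x)) (enc-fromBool b)
enc-gate (and i j) = cong₂ (λ a c → encℕ 2 ∙ a ∙ c) (enc-num (toℕ i)) (enc-num (toℕ j))
enc-gate (or is)   = cong (encℕ 3 ∙_) (enc-fins is)

enc-circuit : ∀ {n m} (C : Circuit (Fin n) m) → ⌜ dCircuit C ⌝ ≡ encCircuit C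
enc-circuit []      = refl
enc-circuit (C ▷ g) = cong₂ _∙_ (enc-gate g) (enc-circuit C)

size-num : ∀ {k s} → k ≤ s → size (num k) ≤ 1 + (s + s)
size-num {zero}      _   = s≤s z≤n
size-num {suc k} {suc s} (s≤s k≤s) = s≤s (s≤s (≤-trans (size-num k≤s) (≤-reflexive (sym (+-suc s s)))))

size-fin : ∀ {k s} (i : Fin k) → k ≤ s → size (num (toℕ i)) ≤ 1 + (s + s)
size-fin i k≤s = size-num (≤-trans (<⇒≤ (Fin.toℕ<n i)) k≤s)

size-fromBool : ∀ b → size (fromBool b) ≤ 3
size-fromBool true  = ≤-refl
size-fromBool false = m≤m+n 1 2

size-tab : ∀ {k c} (h : Fin k → Sexp) → (∀ u → size (h u) ≤ c) → size (dTab h) ≤ 1 + k * suc c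
size-tab {zero}  h ≤c = ≤-refl
size-tab {suc k} {c} h ≤c = s≤s (≤-trans (+-mono-≤ (≤c zero) (size-tab (h ∘ suc) (≤c ∘ suc)))
  (≤-reflexive (+-suc c (k * suc c))))

size-label : ∀ ℓ → size (dLabel ℓ) ≤ 7
size-label pos = m≤m+n 1 6
size-label neg = m≤m+n 3 4
size-label bot = m≤m+n 5 2
size-label top = ≤-refl

-- `b` is the size of the number `s` in unary, `P` bounds the edge set of one node, with 2 cells and
-- two numbers for each pair, and `Q` is the share of one node in the encoding. Below, `R` is the
-- share of one unit of `gateSize`. The constants 20 leave slack.
module Sizes (s : ℕ) where

  b = 1 + (s + s)
  P = 1 + s * s * (2 + (b + b))
  Q = 20 + (b + P)

  size-pairs : ∀ {k₁ k₂} → k₁ ≤ s → k₂ ≤ s → (ps : List (Fin k₁ × Fin k₂)) →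
               size (dPairs ps) ≤ 1 + length ps * (2 + (b + b))
  size-pairs k₁≤ k₂≤ []             = ≤-refl
  size-pairs k₁≤ k₂≤ ((v , w) ∷ ps) = s≤s (≤-trans
    (+-mono-≤ (s≤s (+-mono-≤ (size-fin v k₁≤) (size-fin w k₂≤))) (size-pairs k₁≤ k₂≤ ps))
    (≤-reflexive (+-suc (1 + (b + b)) _)))

  length-elements : ∀ {k₁ k₂} (S : Fin k₁ × Fin k₂ → Bool) → length (elements S) ≤ k₁ * k₂
  length-elements {k₁} {k₂} S = ≤-trans (length-filter (T? ∘ S) (cartesianProduct (allFin k₁) (allFin k₂)))
    (≤-reflexive (trans (length-cartesianProduct (allFin k₁) (allFin k₂))
      (cong₂ _*_ (length-tabulate {n = k₁} (λ u → u)) (length-tabulate {n = k₂} (λ u → u)))))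
    where
    length-cartesianProduct : ∀ {A B : Set} (xs : List A) (ys : List B) →
      length (cartesianProduct xs ys) ≡ length xs * length ys
    length-cartesianProduct []       ys = refl
    length-cartesianProduct (x ∷ xs) ys = trans (length-++ (map (x ,_) ys))
      (cong₂ _+_ (length-map (x ,_) ys) (length-cartesianProduct xs ys))

  size-elements : ∀ {k₁ k₂} → k₁ ≤ s → k₂ ≤ s → (S : Fin k₁ × Fin k₂ → Bool) →
                  size (dPairs (elements S)) ≤ P
  size-elements k₁≤ k₂≤ S = ≤-trans (size-pairs k₁≤ k₂≤ (elements S))
    (s≤s (*-monoˡ-≤ (2 + (b + b)) (≤-trans (length-elements S) (*-mono-≤ k₁≤ k₂≤))))

  width≤ : ∀ {X k} {T : Tree X} (N : Nodes T k) → k ≤ nodeCount N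
  width≤ (leaf _ _ _)     = ≤-refl
  width≤ (node _ _ _ _)   = m≤m+n _ _

  size-nodes : ∀ {n k} {T : Tree (Fin n)} → n ≤ s → (N : Nodes T k) → nodeCount N ≤ s →
               size (dNodes N) ≤ nodeCount N * Q
  size-nodes n≤s (leaf {x = x} {k = k} ℓ _ _) _ = begin
    suc (1 + suc (size (num (toℕ x)) + size (dTab (dLabel ∘ ℓ))))
      ≤⟨ s≤s (s≤s (s≤s (+-mono-≤ (size-fin x n≤s) (size-tab (dLabel ∘ ℓ) (size-label ∘ ℓ))))) ⟩
    3 + (b + (1 + suc k * 8))
      ≤⟨ +-monoʳ-≤ 3 (+-mono-≤ (m≤m+n b P) (≤-refl {1 + suc k * 8})) ⟩
    3 + ((b + P) + (1 + suc k * 8))      ≡⟨ arith (b + P) k ⟩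
    12 + ((b + P) + k * 8)               ≤⟨ +-mono-≤ (m≤m+n 12 8) (+-monoʳ-≤ (b + P) (*-monoʳ-≤ k (m≤m+n 8 (12 + (b + P))))) ⟩
    20 + ((b + P) + k * Q)               ∎
    where
    open ≤-Reasoning
    open +-*-Solver
    arith : ∀ c k → 3 + (c + (1 + suc k * 8)) ≡ 12 + (c + k * 8)
    arith = solve 2 (λ c k → con 3 :+ (c :+ (con 1 :+ (con 1 :+ k) :* con 8)) := con 12 :+ (c :+ k :* con 8)) refl
  size-nodes n≤s (node {k₁ = k₁} {k₂} {k} N₁ N₂ E _) count≤s = begin
    4 + suc (size (dNodes N₁) + suc (size (dNodes N₂) + size (dTab (λ u → dPairs (elements (E u))))))
      ≤⟨ +-monoʳ-≤ 5 (+-mono-≤ (size-nodes n≤s N₁ c₁≤s) (s≤s (+-mono-≤ (size-nodes n≤s N₂ c₂≤s)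
           (size-tab _ (λ u → size-elements (≤-trans (width≤ N₁) c₁≤s) (≤-trans (width≤ N₂) c₂≤s) (E u)))))) ⟩
    5 + (c₁ * Q + (1 + (c₂ * Q + (1 + suc k * suc P)))) ≡⟨ arith (c₁ * Q) (c₂ * Q) P k ⟩
    (8 + P) + (k * (1 + P)) + (c₁ * Q + c₂ * Q)
      ≤⟨ +-monoˡ-≤ (c₁ * Q + c₂ * Q) (+-mono-≤ (+-mono-≤ (m≤m+n 8 12) (m≤n+m P b))
           (*-monoʳ-≤ k (+-mono-≤ (m≤m+n 1 19) (m≤n+m P b)))) ⟩
    Q + k * Q + (c₁ * Q + c₂ * Q)        ≡⟨ cong (Q + k * Q +_) (*-distribʳ-+ Q c₁ c₂) ⟨
    suc k * Q + (c₁ + c₂) * Q            ≡⟨ *-distribʳ-+ Q (suc k) (c₁ + c₂) ⟨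
    (suc k + (c₁ + c₂)) * Q              ∎
    where
    open ≤-Reasoning
    open +-*-Solver
    c₁ = nodeCount N₁
    c₂ = nodeCount N₂
    c₁≤s = ≤-trans (≤-trans (m≤m+n c₁ c₂) (m≤n+m (c₁ + c₂) (suc k))) count≤s
    c₂≤s = ≤-trans (≤-trans (m≤n+m c₂ c₁) (m≤n+m (c₁ + c₂) (suc k))) count≤s
    arith : ∀ x y P k → 5 + (x + (1 + (y + (1 + suc k * suc P)))) ≡ (8 + P) + (k * (1 + P)) + (x + y)
    arith = solve 4 (λ x y P k →
      con 5 :+ (x :+ (con 1 :+ (y :+ (con 1 :+ (con 1 :+ k) :* (con 1 :+ P)))))
      := (con 8 :+ P) :+ (k :* (con 1 :+ P)) :+ (x :+ y)) refl

  R = 20 + (b + b)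

  size-fins : ∀ {m} → m ≤ s → (is : List (Fin m)) → size (dFins is) ≤ 1 + length is * suc b
  size-fins m≤s []       = ≤-refl
  size-fins m≤s (i ∷ is) = s≤s (≤-trans (+-mono-≤ (size-fin i m≤s) (size-fins m≤s is))
    (≤-reflexive (+-suc b _)))

  size-dGate : ∀ {n m} → n ≤ s → m ≤ s → (g : Gate (Fin n) m) → 1 + size (dGate g) ≤ gateSize g * R
  size-dGate n≤s m≤s (const c) = ≤-trans (s≤s (s≤s (s≤s (size-fromBool c))))
    (≤-trans (m≤m+n 6 (14 + (b + b))) (m≤m+n R 0))
  size-dGate n≤s m≤s (lit x c) = begin
    5 + (1 + (size (num (toℕ x)) + size (fromBool c)))
      ≤⟨ +-monoʳ-≤ 6 (+-mono-≤ (size-fin x n≤s) (size-fromBool c)) ⟩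
    6 + (b + 3)                  ≡⟨ cong (6 +_) (+-comm b 3) ⟩
    9 + b                        ≤⟨ +-mono-≤ (m≤m+n 9 11) (m≤m+n b b) ⟩
    R                            ≤⟨ m≤m+n R 0 ⟩
    1 * R                        ∎
    where open ≤-Reasoning
  size-dGate n≤s m≤s (and i j) = begin
    8 + (size (num (toℕ i)) + size (num (toℕ j)))
      ≤⟨ +-monoʳ-≤ 8 (+-mono-≤ (size-fin i m≤s) (size-fin j m≤s)) ⟩
    8 + (b + b)                  ≤⟨ +-monoˡ-≤ (b + b) (m≤m+n 8 12) ⟩
    R                            ≤⟨ m≤m+n R (2 * R) ⟩
    3 * R                        ∎
    where open ≤-Reasoning
  size-dGate n≤s m≤s (or is) = begin
    9 + size (dFins is)          ≤⟨ +-monoʳ-≤ 9 (size-fins m≤s is) ⟩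
    10 + length is * suc b
      ≤⟨ +-mono-≤ (≤-trans (m≤m+n 10 10) (m≤m+n 20 (b + b)))
           (*-monoʳ-≤ (length is) (+-mono-≤ (m≤m+n 1 19) (m≤m+n b b))) ⟩
    R + length is * R            ∎
    where open ≤-Reasoning

  size-dCircuit : ∀ {n m} → n ≤ s → m ≤ s → (C : Circuit (Fin n) m) →
                  size (dCircuit C) ≤ 1 + circuitSize C * R
  size-dCircuit n≤s m≤s []      = ≤-refl
  size-dCircuit n≤s m≤s (_▷_ {m} C g) = begin
    suc (size (dGate g)) + size (dCircuit C)
      ≤⟨ +-mono-≤ (size-dGate n≤s m≤s′ g) (size-dCircuit n≤s m≤s′ C) ⟩
    gateSize g * R + (1 + circuitSize C * R)    ≡⟨ +-suc (gateSize g * R) _ ⟩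
    suc (gateSize g * R + circuitSize C * R)    ≡⟨ cong suc (*-distribʳ-+ R (gateSize g) (circuitSize C)) ⟨
    suc ((gateSize g + circuitSize C) * R)      ≡⟨ cong (λ k → suc (k * R)) (+-comm (gateSize g) _) ⟩
    1 + (circuitSize C + gateSize g) * R        ∎
    where
    open ≤-Reasoning
    m≤s′ = ≤-trans (n≤1+n m) m≤s

  size-dTree : ∀ {n} → n ≤ s → (T : Tree (Fin n)) → size (dTree T) ≤ treeSize T * (5 + b)
  size-dTree n≤s (leaf x) = ≤-trans (s≤s (s≤s (size-fin x n≤s))) (≤-trans (m≤n+m (2 + b) 3) (m≤m+n (5 + b) 0))
  size-dTree n≤s (node l r) = begin
    5 + (size (dTree l) + size (dTree r))
      ≤⟨ +-mono-≤ (m≤m+n 5 b) (+-mono-≤ (size-dTree n≤s l) (size-dTree n≤s r)) ⟩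
    (5 + b) + (treeSize l * (5 + b) + treeSize r * (5 + b))
      ≡⟨ cong (5 + b +_) (*-distribʳ-+ (5 + b) (treeSize l) (treeSize r)) ⟨
    (5 + b) + (treeSize l + treeSize r) * (5 + b) ∎
    where open ≤-Reasoning

gates≤circuitSize : ∀ {X m} (C : Circuit X m) → m ≤ circuitSize C
gates≤circuitSize []            = z≤n
gates≤circuitSize (_▷_ {m} C g) = ≤-trans (≤-reflexive (+-comm 1 m))
  (+-mono-≤ (gates≤circuitSize C) (1≤gateSize g))
  where
  1≤gateSize : ∀ {X m} (g : Gate X m) → 1 ≤ gateSize g
  1≤gateSize (const _) = ≤-refl
  1≤gateSize (lit _ _) = ≤-refl
  1≤gateSize (and _ _) = m≤m+n 1 2
  1≤gateSize (or is)   = m≤m+n 1 (length is)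

1≤nodeCount : ∀ {X k} {T : Tree X} (N : Nodes T k) → 1 ≤ nodeCount N
1≤nodeCount (leaf _ _ _)   = s≤s z≤n
1≤nodeCount (node _ _ _ _) = s≤s z≤n

1≤treeSize : ∀ {X} (T : Tree X) → 1 ≤ treeSize T
1≤treeSize (leaf _)   = ≤-refl
1≤treeSize (node _ _) = s≤s z≤n

labels : ∀ {X} → Tree X → List X
labels (leaf x)   = x ∷ []
labels (node l r) = labels l ++ labels r

label∈labels : ∀ {X} (T : Tree X) {x} → LeafVars T x → x ∈ labels T
label∈labels (leaf x)   (_ , refl)    = here refl
label∈labels (node l r) (inj₁ p , eq) = ∈-++⁺ˡ (label∈labels l (p , eq))
label∈labels (node l r) (inj₂ p , eq) = ∈-++⁺ʳ (labels l) (label∈labels r (p , eq))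

length-labels : ∀ {X} (T : Tree X) → length (labels T) ≤ treeSize T
length-labels (leaf _)   = ≤-refl
length-labels (node l r) = ≤-trans (≤-reflexive (length-++ (labels l)))
  (m≤n⇒m≤1+n (+-mono-≤ (length-labels l) (length-labels r)))

-- Variables are written in unary, so their number has to be bounded by the input size. Distinct
-- variables occur at distinct positions among the labels of the leaves.
variables≤treeSize : ∀ {n} (T : Tree (Fin n)) → (∀ x → LeafVars T x) → n ≤ treeSize T
variables≤treeSize T covers = ≤-trans
  (Fin.injective⇒≤ {f = λ x → Any.index (x∈ x)} (λ {x} {y} eq →
    trans (lookup-index (x∈ x)) (trans (cong (List.lookup (labels T)) eq) (sym (lookup-index (x∈ y))))))
  (length-labels T)
  where
  x∈ : ∀ x → x ∈ labels T
  x∈ x = label∈labels T (covers x)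

vtree-distinct : ∀ {X} (V : Vtree X) → Distinct (tree V)
vtree-distinct V = proj₁ (bijective V)

vtree-covers : ∀ {X} (V : Vtree X) → ∀ x → LeafVars (tree V) x
vtree-covers V x = let p , eq = proj₂ (bijective V) x in p , eq refl

module Instance {n} {V V′ : Vtree (Fin n)} (D : BooleanTDD V) (D′ : DSDNNF V′) where

  open DSDNNF D′ using (circuit; outputGate; structured; deterministic)
  open Bijection (TDD.outNode D) using () renaming (to to node-of; injective to node-injective; strictlySurjective to node-surjective)

  N = TDD.nodes D

  input : Sexp
  input = (dNodes N ◂ num (toℕ (node-of false)) ◂ num (toℕ (node-of true)))
        ◂ dTree (tree V′) ◂ dCircuit circuit ◂ num (toℕ outputGate)

  enc-input : ⌜ input ⌝ ≡ encTDD D ∙ encDSDNNF D′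
  enc-input = cong₂ _∙_
    (cong₂ _∙_ (enc-nodes N) (cong₂ _∙_ (enc-num (toℕ (node-of false))) (enc-num (toℕ (node-of true)))))
    (cong₂ _∙_ (enc-tree (tree V′)) (cong₂ _∙_ (enc-circuit circuit) (enc-num (toℕ outputGate))))

  decision-correct : bit (run decisionF input) ≡ true ⇔ computedByTDD D ≋ computedByDSDNNF D′
  decision-correct = Correctness.main-correct (tree V′) (vtree-distinct V′) (vtree-covers V′)
    circuit outputGate structured deterministic (vtree-distinct V) (vtree-covers V) N
    (node-of false) (node-of true) false≢true false-or-true
    where
    false≢true : node-of false ≢ node-of true
    false≢true eq with node-injective eq
    ... | ()
    false-or-true : ∀ u → u ≡ node-of false ⊎ u ≡ node-of true
    false-or-true u with node-surjective u
    ... | false , eq = inj₁ (sym eq)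
    ... | true  , eq = inj₂ (sym eq)

  s : ℕ
  s = TDD.size D + DSDNNF.size D′

  2≤s : 2 ≤ s
  2≤s = +-mono-≤ (1≤nodeCount N) (≤-trans (1≤treeSize (tree V′)) (m≤n+m _ (circuitSize circuit)))

  open Sizes s

  size-input : size input ≤ 20 + (s * Q + (s * R + (s * (5 + b) + (b + (b + b)))))
  size-input = begin
    suc (suc (x + suc (f + t)) + suc (y + suc (z + o)))   ≡⟨ arith x f t y z o ⟩
    5 + (x + (z + (y + (f + (t + o)))))
      ≤⟨ +-monoʳ-≤ 5 (+-mono-≤ x≤ (+-mono-≤ z≤ (+-mono-≤ y≤ (+-mono-≤ (size-fin (node-of false) w≤s)
           (+-mono-≤ (size-fin (node-of true) w≤s) (size-fin outputGate m≤s)))))) ⟩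
    5 + (s * Q + ((1 + s * R) + (s * (5 + b) + (b + (b + b)))))
      ≡⟨ cong (5 +_) (+-suc (s * Q) _) ⟩
    6 + (s * Q + (s * R + (s * (5 + b) + (b + (b + b))))) ≤⟨ +-monoˡ-≤ _ (m≤m+n 6 14) ⟩
    20 + (s * Q + (s * R + (s * (5 + b) + (b + (b + b))))) ∎
    where
    open ≤-Reasoning
    x = size (dNodes N)
    f = size (num (toℕ (node-of false)))
    t = size (num (toℕ (node-of true)))
    y = size (dTree (tree V′))
    z = size (dCircuit circuit)
    o = size (num (toℕ outputGate))
    N≤s : nodeCount N ≤ s
    N≤s = m≤m+n _ _
    C≤s : circuitSize circuit ≤ s
    C≤s = ≤-trans (m≤m+n _ (treeSize (tree V′))) (m≤n+m _ (nodeCount N))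
    T≤s : treeSize (tree V′) ≤ s
    T≤s = ≤-trans (m≤n+m _ (circuitSize circuit)) (m≤n+m _ (nodeCount N))
    n≤s : n ≤ s
    n≤s = ≤-trans (variables≤treeSize (tree V′) (vtree-covers V′)) T≤s
    m≤s : DSDNNF.gates D′ ≤ s
    m≤s = ≤-trans (gates≤circuitSize circuit) C≤s
    w≤s : TDD.width D ≤ s
    w≤s = ≤-trans (width≤ N) N≤s
    x≤ : x ≤ s * Q
    x≤ = ≤-trans (size-nodes n≤s N N≤s) (*-monoˡ-≤ Q N≤s)
    y≤ : y ≤ s * (5 + b)
    y≤ = ≤-trans (size-dTree n≤s (tree V′)) (*-monoˡ-≤ (5 + b) T≤s)
    z≤ : z ≤ 1 + s * R
    z≤ = ≤-trans (size-dCircuit n≤s m≤s circuit) (s≤s (*-monoˡ-≤ R C≤s))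
    arith : ∀ x f t y z o → suc (suc (x + suc (f + t)) + suc (y + suc (z + o))) ≡ 5 + (x + (z + (y + (f + (t + o)))))
    arith = solve 6 (λ x f t y z o →
      con 1 :+ ((con 1 :+ (x :+ (con 1 :+ (f :+ t)))) :+ (con 1 :+ (y :+ (con 1 :+ (z :+ o)))))
      := con 5 :+ (x :+ (z :+ (y :+ (f :+ (t :+ o)))))) refl
      where open +-*-Solver

-- The measure has to be positive, hence `suc`; the bounds are powers of `2 + s`.
module ℕ-Growth = Growth {ℕ} suc (λ _ → s≤s z≤n)

inputBound : ℕ → ℕ
inputBound s = 20 + (s * Q + (s * R + (s * (5 + b) + (b + (b + b)))))
  where open Sizes s

open ℕ-Growth using () renaming
  (poly-const to con; poly-+ to infixr 6 _⊕_; poly-* to infixr 7 _⊗_)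

inputBound-poly : ℕ-Growth.Poly inputBound
inputBound-poly = con 20 ⊕ s ⊗ Q ⊕ s ⊗ R ⊕ s ⊗ (con 5 ⊕ b) ⊕ b ⊕ b ⊕ b
  where
  s : ℕ-Growth.Poly (λ s → s)
  s = ℕ-Growth.poly-≤ n≤1+n ℕ-Growth.poly-μ
  b = con 1 ⊕ s ⊕ s
  P = con 1 ⊕ (s ⊗ s) ⊗ (con 2 ⊕ b ⊕ b)
  Q = con 20 ⊕ b ⊕ P
  R = con 20 ⊕ b ⊕ b

boolF-run : ∀ c x → run (boolF c) x ≡ fromBool (bit (run c x))
boolF-run c x with bit (run c x)
... | true  = refl
... | false = refl

programF : Fn
programF = boolF decisionF

timeBound-poly : ℕ-Growth.Poly (λ s → suc (inputBound s) ^ proj₁ (time-poly programF))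
timeBound-poly = ℕ-Growth.poly-^ (con 1 ⊕ inputBound-poly) (proj₁ (time-poly programF))

-- The factor 2 turns powers of `2 + s` into powers of `s`: `2 + s ≤ s * s` for `s ≥ 2`, which holds
-- because the diagram and the vtree of the circuit have at least one node each.
exponent : ℕ
exponent = 2 * proj₁ timeBound-poly

program-time : ∀ s x → 2 ≤ s → size x ≤ inputBound s → time programF x ≤ 1 * s ^ exponent + 1
program-time s x 2≤s x≤ = begin
  time programF x                  ≤⟨ proj₂ (time-poly programF) x ⟩
  suc (size x) ^ e                 ≤⟨ ^-monoˡ-≤ e (s≤s x≤) ⟩
  suc (inputBound s) ^ e           ≤⟨ proj₂ timeBound-poly s ⟩
  (2 + s) ^ q                      ≤⟨ ^-monoˡ-≤ q (≤-trans (+-monoˡ-≤ s 2≤s) (≤-trans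
                                        (≤-reflexive (cong (s +_) (sym (+-identityʳ s)))) (*-monoˡ-≤ s 2≤s))) ⟩
  (s * s) ^ q                      ≡⟨ cong (λ m → (s * m) ^ q) (*-identityʳ s) ⟨
  (s ^ 2) ^ q                      ≡⟨ ^-*-assoc s 2 q ⟩
  s ^ exponent                     ≤⟨ m≤m+n (s ^ exponent) 0 ⟩
  1 * s ^ exponent                 ≤⟨ m≤m+n (1 * s ^ exponent) 1 ⟩
  1 * s ^ exponent + 1             ∎
  where
  open ≤-Reasoning
  e = proj₁ (time-poly programF)
  q = proj₁ timeBound-poly

lemma16 : ∃[ M ] ∃[ c ] ∃[ k ] ((n : ℕ) (V V′ : Vtree (Fin n)) (D : BooleanTDD V) (D′ : DSDNNF V′) →
    DecidesWithin M (encTDD D ∙ encDSDNNF D′)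
    (computedByTDD D ≋ computedByDSDNNF D′)
    (c * (TDD.size D + DSDNNF.size D′) ^ k + c))
lemma16 = code programF zero , 1 , exponent , λ n V V′ D D′ →
  let open Instance D D′
      t , derivation , t≤ = evaluates programF ((encTDD D ∙ encDSDNNF D′) ∷ []) zero input (sym enc-input)
  in bit (run decisionF input) , t ,
     subst (λ v → ((encTDD D ∙ encDSDNNF D′) ∷ []) ⊢ code programF zero ⇓ v ⟨ t ⟩)
       (trans (cong ⌜_⌝ (boolF-run decisionF input)) (enc-fromBool (bit (run decisionF input)))) derivation ,
     ≤-trans t≤ (program-time s input 2≤s size-input) ,
     decision-correct
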